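{- The optimal deterministic $(3+2\sqrt2)$-competitive algorithm Greedy (of Awerbuch et al.), the $5$-competitive randomized algorithm Balance (of Caragiannis), and a new optimal $4$-competitive fractional algorithm (FracBalance) for the online load balancing problem on unrelated machines can all be analyzed through a simple dual fitting argument on the same semidefinite programming relaxation (SDP-LB).
   Context: Problem: a finite set of machines $M$ is given; jobs $J=\{1,\dots,n\}$ arrive online in this (adversarial) order. When $j$ arrives it reveals a nonempty set $\mathcal S_j\subseteq M$ of feasible machines and weights $w_{ij}\ge0$ for $i\in\mathcal S_j$, and it must be assigned irrevocably. An integral (respectively fractional) assignment is $x$ with $x_{ij}\in\{0,1\}$ (respectively $x_{ij}\in[0,1]$), $\sum_{i\in\mathcal S_j}x_{ij}=1$ for each $j$, and $x_{ij}=0$ for $i\notin\mathcal S_j$. Loads: $L_i^{(j)}(x)=\sum_{k\le j}w_{ik}x_{ik}$, $L_i^{(0)}=0$, $L_i(x)=L_i^{(n)}(x)$. The cost is $\sum_{i\in M}L_i(x)^2$ (in expectation for a randomized algorithm). An algorithm is $c$-competitive if on every instance its (expected) cost is at most $c$ times the minimum cost of an integral assignment. "Optimal" means that no algorithm of the same class has a smaller competitive ratio: for Greedy the class is that of deterministic (integral) online algorithms, for FracBalance that of fractional online algorithms. Relaxation (SDP-LB), in dual vector form: variables $y_j\in\mathbb R$ ($j\in J$), $\nu\in\mathbb R^M$, $v_{ij}\in\mathbb R^M$ ($j\in J$, $i\in\mathcal S_j$); maximize $\sum_{j\in J}y_j-\frac12\|\nu\|^2$ subject to $y_j\le w_{ij}^2-\frac12\|v_{ij}\|^2+\langle\nu,v_{ij}\rangle$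 for all $j\in J$, $i\in\mathcal S_j$, and $\langle v_{ij},v_{i'k}\rangle\le2\,w_{ij}w_{i'k}\mathbf 1_{\{i=i'\}}$ for all $(i,j)\ne(i',k)$. By weak duality the value of any feasible solution is a lower bound on the minimum cost of an integral assignment. Dual fitting argument: for an algorithm with competitive ratio $c$, one builds from the solution output by the algorithm on an instance a feasible solution of (SDP-LB) whose objective value is at least $1/c$ times the (expected) cost of the algorithm; by weak duality the algorithm is $c$-competitive. Here $c=3+2\sqrt2$ for Greedy, $c=5$ for Balance, $c=4$ for FracBalance. For Greedy the argument is carried out in the more general hypergraph model, where $\mathcal S_j\subseteq2^M$ is a collection of subsets of machines, $x_{ij}\in\{0,1\}$ indicates that $j$ is assigned to the subset $i\in\mathcal S_j$, the load of $e\in M$ is $L_e(x)=\sum_{j}w_{ej}\sum_{i\in\mathcal S_j:e\in i}x_{ij}$, and in (SDP-LB) $w_{ij}^2$ is replaced by $\sum_{e\in i}w_{ej}^2$ and the right-hand side of the second constraint by $2\sum_{e\in i\cap i'}w_{ej}w_{ek}$; the standard model is the case of singletons. Greedy: when $j$ arrives, set $x_{ij}=1$ for an $i\in\mathcal S_j$ giving the minimal increase of the global objective $\sum_{e\in M}L_e^2$. Balance: when $j$ arrives, let $f_{ij}(t)=w_{ij}^2+4w_{ij}\big(\mathbb E[L_i^{(j-1)}(X)]+t\,w_{ij}\big)$ for $i\in\mathcal S_j$, $t\in[0,1]$; compute $x_{ij}\ge0$ ($i\in\mathcal S_j$) with $\sum_{i}x_{ij}=1$ and $\sum_{e}x_{ej}f_{ej}(x_{ej})\le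 f_{ij}(x_{ij})$ for all $i\in\mathcal S_j$; then, independently of all other jobs, assign $j$ to $i$ (set $X_{ij}=1$) with probability $x_{ij}$. FracBalance: when $j$ arrives, let $f_{ij}(t)=w_{ij}\big(2L_i^{(j-1)}(x)+t\,w_{ij}\big)$ for $i\in\mathcal S_j$, $t\in[0,1]$; output $x_{ij}\ge0$ ($i\in\mathcal S_j$) with $\sum_{i}x_{ij}=1$ and $\sum_{e}x_{ej}f_{ej}(x_{ej})\le f_{ij}(x_{ij})$ for all $i\in\mathcal S_j$. -}

module Defs where

open import Level using (0ℓ)
open import Algebra.Bundles using (CommutativeRing)
import Algebra.Definitions.RawMonoid
open import Data.Bool using (Bool; if_then_else_)
open import Data.Fin using (Fin; toℕ) renaming (zero to fzero; suc to fsuc)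
import Data.Fin as Fin
open import Data.Fin.Subset using (Subset; _∩_)
open import Data.Fin.Subset.Properties using (_∈?_)
open import Data.List using (List; []; length; lookup; take; foldr)
open import Data.List.Membership.Propositional using (_∈_; _∉_)
open import Data.List.Relation.Unary.Unique.Propositional using (Unique)
open import Data.Nat using (ℕ; zero; suc; _<ᵇ_)
open import Data.Product using (Σ-syntax; ∃; ∃-syntax; _×_)
open import Data.Sum using (_⊎_)
import Data.Vec.Functional as Vector
open import Function using (_∘_)
open import Relation.Binary using (Rel; IsDecTotalOrder)
open import Relation.Binary.PropositionalEquality using (_≡_; _≢_)
open import Relation.Nullary using (¬_)
open import Relation.Nullary.Decidable using (⌊_⌋)
open import Relation.Unary using (Pred)

-- The real numbers, axiomatised up to isomorphism as a complete ordered field.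
-- The order is decidable because real analysis is meant classically;
-- x ⁻¹ is only specified for x ≉ 0.
record CompleteOrderedField : Set₁ where
  infix  4 _≤_
  infixl 8 _⁻¹
  field
    commutativeRing : CommutativeRing 0ℓ 0ℓ

  open CommutativeRing commutativeRing public

  field
    _⁻¹             : Carrier → Carrier
    ⁻¹-inverseʳ     : ∀ x → ¬ (x ≈ 0#) → x * x ⁻¹ ≈ 1#
    1≉0             : ¬ (1# ≈ 0#)
    _≤_             : Rel Carrier 0ℓ
    isDecTotalOrder : IsDecTotalOrder _≈_ _≤_
    +-monoˡ-≤       : ∀ z {x y} → x ≤ y → x + z ≤ y + z
    *-nonNegative   : ∀ {x y} → 0# ≤ x → 0# ≤ y → 0# ≤ x * y

  IsUpperBound : Pred Carrier 0ℓ → Carrier → Set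
  IsUpperBound P u = ∀ x → P x → x ≤ u

  field
    supremum : (P : Pred Carrier 0ℓ) → ∃ P → ∃ (IsUpperBound P) →
               ∃[ s ] (IsUpperBound P s × (∀ u → IsUpperBound P u → s ≤ u))

module LoadBalancing (R : CompleteOrderedField) where
  open CompleteOrderedField R renaming (Carrier to ℝ)
  open Algebra.Definitions.RawMonoid +-rawMonoid using (sum) renaming (_×_ to _×ᵐ_)

  infixl 8 _²

  fromℕ : ℕ → ℝ
  fromℕ n = n ×ᵐ 1#

  ½ : ℝ
  ½ = fromℕ 2 ⁻¹

  _² : ℝ → ℝ
  x ² = x * x

  ⟨_,_⟩ : ∀ {m} → (Fin m → ℝ) → (Fin m → ℝ) → ℝ
  ⟨ a , b ⟩ = sum (λ e → a e * b e)

  ‖_‖² : ∀ {m} → (Fin m → ℝ) → ℝ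
  ‖ a ‖² = ⟨ a , a ⟩

  ∑∈ : {O : Set} → List O → (O → ℝ) → ℝ
  ∑∈ S f = foldr (λ i s → f i + s) 0# S

  when : Bool → ℝ → ℝ
  when b x = if b then x else 0#

  -- What distinguishes the standard from the hypergraph model.  The machines
  -- are Fin m, and i : Option m is something a job may be assigned to.
  record Model : Set₁ where
    field
      Option : ℕ → Set
      -- whether e is used by option i
      uses   : ∀ {m} → Option m → Fin m → Bool
      -- the fraction of a job on machine e, if it is assigned as x over S
      share  : ∀ {m} → List (Option m) → (Option m → ℝ) → Fin m → ℝ
      -- the terms in the two constraints of (SDP-LB) depending on the weights
      diagonal : ∀ {m} → (Fin m → ℝ) → Option m → ℝ
      cross    : ∀ {m} → (Fin m → ℝ) → (Fin m → ℝ) → Option m → Option m → ℝ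

  standard : Model
  standard = record
    { Option   = Fin
    ; uses     = λ i e → ⌊ i Fin.≟ e ⌋
    ; share    = λ S x e → x e
    ; diagonal = λ w i → w i ²
    ; cross    = λ w w′ i i′ → when ⌊ i Fin.≟ i′ ⌋ (fromℕ 2 * (w i * w′ i′))
    }

  hypergraph : Model
  hypergraph = record
    { Option   = Subset
    ; uses     = λ i e → ⌊ e ∈? i ⌋
    ; share    = λ S x e → ∑∈ S (λ i → when ⌊ e ∈? i ⌋ (x i))
    ; diagonal = λ w i → sum (λ e → when ⌊ e ∈? i ⌋ (w e ²))
    ; cross    = λ w w′ i i′ →
                   fromℕ 2 * sum (λ e → when ⌊ e ∈? (i ∩ i′) ⌋ (w e * w′ e))
    }

  module _ (M : Model) where
    open Model M

    -- The weight of a job on a machine that none of its feasible options uses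
    -- plays no role, so nonnegativity can be required of all weights.
    record Job (m : ℕ) : Set where
      field
        feasible : List (Option m)
        unique   : Unique feasible
        nonempty : feasible ≢ []
        weight   : Fin m → ℝ
        weight≥0 : ∀ e → 0# ≤ weight e
    open Job

    -- jobs in the order of their arrival
    Instance : ℕ → Set
    Instance m = List (Job m)

    Assignment : ∀ {m} → Instance m → Set
    Assignment {m} I = Option m → Fin (length I) → ℝ

    record FractionalChoice {m} (J : Job m) (x : Option m → ℝ) : Set where
      field
        x≥0        : ∀ i → 0# ≤ x i
        x≤1        : ∀ i → x i ≤ 1#
        total      : ∑∈ (feasible J) x ≈ 1#
        infeasible : ∀ i → i ∉ feasible J → x i ≈ 0#

    IntegralChoice : ∀ {m} → Job m → (Option m → ℝ) → Set
    IntegralChoice J x = FractionalChoice J x × (∀ i → x i ≈ 0# ⊎ x i ≈ 1#)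

    IsIntegral : ∀ {m} (I : Instance m) → Assignment I → Set
    IsIntegral I x = ∀ j → IntegralChoice (lookup I j) (λ i → x i j)

    -- Load of e due to the first t jobs.  As jobs are numbered from 0 here,
    -- the load just before the arrival of j is loadUpTo I x (toℕ j) e.
    loadUpTo : ∀ {m} (I : Instance m) → Assignment I → ℕ → Fin m → ℝ
    loadUpTo I x t e = sum λ k → when (toℕ k <ᵇ t)
      (weight (lookup I k) e * share (feasible (lookup I k)) (λ i → x i k) e)

    load : ∀ {m} (I : Instance m) → Assignment I → Fin m → ℝ
    load I x = loadUpTo I x (length I)

    CostFunction : Set
    CostFunction = ∀ {m} (I : Instance m) → Assignment I → ℝ

    cost : CostFunction
    cost I x = sum λ e → load I x e ²

    record DualSolution {m} (I : Instance m) : Set where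
      field
        y : Fin (length I) → ℝ
        ν : Fin m → ℝ
        v : Option m → Fin (length I) → Fin m → ℝ

    -- (SDP-LB); v i j is a variable only for i ∈ feasible (lookup I j).
    record DualFeasible {m} (I : Instance m) (d : DualSolution I) : Set where
      open DualSolution d
      field
        y-bound : ∀ j i → i ∈ feasible (lookup I j) →
          y j ≤ diagonal (weight (lookup I j)) i - ½ * ‖ v i j ‖² + ⟨ ν , v i j ⟩
        v-bound : ∀ j i k i′ →
          i ∈ feasible (lookup I j) → i′ ∈ feasible (lookup I k) →
          ¬ (i ≡ i′ × j ≡ k) →
          ⟨ v i j , v i′ k ⟩ ≤
            cross (weight (lookup I j)) (weight (lookup I k)) i i′

    objective : ∀ {m} (I : Instance m) → DualSolution I → ℝ
    objective I d = sum y - ½ * ‖ ν ‖²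
      where open DualSolution d

    WeakDuality : Set
    WeakDuality = ∀ {m} (I : Instance m) (d : DualSolution I) (x : Assignment I) →
      DualFeasible I d → IsIntegral I x → objective I d ≤ cost I x

    -- Maps the jobs that arrived earlier and the current job to the
    -- assignment of the current job.
    Algorithm : Set
    Algorithm = ∀ {m} → List (Job m) → Job m → Option m → ℝ

    run : Algorithm → ∀ {m} (I : Instance m) → Assignment I
    run A I i j = A (take (toℕ j) I) (lookup I j) i

    AlgorithmClass : Set₁
    AlgorithmClass = Algorithm → Set

    Fractional : AlgorithmClass
    Fractional A = ∀ {m} (past : List (Job m)) J → FractionalChoice J (A past J)

    Deterministic : AlgorithmClass
    Deterministic A = ∀ {m} (past : List (Job m)) J → IntegralChoice J (A past J)

    -- what a solution has to satisfy at a job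
    Rule : Set₁
    Rule = ∀ {m} (I : Instance m) → Assignment I → Fin (length I) → Set

    Follows : Rule → Algorithm → Set
    Follows rule A = ∀ {m} (I : Instance m) j → rule I (run A I) j

    -- Bounding the cost by c times the cost of every integral assignment
    -- bounds it by c times the minimum.
    Competitive : CostFunction → Algorithm → ℝ → Set
    Competitive costOf A c = ∀ {m} (I : Instance m) (z : Assignment I) →
      IsIntegral I z → costOf I (run A I) ≤ c * cost I z

    -- The solution fitted to an instance depends on the algorithm only through
    -- its output.
    DualFitting : AlgorithmClass → Rule → CostFunction → ℝ → Set
    DualFitting Class rule costOf c =
      Σ[ fit ∈ (∀ {m} (I : Instance m) → Assignment I → DualSolution I) ]
        ((A : Algorithm) → Class A → Follows rule A → ∀ {m} (I : Instance m) →
          DualFeasible I (fit I (run A I)) ×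
          c ⁻¹ * costOf I (run A I) ≤ objective I (fit I (run A I)))

    AnalyzedByDualFitting : AlgorithmClass → Rule → CostFunction → ℝ → Set
    AnalyzedByDualFitting Class rule costOf c =
      (Σ[ A ∈ Algorithm ] (Class A × Follows rule A)) ×
      DualFitting Class rule costOf c ×
      ((A : Algorithm) → Class A → Follows rule A → Competitive costOf A c)

    OptimalRatio : AlgorithmClass → ℝ → Set
    OptimalRatio Class c = (A : Algorithm) → Class A →
      ∀ c′ → Competitive cost A c′ → c ≤ c′

    greedy : Rule
    greedy {m} I x j =
      ∃[ i ] (i ∈ S × x i j ≈ 1# × (∀ i′ → i′ ∈ S → increase i ≤ increase i′))
      where
      S = feasible (lookup I j)

      before : Fin m → ℝ
      before = loadUpTo I x (toℕ j)

      increase : Option m → ℝ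
      increase i =
        sum (λ e → (before e + when (uses i e) (weight (lookup I j) e)) ²)
        - sum (λ e → before e ²)

  open Job

  -- Expectation of g over independent σ j, with σ j = i of probability p j i.
  expectation : ∀ {m} n → (Fin n → Fin m → ℝ) → ((Fin n → Fin m) → ℝ) → ℝ
  expectation zero    p g = g Vector.[]
  expectation (suc n) p g =
    sum λ i → p fzero i * expectation n (p ∘ fsuc) (λ σ → g (i Vector.∷ σ))

  -- Expectation of g X for the random integral assignment X that assigns each
  -- job j independently to i with probability x i j.
  𝔼 : ∀ {m} (I : Instance standard m) → Assignment standard I →
      (Assignment standard I → ℝ) → ℝ
  𝔼 I x g = expectation (length I) (λ j i → x i j)
    (λ σ → g (λ i j → when ⌊ σ j Fin.≟ i ⌋ 1#))

  expectedCost : CostFunction standard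
  expectedCost I x = 𝔼 I x (cost standard I)

  -- Σₑ xₑⱼ fₑⱼ(xₑⱼ) ≤ fᵢⱼ(xᵢⱼ) for all i ∈ Sⱼ
  Balanced : ∀ {m} (I : Instance standard m) → Assignment standard I →
             Fin (length I) → (Fin m → ℝ → ℝ) → Set
  Balanced I x j f = ∀ i → i ∈ S → ∑∈ S (λ e → x e j * f e (x e j)) ≤ f i (x i j)
    where S = feasible (lookup I j)

  -- x holds the probabilities of the random assignment X.
  balance : Rule standard
  balance I x j = Balanced I x j λ i t →
    let w = weight (lookup I j) i in
    w ² + fromℕ 4 * w *
      (𝔼 I x (λ X → loadUpTo standard I X (toℕ j) i) + t * w)

  fracBalance : Rule standard
  fracBalance I x j = Balanced I x j λ i t →
    let w = weight (lookup I j) i in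
    w * (fromℕ 2 * loadUpTo standard I x (toℕ j) i + t * w)

{-# OPTIONS --safe #-}
-- The vectors fitted to a solution are as simple as possible: v i j is α times
-- the restriction of the weights of j to the machines of i, and ν is β times the
-- vector of final loads.  The second constraint then says α² ≤ 2, the bound on
-- y j becomes (1 - α²/2) ‖a‖² + βα ⟨load, a⟩, and each algorithm's decision rule
-- provides a y j of this size proportional to what it pays for j, so that only
-- α and β remain to be optimised.
--
-- The lower bounds come from adaptive adversaries.  Against a deterministic
-- algorithm, machines of equal load are paired with jobs of weight √2ᵏ in
-- round k, and only the machine chosen by the algorithm stays in the game; the
-- offline solution uses the other one.  Against a fractional algorithm, every
-- job may use all remaining machines, and the least loaded one is removed and
-- used offline; comparing the costs is Hardy's inequality, whose constant is 4.
module Submission where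

open import Algebra.Bundles using (RawRing)
import Algebra.Definitions.RawMonoid
open import Algebra.Solver.Ring.AlmostCommutativeRing using (fromCommutativeRing; _-Raw-AlmostCommutative⟶_; Induced-equivalence)
open import Data.Bool using (Bool; true; false; T)
open import Data.Bool.Properties using () renaming (_≟_ to _≟ᵇ_)
open import Data.Fin using (Fin; toℕ) renaming (zero to fzero; suc to fsuc; _≟_ to _≟ᶠ_)
open import Data.Fin.Properties using (suc-injective)
open import Data.Fin.Subset using (Subset; _∩_)
open import Data.Fin.Subset.Properties using (_∈?_; x∈p∩q⁺; x∈p∩q⁻)
open import Data.List using (List; []; _∷_; _++_; length; lookup; take; drop; foldl; allFin)
open import Data.List.Membership.Propositional using (_∈_; _∉_; find; lose)
open import Data.List.Membership.Propositional.Properties using (∈-∃++; ∈-allFin; ∈-++⁺ˡ; ∈-++⁺ʳ)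
open import Data.List.Properties using (++-identityʳ; ++-assoc; length-take; length-drop; take++drop≡id; length-tabulate)
open import Data.List.Relation.Binary.Permutation.Propositional using (_↭_; ↭-refl; ↭-sym; ↭-trans; ↭-prep; ↭-swap; ↭⇒↭ₛ)
open import Data.List.Relation.Binary.Permutation.Propositional.Properties using (shift; ↭-length; ∈-resp-↭) renaming (++⁺ to ↭-++⁺)
open import Data.List.Relation.Binary.Permutation.Setoid.Properties using (Unique-resp-↭)
open import Data.List.Relation.Unary.All as All using (All) renaming (_∷_ to _∷ᵃ_)
open import Data.List.Relation.Unary.All.Properties using (++⁺; ++⁻ˡ; ++⁻ʳ)
open import Data.List.Relation.Unary.AllPairs as AllPairs using () renaming ([] to []ᵘ; _∷_ to _∷ᵘ_)
open import Data.List.Relation.Unary.Any using (here; there; any?)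
open import Data.List.Relation.Unary.Unique.Propositional using (Unique)
open import Data.List.Relation.Unary.Unique.Propositional.Properties using (allFin⁺)
import Data.Maybe as Maybe
open import Data.Nat using (ℕ; zero; suc; _<ᵇ_)
import Data.Nat as ℕ
import Data.Nat.Properties as ℕₚ
open import Data.Product using (∃-syntax; _×_; _,_; proj₁; proj₂)
open import Data.Sum using (_⊎_; inj₁; inj₂; [_,_]′)
import Data.Vec.Functional as Vector
open import Data.Vec.N-ary using (N-ary; Eq; curryⁿ; curryⁿ-cong)
open import Data.Vec.Properties using (≡-dec)
open import Function using (id)
open import Relation.Binary using (DecidableEquality; IsDecTotalOrder; Poset; WeaklyDecidable)
open import Relation.Binary.PropositionalEquality as ≡ using (_≡_; _≢_)
open import Relation.Nullary using (¬_; Dec; yes; no; contradiction; toSum)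
open import Relation.Nullary.Decidable using (⌊_⌋)
open import Defs

-- The field is arbitrary and its equality a setoid, so nothing about numbers holds by computation.
-- Inequalities are therefore mostly brought to one shape: the difference of the two sides equals,
-- by a polynomial identity over the rationals, an expression that is visibly nonnegative. Relations
-- such as `r * r ≈ 2` and the defining equations of inverses enter these identities as explicit
-- multiples. Completeness is used for three things: square roots, the existence of the assignments
-- that Balance and FracBalance ask for, and the unboundedness of certain sequences.
--
-- Balance charges a job more than the growth of the fractional cost, because the expected cost also
-- contains the variance of the loads; the surplus pays for it.
--
-- The adversaries stop after finitely many rounds, so their instances miss the optimal ratio by an
-- error term. The weights are chosen such that the offline cost outgrows the error, which then
-- disappears in the limit.

-- Arithmetic of an ordered field

module OrderedField (R : CompleteOrderedField) where
  open CompleteOrderedField R renaming (Carrier to ℝ) public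
  module LB = LoadBalancing R
  open LB using (fromℕ; ½; _²) public
  open IsDecTotalOrder isDecTotalOrder public using (_≤?_; _≟_; total; antisym)
    renaming (refl to ≤-refl; reflexive to ≤-reflexive; trans to ≤-trans; isPartialOrder to ≤-isPartialOrder)
  open import Algebra.Properties.Ring ring using (-1*x≈-x; -‿involutive)
  open import Algebra.Properties.Semiring.Mult semiring using (×-homo-+; ×1-homo-*)

  private
    module ≈-Reasoning where
      open import Relation.Binary.Reasoning.Setoid setoid public

  ≤-cong : ∀ {a b c d} → a ≈ b → c ≈ d → a ≤ c → b ≤ d
  ≤-cong a≈b c≈d a≤c = ≤-trans (≤-reflexive (sym a≈b)) (≤-trans a≤c (≤-reflexive c≈d))

  +-mono-≤ : ∀ {a b c d} → a ≤ b → c ≤ d → a + c ≤ b + d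
  +-mono-≤ {a} {b} {c} {d} a≤b c≤d = ≤-trans (+-monoˡ-≤ c a≤b)
    (≤-cong (+-comm c b) (+-comm d b) (+-monoˡ-≤ b c≤d))

  0≤1 : 0# ≤ 1#
  0≤1 with total 0# 1#
  ... | inj₁ 0≤1 = 0≤1
  ... | inj₂ 1≤0 = ≤-cong refl (trans (-1*x≈-x (- 1#)) (-‿involutive 1#)) (*-nonNegative 0≤-1 0≤-1)
    where
    0≤-1 : 0# ≤ - 1#
    0≤-1 = ≤-cong (-‿inverseʳ 1#) (+-identityˡ (- 1#)) (+-monoˡ-≤ (- 1#) 1≤0)

  fromℕ≥0 : ∀ n → 0# ≤ fromℕ n
  fromℕ≥0 zero    = ≤-refl
  fromℕ≥0 (suc n) = ≤-cong (+-identityˡ 0#) refl (+-mono-≤ 0≤1 (fromℕ≥0 n))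

  fromℕ≉0 : ∀ n → ¬ (fromℕ (suc n) ≈ 0#)
  fromℕ≉0 n n≈0 = 1≉0 (antisym (≤-cong (+-identityʳ 1#) n≈0 (+-mono-≤ ≤-refl (fromℕ≥0 n))) 0≤1)

  fromℕ-+ : ∀ m n → fromℕ (m ℕ.+ n) ≈ fromℕ m + fromℕ n
  fromℕ-+ = ×-homo-+ 1#

  fromℕ-* : ∀ m n → fromℕ (m ℕ.* n) ≈ fromℕ m * fromℕ n
  fromℕ-* = ×1-homo-*

  ⁻¹-inverse-suc : ∀ n → fromℕ (suc n) * fromℕ (suc n) ⁻¹ ≈ 1#
  ⁻¹-inverse-suc n = ⁻¹-inverseʳ _ (fromℕ≉0 n)

  *-cancelʳ : ∀ {x y z} → ¬ (z ≈ 0#) → x * z ≈ y * z → x ≈ y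
  *-cancelʳ {x} {y} {z} z≉0 xz≈yz = begin
    x              ≈⟨ undo x ⟩
    x * z * z ⁻¹   ≈⟨ *-congʳ xz≈yz ⟩
    y * z * z ⁻¹   ≈⟨ sym (undo y) ⟩
    y              ∎
    where
    open ≈-Reasoning
    undo : ∀ x → x ≈ x * z * z ⁻¹
    undo x = sym (trans (*-assoc x z (z ⁻¹)) (trans (*-congˡ (⁻¹-inverseʳ z z≉0)) (*-identityʳ x)))

  -- A ring solver with rational coefficients

  module Coefficients where
    open ≈-Reasoning
    import Algebra.Solver.Ring.NaturalCoefficients.Default commutativeSemiring as ℕ-Solver

    -- An opaque constant of which only `ε²≈1` and `1+ε≈0` are used. This leaves identities without
    -- subtraction, within reach of a solver for commutative semirings.
    ε : ℝ
    ε = - 1#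

    ε²≈1 : ε * ε ≈ 1#
    ε²≈1 = trans (-1*x≈-x ε) (-‿involutive 1#)

    1+ε≈0 : 1# + ε ≈ 0#
    1+ε≈0 = -‿inverseʳ 1#

    -- frac a b n stands for (a - b) / (1 + n); the other constructors let
    -- numerals and their inverses occur literally in the equations to be solved.
    data Coefficient : Set where
      frac      : ℕ → ℕ → ℕ → Coefficient
      one       : Coefficient
      nat recip : ℕ → Coefficient

    num⁺ num⁻ den-1 : Coefficient → ℕ
    num⁺ (frac a b n) = a
    num⁺ one          = 1
    num⁺ (nat n)      = n
    num⁺ (recip n)    = 1
    num⁻ (frac a b n) = b
    num⁻ _            = 0
    den-1 (frac a b n) = n
    den-1 (recip n)    = n
    den-1 _            = 0

    num den : Coefficient → ℝ
    num q = fromℕ (num⁺ q) + fromℕ (num⁻ q) * ε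
    den q = fromℕ (suc (den-1 q))

    ⟦_⟧ᶜ : Coefficient → ℝ
    ⟦ frac a b n ⟧ᶜ = (fromℕ a + fromℕ b * ε) * fromℕ (suc n) ⁻¹
    ⟦ one ⟧ᶜ        = 1#
    ⟦ nat n ⟧ᶜ      = fromℕ n
    ⟦ recip n ⟧ᶜ    = fromℕ (suc n) ⁻¹

    0*ε : ∀ x → x + 0# * ε ≈ x
    0*ε x = trans (+-congˡ (zeroˡ ε)) (+-identityʳ x)

    clear : ∀ q → ⟦ q ⟧ᶜ * den q ≈ num q
    clear (frac a b n) = trans (*-assoc _ _ _) (trans (*-congˡ (trans (*-comm _ _) (⁻¹-inverse-suc n))) (*-identityʳ _))
    clear one          = sym (trans (0*ε _) (sym (*-identityˡ _)))
    clear (nat n)      = sym (trans (0*ε _) (sym (trans (*-congˡ (+-identityʳ 1#)) (*-identityʳ _))))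
    clear (recip n)    = trans (*-comm _ _) (trans (⁻¹-inverse-suc n) (sym (trans (0*ε _) (+-identityʳ 1#))))

    den≉0 : ∀ q → ¬ (den q ≈ 0#)
    den≉0 q = fromℕ≉0 (den-1 q)

    -- The last argument is one less than the denominator; its successor computes to the product of
    -- the two denominators, so that `fromℕ-*` applies directly.
    addᶜ mulᶜ : Coefficient → Coefficient → Coefficient
    addᶜ p q = frac (num⁺ p ℕ.* suc (den-1 q) ℕ.+ num⁺ q ℕ.* suc (den-1 p))
                    (num⁻ p ℕ.* suc (den-1 q) ℕ.+ num⁻ q ℕ.* suc (den-1 p))
                    (den-1 q ℕ.+ den-1 p ℕ.* suc (den-1 q))
    mulᶜ p q = frac (num⁺ p ℕ.* num⁺ q ℕ.+ num⁻ p ℕ.* num⁻ q)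
                    (num⁺ p ℕ.* num⁻ q ℕ.+ num⁻ p ℕ.* num⁺ q)
                    (den-1 q ℕ.+ den-1 p ℕ.* suc (den-1 q))

    negᶜ : Coefficient → Coefficient
    negᶜ p = frac (num⁻ p) (num⁺ p) (den-1 p)

    fromℕ-+* : ∀ a b c d → fromℕ (a ℕ.* b ℕ.+ c ℕ.* d) ≈ fromℕ a * fromℕ b + fromℕ c * fromℕ d
    fromℕ-+* a b c d = trans (fromℕ-+ (a ℕ.* b) (c ℕ.* d)) (+-cong (fromℕ-* a b) (fromℕ-* c d))

    open ℕ-Solver using (_:+_; _:*_; _:=_)

    +-homo : ∀ p q → ⟦ addᶜ p q ⟧ᶜ ≈ ⟦ p ⟧ᶜ + ⟦ q ⟧ᶜ
    +-homo p q = *-cancelʳ (den≉0 (addᶜ p q)) (begin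
      ⟦ addᶜ p q ⟧ᶜ * den (addᶜ p q)          ≈⟨ clear (addᶜ p q) ⟩
      num (addᶜ p q)                          ≈⟨ +-cong (fromℕ-+* (num⁺ p) (suc (den-1 q)) (num⁺ q) (suc (den-1 p))) (*-congʳ (fromℕ-+* (num⁻ p) (suc (den-1 q)) (num⁻ q) (suc (den-1 p)))) ⟩
      (fromℕ (num⁺ p) * den q + fromℕ (num⁺ q) * den p) + (fromℕ (num⁻ p) * den q + fromℕ (num⁻ q) * den p) * ε
        ≈⟨ ℕ-Solver.solve 7 (λ a b c d m n e → (a :* n :+ c :* m) :+ (b :* n :+ d :* m) :* e := (a :+ b :* e) :* n :+ (c :+ d :* e) :* m) refl
             (fromℕ (num⁺ p)) (fromℕ (num⁻ p)) (fromℕ (num⁺ q)) (fromℕ (num⁻ q)) (den p) (den q) ε ⟩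
      num p * den q + num q * den p           ≈⟨ sym (+-cong (*-congʳ (clear p)) (*-congʳ (clear q))) ⟩
      ⟦ p ⟧ᶜ * den p * den q + ⟦ q ⟧ᶜ * den q * den p
        ≈⟨ ℕ-Solver.solve 4 (λ x y m n → x :* m :* n :+ y :* n :* m := (x :+ y) :* (m :* n)) refl ⟦ p ⟧ᶜ ⟦ q ⟧ᶜ (den p) (den q) ⟩
      (⟦ p ⟧ᶜ + ⟦ q ⟧ᶜ) * (den p * den q)     ≈⟨ *-congˡ (sym (fromℕ-* (suc (den-1 p)) (suc (den-1 q)))) ⟩
      (⟦ p ⟧ᶜ + ⟦ q ⟧ᶜ) * den (addᶜ p q)      ∎)

    *-homo : ∀ p q → ⟦ mulᶜ p q ⟧ᶜ ≈ ⟦ p ⟧ᶜ * ⟦ q ⟧ᶜ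
    *-homo p q = *-cancelʳ (den≉0 (mulᶜ p q)) (begin
      ⟦ mulᶜ p q ⟧ᶜ * den (mulᶜ p q)          ≈⟨ clear (mulᶜ p q) ⟩
      num (mulᶜ p q)                          ≈⟨ +-cong (trans (fromℕ-+* (num⁺ p) (num⁺ q) (num⁻ p) (num⁻ q)) (+-congˡ (sym (trans (*-congˡ ε²≈1) (*-identityʳ _)))))
                                                        (*-congʳ (fromℕ-+* (num⁺ p) (num⁻ q) (num⁻ p) (num⁺ q))) ⟩
      (fromℕ (num⁺ p) * fromℕ (num⁺ q) + fromℕ (num⁻ p) * fromℕ (num⁻ q) * (ε * ε)) + (fromℕ (num⁺ p) * fromℕ (num⁻ q) + fromℕ (num⁻ p) * fromℕ (num⁺ q)) * ε
        ≈⟨ ℕ-Solver.solve 5 (λ a b c d e → (a :* c :+ b :* d :* (e :* e)) :+ (a :* d :+ b :* c) :* e := (a :+ b :* e) :* (c :+ d :* e)) refl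
             (fromℕ (num⁺ p)) (fromℕ (num⁻ p)) (fromℕ (num⁺ q)) (fromℕ (num⁻ q)) ε ⟩
      num p * num q                           ≈⟨ sym (*-cong (clear p) (clear q)) ⟩
      (⟦ p ⟧ᶜ * den p) * (⟦ q ⟧ᶜ * den q)
        ≈⟨ ℕ-Solver.solve 4 (λ x y m n → (x :* m) :* (y :* n) := (x :* y) :* (m :* n)) refl ⟦ p ⟧ᶜ ⟦ q ⟧ᶜ (den p) (den q) ⟩
      (⟦ p ⟧ᶜ * ⟦ q ⟧ᶜ) * (den p * den q)     ≈⟨ *-congˡ (sym (fromℕ-* (suc (den-1 p)) (suc (den-1 q)))) ⟩
      (⟦ p ⟧ᶜ * ⟦ q ⟧ᶜ) * den (mulᶜ p q)      ∎)

    -‿homo : ∀ p → ⟦ negᶜ p ⟧ᶜ ≈ - ⟦ p ⟧ᶜ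
    -‿homo p = *-cancelʳ (den≉0 p) (begin
      ⟦ negᶜ p ⟧ᶜ * den p                     ≈⟨ clear (negᶜ p) ⟩
      fromℕ (num⁻ p) + fromℕ (num⁺ p) * ε     ≈⟨ +-congʳ (sym (trans (*-congˡ ε²≈1) (*-identityʳ _))) ⟩
      fromℕ (num⁻ p) * (ε * ε) + fromℕ (num⁺ p) * ε
        ≈⟨ ℕ-Solver.solve 3 (λ a b e → b :* (e :* e) :+ a :* e := e :* (a :+ b :* e)) refl (fromℕ (num⁺ p)) (fromℕ (num⁻ p)) ε ⟩
      ε * num p                               ≈⟨ *-congˡ (sym (clear p)) ⟩
      ε * (⟦ p ⟧ᶜ * den p)                    ≈⟨ sym (*-assoc _ _ _) ⟩
      ε * ⟦ p ⟧ᶜ * den p                      ≈⟨ *-congʳ (-1*x≈-x ⟦ p ⟧ᶜ) ⟩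
      - ⟦ p ⟧ᶜ * den p                        ∎)

    ℝ-ring = fromCommutativeRing commutativeRing

    coefficients : RawRing _ _
    coefficients = record
      { Carrier = Coefficient; _≈_ = _≡_; _+_ = addᶜ; _*_ = mulᶜ; -_ = negᶜ; 0# = nat 0; 1# = one }

    morphism : coefficients -Raw-AlmostCommutative⟶ ℝ-ring
    morphism = record
      { ⟦_⟧ = ⟦_⟧ᶜ; +-homo = +-homo; *-homo = *-homo; -‿homo = -‿homo; 0-homo = refl; 1-homo = refl }

    -- Once cross-multiplied, with the negative parts moved to the other side, the comparison
    -- concerns natural numbers only. Fractions are never reduced, so equal coefficients come in
    -- many forms.
    _≟ᶜ_ : WeaklyDecidable (Induced-equivalence morphism)
    p ≟ᶜ q with num⁺ p ℕ.* suc (den-1 q) ℕ.+ num⁻ q ℕ.* suc (den-1 p)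
              ℕ.≟ num⁺ q ℕ.* suc (den-1 p) ℕ.+ num⁻ p ℕ.* suc (den-1 q)
    ... | no  _   = Maybe.nothing
    ... | yes a≡b = Maybe.just (*-cancelʳ (den≉0 p) (*-cancelʳ (den≉0 q) (begin
      ⟦ p ⟧ᶜ * den p * den q                        ≈⟨ *-congʳ (clear p) ⟩
      (P + P′ * ε) * den q                          ≈⟨ sym (+-zero-term (Q′ * den p)) ⟩
      (P + P′ * ε) * den q + Q′ * den p * (1# + ε)  ≈⟨ ℕ-Solver.solve 6 (λ a b d m n e →
                                                         (a :+ b :* e) :* n :+ d :* m :* (ℕ-Solver.con 1 :+ e) := (a :* n :+ d :* m) :+ (b :* n :* e :+ d :* m :* e)) refl P P′ Q′ (den p) (den q) ε ⟩
      (P * den q + Q′ * den p) + (P′ * den q * ε + Q′ * den p * ε)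
        ≈⟨ +-congʳ (trans (sym (fromℕ-+* (num⁺ p) (suc (den-1 q)) (num⁻ q) (suc (den-1 p)))) (trans (reflexive (≡.cong fromℕ a≡b)) (fromℕ-+* (num⁺ q) (suc (den-1 p)) (num⁻ p) (suc (den-1 q))))) ⟩
      (Q * den p + P′ * den q) + (P′ * den q * ε + Q′ * den p * ε)
        ≈⟨ ℕ-Solver.solve 6 (λ c b d m n e → (c :* m :+ b :* n) :+ (b :* n :* e :+ d :* m :* e) := (c :+ d :* e) :* m :+ b :* n :* (ℕ-Solver.con 1 :+ e)) refl Q P′ Q′ (den p) (den q) ε ⟩
      (Q + Q′ * ε) * den p + P′ * den q * (1# + ε)  ≈⟨ +-zero-term (P′ * den q) ⟩
      (Q + Q′ * ε) * den p                          ≈⟨ *-congʳ (sym (clear q)) ⟩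
      ⟦ q ⟧ᶜ * den q * den p                        ≈⟨ trans (*-assoc _ _ _) (trans (*-congˡ (*-comm _ _)) (sym (*-assoc _ _ _))) ⟩
      ⟦ q ⟧ᶜ * den p * den q                        ∎)))
      where
      P = fromℕ (num⁺ p)
      P′ = fromℕ (num⁻ p)
      Q = fromℕ (num⁺ q)
      Q′ = fromℕ (num⁻ q)

      +-zero-term : ∀ {x} y → x + y * (1# + ε) ≈ x
      +-zero-term y = trans (+-congˡ (trans (*-congˡ 1+ε≈0) (zeroʳ y))) (+-identityʳ _)

  open Coefficients using (Coefficient; one; nat; recip; coefficients; ℝ-ring; morphism; _≟ᶜ_) public
  import Algebra.Solver.Ring coefficients ℝ-ring morphism _≟ᶜ_ as ℚ-Solver
  open ℚ-Solver using (Polynomial; _:+_; _:*_; _:-_; :-_; _:=_; con; normalise; _≟N_; ⟦_⟧N-cong; prove) public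
  open import Relation.Binary.Reflection setoid ℚ-Solver.var ℚ-Solver.⟦_⟧ ℚ-Solver.⟦_⟧↓ ℚ-Solver.correct using (close)

  :0 :1 :½ : ∀ {n} → Polynomial n
  :0 = con (nat 0)
  :1 = con one
  :½ = con (recip 1)

  ♯_ : ∀ {n} → ℕ → Polynomial n
  ♯ n = con (nat n)

  -- Because equal coefficients have different forms, equal polynomials need not have definitionally
  -- equal values in an abstract field, and `refl` could fail. The normal forms are compared by
  -- `_≟N_` during type checking instead; on success the hidden argument has the unit type and is
  -- filled in.
  solve : ∀ n (f : N-ary n (Polynomial n) (Polynomial n × Polynomial n)) →
          {_ : T (Maybe.is-just (normalise (proj₁ (close n f)) ≟N normalise (proj₂ (close n f))))} →
          Eq n _≈_ (curryⁿ ℚ-Solver.⟦ proj₁ (close n f) ⟧) (curryⁿ ℚ-Solver.⟦ proj₂ (close n f) ⟧)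
  solve n f {t} = curryⁿ-cong _≈_ ℚ-Solver.⟦ proj₁ (close n f) ⟧ ℚ-Solver.⟦ proj₂ (close n f) ⟧
    (λ ρ → prove ρ (proj₁ (close n f)) (proj₂ (close n f)) (⟦ Maybe.to-witness-T _ t ⟧N-cong ρ))

-- Inequalities, unbounded sequences and square roots

module Completeness (R : CompleteOrderedField) where
  open OrderedField R public

  ≤-poset : Poset _ _ _
  ≤-poset = record { isPartialOrder = ≤-isPartialOrder }

  open import Relation.Binary.Reasoning.PartialOrder ≤-poset public
    using (begin_; begin-equality_; step-≤; step-≈-⟩; step-≈-⟨; step-≡-⟩; step-≡-∣; _∎)

  _≰_ : ℝ → ℝ → Set
  x ≰ y = ¬ (x ≤ y)

  infix 4 _≰_

  ≰⇒≥ : ∀ {x y} → x ≰ y → y ≤ x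
  ≰⇒≥ {x} {y} x≰y with total x y
  ... | inj₁ x≤y = contradiction x≤y x≰y
  ... | inj₂ y≤x = y≤x

  ≤-stable : ∀ {x y} → ¬ (x ≰ y) → x ≤ y
  ≤-stable {x} {y} ¬x≰y with x ≤? y
  ... | yes x≤y = x≤y
  ... | no  x≰y = contradiction x≰y ¬x≰y

  x≤y⇒0≤y-x : ∀ {x y} → x ≤ y → 0# ≤ y - x
  x≤y⇒0≤y-x {x} x≤y = ≤-cong (-‿inverseʳ x) refl (+-monoˡ-≤ (- x) x≤y)

  0≤y-x⇒x≤y : ∀ {x y} → 0# ≤ y - x → x ≤ y
  0≤y-x⇒x≤y {x} {y} 0≤y-x = ≤-cong (+-identityˡ x) (solve 2 (λ x y → y :- x :+ x := y) x y) (+-monoˡ-≤ x 0≤y-x)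

  -- The shape in which inequalities are proved from a certificate:
  -- y - x is identically equal to something nonnegative.
  ≤-by : ∀ {x y d} → 0# ≤ d → y - x ≈ d → x ≤ y
  ≤-by 0≤d y-x≈d = 0≤y-x⇒x≤y (≤-cong refl (sym y-x≈d) 0≤d)

  -- How a relation such as r² ≈ 2 enters an identity left to the solver.
  ≈-mod : ∀ {x y p u v} → u ≈ v → x ≈ y + p * (u - v) → x ≈ y
  ≈-mod {x} {y} {p} {u} {v} u≈v x≈ = trans x≈ (trans (+-congˡ (trans (*-congˡ (trans (+-congʳ u≈v) (-‿inverseʳ v))) (zeroʳ p))) (+-identityʳ y))

  +-nonNegative : ∀ {x y} → 0# ≤ x → 0# ≤ y → 0# ≤ x + y
  +-nonNegative 0≤x 0≤y = ≤-cong (+-identityˡ 0#) refl (+-mono-≤ 0≤x 0≤y)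

  x≤x+y : ∀ {x y} → 0# ≤ y → x ≤ x + y
  x≤x+y {x} 0≤y = ≤-cong (+-identityʳ x) refl (+-mono-≤ ≤-refl 0≤y)

  x≤y+x : ∀ {x y} → 0# ≤ y → x ≤ y + x
  x≤y+x {x} 0≤y = ≤-cong (+-identityˡ x) refl (+-mono-≤ 0≤y ≤-refl)

  *-monoˡ-≤ : ∀ {x y z} → 0# ≤ x → y ≤ z → x * y ≤ x * z
  *-monoˡ-≤ {x} {y} {z} 0≤x y≤z = ≤-by (*-nonNegative 0≤x (x≤y⇒0≤y-x y≤z))
    (solve 3 (λ x y z → x :* z :- x :* y := x :* (z :- y)) x y z)

  *-monoʳ-≤ : ∀ {x y z} → 0# ≤ x → y ≤ z → y * x ≤ z * x
  *-monoʳ-≤ 0≤x y≤z = ≤-cong (*-comm _ _) (*-comm _ _) (*-monoˡ-≤ 0≤x y≤z)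

  x²≥0 : ∀ x → 0# ≤ x ²
  x²≥0 x with total 0# x
  ... | inj₁ 0≤x = *-nonNegative 0≤x 0≤x
  ... | inj₂ x≤0 = ≤-cong refl (solve 1 (λ x → (:0 :- x) :* (:0 :- x) := x :* x) x)
                     (*-nonNegative (x≤y⇒0≤y-x x≤0) (x≤y⇒0≤y-x x≤0))

  1≰0 : 1# ≰ 0#
  1≰0 1≤0 = 1≉0 (antisym 1≤0 0≤1)

  ≰0⇒≉0 : ∀ {x} → x ≰ 0# → ¬ (x ≈ 0#)
  ≰0⇒≉0 x≰0 x≈0 = x≰0 (≤-reflexive x≈0)

  ≥0∧≉0⇒≰0 : ∀ {x} → 0# ≤ x → ¬ (x ≈ 0#) → x ≰ 0#
  ≥0∧≉0⇒≰0 0≤x x≉0 x≤0 = x≉0 (antisym x≤0 0≤x)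

  ⁻¹-nonNegative : ∀ {x} → x ≰ 0# → 0# ≤ x ⁻¹
  ⁻¹-nonNegative {x} x≰0 with total 0# (x ⁻¹)
  ... | inj₁ 0≤x⁻¹ = 0≤x⁻¹
  ... | inj₂ x⁻¹≤0 = contradiction
    (≤-cong (⁻¹-inverseʳ x (≰0⇒≉0 x≰0)) (zeroʳ x) (*-monoˡ-≤ (≰⇒≥ x≰0) x⁻¹≤0)) 1≰0

  *-cancelʳ-≤ : ∀ {x y z} → z ≰ 0# → x * z ≤ y * z → x ≤ y
  *-cancelʳ-≤ {x} {y} {z} z≰0 xz≤yz = ≤-cong (undo x) (undo y) (*-monoʳ-≤ (⁻¹-nonNegative z≰0) xz≤yz)
    where
    undo : ∀ x → x * z * z ⁻¹ ≈ x
    undo x = trans (*-assoc x z (z ⁻¹)) (trans (*-congˡ (⁻¹-inverseʳ z (≰0⇒≉0 z≰0))) (*-identityʳ x))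

  x²≈0⇒x≈0 : ∀ {x} → x ² ≈ 0# → x ≈ 0#
  x²≈0⇒x≈0 {x} x²≈0 with x ≟ 0#
  ... | yes x≈0 = x≈0
  ... | no  x≉0 = *-cancelʳ x≉0 (trans x²≈0 (sym (zeroˡ x)))

  *-positive : ∀ {x y} → x ≰ 0# → y ≰ 0# → x * y ≰ 0#
  *-positive {x} {y} x≰0 y≰0 xy≤0 = x≰0 (*-cancelʳ-≤ y≰0 (≤-cong refl (sym (zeroˡ y)) xy≤0))

  ⁻¹-positive : ∀ {x} → x ≰ 0# → x ⁻¹ ≰ 0#
  ⁻¹-positive {x} x≰0 x⁻¹≤0 = 1≰0 (≤-cong (⁻¹-inverseʳ x (≰0⇒≉0 x≰0)) (zeroʳ x) (*-monoˡ-≤ (≰⇒≥ x≰0) x⁻¹≤0))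

  ⁻¹-unique : ∀ {x y} → x * y ≈ 1# → x ⁻¹ ≈ y
  ⁻¹-unique {x} {y} xy≈1 = begin-equality
    x ⁻¹            ≈⟨ *-identityˡ _ ⟨
    1# * x ⁻¹       ≈⟨ *-congʳ xy≈1 ⟨
    x * y * x ⁻¹    ≈⟨ solve 3 (λ x y z → x :* y :* z := x :* z :* y) x y (x ⁻¹) ⟩
    x * x ⁻¹ * y    ≈⟨ *-congʳ (⁻¹-inverseʳ x λ x≈0 → 1≉0 (trans (sym xy≈1) (trans (*-congʳ x≈0) (zeroˡ y)))) ⟩
    1# * y          ≈⟨ *-identityˡ y ⟩
    y               ∎

  fromℕ-suc≰0 : ∀ n → fromℕ (suc n) ≰ 0#
  fromℕ-suc≰0 n = ≥0∧≉0⇒≰0 (fromℕ≥0 (suc n)) (fromℕ≉0 n)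

  recip≥0 : ∀ n → 0# ≤ fromℕ (suc n) ⁻¹
  recip≥0 n = ⁻¹-nonNegative (fromℕ-suc≰0 n)

  ≰-shift : ∀ {x y} → x ≰ y → x - y ≰ 0#
  ≰-shift {x} {y} x≰y x-y≤0 = x≰y (≤-cong (solve 2 (λ x y → x :- y :+ y := x) x y) (+-identityˡ y) (+-monoˡ-≤ y x-y≤0))

  x-y≰x : ∀ {x y} → y ≰ 0# → x ≰ x - y
  x-y≰x {x} {y} y≰0 x≤x-y = y≰0 (≤-by (x≤y⇒0≤y-x x≤x-y) (solve 2 (λ x y → :0 :- y := x :- y :- x) x y))

  x+y≰x : ∀ {x y} → y ≰ 0# → x + y ≰ x
  x+y≰x {x} {y} y≰0 x+y≤x = y≰0 (≤-by (x≤y⇒0≤y-x x+y≤x) (solve 2 (λ x y → :0 :- y := x :- (x :+ y)) x y))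

  -- Every value is followed by one larger by `δ`, so lowering the supremum of the values by `δ`
  -- would give a smaller upper bound. `next` is not always the successor: for `H` below, a constant
  -- gain takes about a doubling of the index.
  unbounded : ∀ (f : ℕ → ℝ) (next : ℕ → ℕ) {δ} → δ ≰ 0# → (∀ n → f n + δ ≤ f (next n)) →
              ∀ B → ¬ (∀ n → f n ≤ B)
  unbounded f next {δ} δ≰0 gain B f≤B = x-y≰x δ≰0 (s-least (s - δ) s-δ-upper)
    where
    values : ℝ → Set
    values x = ∃[ n ] x ≈ f n

    sup = supremum values (f 0 , 0 , refl) (B , λ { x (n , x≈fn) → ≤-cong (sym x≈fn) refl (f≤B n) })
    s = proj₁ sup
    s-upper = proj₁ (proj₂ sup)
    s-least = proj₂ (proj₂ sup)

    s-δ-upper : IsUpperBound values (s - δ)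
    s-δ-upper x (n , x≈fn) = ≤-by (x≤y⇒0≤y-x (≤-trans (gain n) (s-upper _ (next n , refl))))
      (trans (+-congˡ (-‿cong x≈fn)) (solve 3 (λ s δ f → s :- δ :- f := s :- (f :+ δ)) s δ (f n)))

  archimedean : ∀ B → ¬ (∀ n → fromℕ n ≤ B)
  archimedean = unbounded fromℕ suc 1≰0 (λ n → ≤-reflexive (+-comm (fromℕ n) 1#))

  private
    module SquareRoot (a : ℝ) (0≤a : 0# ≤ a) where
      P : ℝ → Set
      P x = x ² ≤ a

      bounded : IsUpperBound P (1# + a)
      bounded x x²≤a = ≤-stable λ x≰1+a → contradiction
        (≤-trans (≤-by (+-nonNegative (+-nonNegative (+-nonNegative 0≤a (x²≥0 a)) (x²≥0 (x - (1# + a))))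
                        (*-nonNegative (+-nonNegative (+-nonNegative 0≤1 0≤1) (+-nonNegative 0≤a 0≤a)) (x≤y⇒0≤y-x (≰⇒≥ x≰1+a))))
                  (solve 2 (λ x a → x :* x :- (:1 :+ a) := a :+ a :* a :+ (x :- (:1 :+ a)) :* (x :- (:1 :+ a)) :+ (:1 :+ :1 :+ (a :+ a)) :* (x :- (:1 :+ a))) x a))
                 (≤-cong refl (sym (+-identityˡ a)) x²≤a))
        (λ 1+a≤0+a → 1≰0 (≤-by (x≤y⇒0≤y-x 1+a≤0+a) (solve 1 (λ a → :0 :- :1 := :0 :+ a :- (:1 :+ a)) a)))

      sup = supremum P (0# , ≤-cong (sym (zeroˡ 0#)) refl 0≤a) (1# + a , bounded)
      s = proj₁ sup
      s-upper = proj₁ (proj₂ sup)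
      s-least = proj₂ (proj₂ sup)

      0≤s : 0# ≤ s
      0≤s = s-upper 0# (≤-cong (sym (zeroˡ 0#)) refl 0≤a)

      -- If s² exceeds a by η, then already s - η/2s is an upper bound.
      s²≤a : s ² ≤ a
      s²≤a = ≤-stable λ s²≰a →
        let
          η = s ² - a
          2s≰0 : s + s ≰ 0#
          2s≰0 2s≤0 = s²≰a (≤-cong (sym (trans (*-congʳ (antisym (≤-trans (x≤x+y 0≤s) 2s≤0) 0≤s)) (zeroˡ s))) refl 0≤a)
          upper : IsUpperBound P (s - η * (s + s) ⁻¹)
          upper x x²≤a = *-cancelʳ-≤ 2s≰0 (≤-by
            (+-nonNegative (x²≥0 (s - x)) (x≤y⇒0≤y-x x²≤a))
            (trans (solve 4 (λ s x a i → (s :- (s :* s :- a) :* i) :* (s :+ s) :- x :* (s :+ s)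
                                         := (s :- x) :* (s :- x) :+ (a :- x :* x) :+ (s :* s :- a) :* (:1 :- (s :+ s) :* i)) s x a ((s + s) ⁻¹))
                   (trans (+-congˡ (trans (*-congˡ (trans (+-congˡ (-‿cong (⁻¹-inverseʳ (s + s) (≰0⇒≉0 2s≰0)))) (-‿inverseʳ 1#))) (zeroʳ η))) (+-identityʳ _))))
        in x-y≰x (*-positive (≰-shift s²≰a) (⁻¹-positive 2s≰0)) (s-least _ upper)

      -- If s² falls short of a by η, then s + η/(2s+1+η) still belongs to P.
      a≤s² : a ≤ s ²
      a≤s² = ≤-stable λ a≰s² →
        let
          η = a - s ²
          0≤η = ≰⇒≥ (≰-shift a≰s²)
          q = s + s + 1# + η
          q≰0 : q ≰ 0#
          q≰0 q≤0 = 1≰0 (≤-trans (≤-by (+-nonNegative (+-nonNegative 0≤s 0≤s) 0≤η) (solve 2 (λ s η → s :+ s :+ :1 :+ η :- :1 := s :+ s :+ η) s η)) q≤0)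
          i = q ⁻¹
          0≤i = ⁻¹-nonNegative q≰0
          t = η * i
          0≤t = *-nonNegative 0≤η 0≤i
          member : P (s + t)
          member = ≤-by
            (+-nonNegative (*-nonNegative 0≤t 0≤η) (*-nonNegative 0≤t (*-nonNegative (+-nonNegative (+-nonNegative 0≤s 0≤s) 0≤1) 0≤i)))
            (trans (solve 3 (λ s a i → let η = a :- s :* s ; t = η :* i ; q = s :+ s :+ :1 :+ η in
                      a :- (s :+ t) :* (s :+ t) := t :* η :+ t :* ((s :+ s :+ :1) :* i) :+ (:1 :- q :* i) :* (η :+ t)) s a i)
                   (trans (+-congˡ (trans (*-congʳ (trans (+-congˡ (-‿cong (⁻¹-inverseʳ q (≰0⇒≉0 q≰0)))) (-‿inverseʳ 1#))) (zeroˡ _))) (+-identityʳ _)))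
        in x+y≰x (*-positive (≰-shift a≰s²) (⁻¹-positive q≰0)) (s-upper _ member)

  squareRoot : ∀ a → 0# ≤ a → ∃[ r ] (0# ≤ r × r ² ≈ a)
  squareRoot a 0≤a = s , 0≤s , antisym s²≤a a≤s²
    where open SquareRoot a 0≤a

-- Finite sums, partial sums and inner products

module Sums (R : CompleteOrderedField) where
  open Completeness R public
  open LB using (⟨_,_⟩; ‖_‖²; ∑∈; when) public
  open Algebra.Definitions.RawMonoid +-rawMonoid using (sum) public
  open import Algebra.Properties.Semiring.Sum semiring public
    using (∑-comm) renaming (sum-cong-≋ to sum-cong; ∑-distrib-+ to sum-+; *-distribˡ-sum to sum-*ˡ)

  private
    variable
      m n : ℕ
      O : Set

  when-true : ∀ {P : Set} (P? : Dec P) {x} → P → when ⌊ P? ⌋ x ≡ x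
  when-true (yes _) p = ≡.refl
  when-true (no ¬p) p = contradiction p ¬p

  when-false : ∀ {P : Set} (P? : Dec P) {x} → ¬ P → when ⌊ P? ⌋ x ≡ 0#
  when-false (yes p) ¬p = contradiction p ¬p
  when-false (no _)  ¬p = ≡.refl

  when-cong : ∀ b {x y} → x ≈ y → when b x ≈ when b y
  when-cong true  x≈y = x≈y
  when-cong false x≈y = refl

  when-nonNegative : ∀ b {x} → 0# ≤ x → 0# ≤ when b x
  when-nonNegative true  0≤x = 0≤x
  when-nonNegative false 0≤x = ≤-refl

  *-when : ∀ b {x} y → x * when b y ≈ when b (x * y)
  *-when true  y = refl
  *-when false y = zeroʳ _

  when-* : ∀ b {y} x → when b x * y ≈ when b (x * y)
  when-* true  x = refl
  when-* false x = zeroˡ _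

  sum-zero : ∀ {f : Fin n → ℝ} → (∀ i → f i ≈ 0#) → sum f ≈ 0#
  sum-zero {zero}  f≈0 = refl
  sum-zero {suc n} f≈0 = trans (+-cong (f≈0 fzero) (sum-zero (λ i → f≈0 (fsuc i)))) (+-identityˡ 0#)

  sum-mono : ∀ {f g : Fin n → ℝ} → (∀ i → f i ≤ g i) → sum f ≤ sum g
  sum-mono {zero}  f≤g = ≤-refl
  sum-mono {suc n} f≤g = +-mono-≤ (f≤g fzero) (sum-mono (λ i → f≤g (fsuc i)))

  sum-nonNegative : ∀ {f : Fin n → ℝ} → (∀ i → 0# ≤ f i) → 0# ≤ sum f
  sum-nonNegative {zero}  0≤f = ≤-refl
  sum-nonNegative {suc n} 0≤f = +-nonNegative (0≤f fzero) (sum-nonNegative (λ i → 0≤f (fsuc i)))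

  sum-neg : ∀ (f : Fin n → ℝ) → sum (λ i → - f i) ≈ - sum f
  sum-neg f = begin-equality
    sum (λ i → - f i)         ≈⟨ sum-cong (λ i → solve 1 (λ x → :- x := (:0 :- :1) :* x) (f i)) ⟩
    sum (λ i → (0# - 1#) * f i) ≈⟨ sum-*ˡ (0# - 1#) f ⟨
    (0# - 1#) * sum f         ≈⟨ solve 1 (λ x → (:0 :- :1) :* x := :- x) (sum f) ⟩
    - sum f                   ∎

  sum-- : ∀ (f g : Fin n → ℝ) → sum (λ i → f i - g i) ≈ sum f - sum g
  sum-- f g = trans (sum-+ f (λ i → - g i)) (+-congˡ (sum-neg g))

  sum-single : ∀ (i : Fin n) (f : Fin n → ℝ) → (∀ e → e ≢ i → f e ≈ 0#) → sum f ≈ f i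
  sum-single fzero    f f≈0 = trans (+-congˡ (sum-zero (λ e → f≈0 (fsuc e) λ ()))) (+-identityʳ _)
  sum-single (fsuc i) f f≈0 = trans
    (+-cong (f≈0 fzero λ ()) (sum-single i (λ e → f (fsuc e)) (λ e e≢i → f≈0 (fsuc e) (λ se≡si → e≢i (suc-injective se≡si)))))
    (+-identityˡ _)

  sum-δ : ∀ (i : Fin n) (f : Fin n → ℝ) → sum (λ e → when ⌊ i ≟ᶠ e ⌋ (f e)) ≈ f i
  sum-δ i f = trans
    (sum-single i _ (λ e e≢i → reflexive (when-false (i ≟ᶠ e) (λ i≡e → e≢i (≡.sym i≡e)))))
    (reflexive (when-true (i ≟ᶠ i) ≡.refl))

  sum-δ-* : ∀ (i : Fin n) (f g : Fin n → ℝ) → sum (λ e → when ⌊ i ≟ᶠ e ⌋ (f e) * g e) ≈ f i * g i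
  sum-δ-* i f g = trans (sum-cong (λ e → when-* ⌊ i ≟ᶠ e ⌋ (f e))) (sum-δ i (λ e → f e * g e))

  sum-1δ : ∀ (f : Fin n → ℝ) e → sum (λ i → f i * when ⌊ i ≟ᶠ e ⌋ 1#) ≈ f e
  sum-1δ f e = trans
    (sum-single e _ (λ i i≢e → trans (*-congˡ (reflexive (when-false (i ≟ᶠ e) i≢e))) (zeroʳ (f i))))
    (trans (*-congˡ (reflexive (when-true (e ≟ᶠ e) ≡.refl))) (*-identityʳ (f e)))

  telescope : ∀ n (f : ℕ → ℝ) → sum {n} (λ j → f (suc (toℕ j)) - f (toℕ j)) ≈ f n - f 0
  telescope zero    f = sym (-‿inverseʳ (f 0))
  telescope (suc n) f = trans (+-congˡ (telescope n (λ k → f (suc k))))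
    (solve 3 (λ x y z → y :- x :+ (z :- y) := z :- x) (f 0) (f 1) (f (suc n)))

  ∑∈-cong : ∀ (S : List O) {f g} → (∀ i → i ∈ S → f i ≈ g i) → ∑∈ S f ≈ ∑∈ S g
  ∑∈-cong []      f≈g = refl
  ∑∈-cong (i ∷ S) f≈g = +-cong (f≈g i (here ≡.refl)) (∑∈-cong S (λ k k∈S → f≈g k (there k∈S)))

  ∑∈-zero : ∀ (S : List O) {f} → (∀ i → i ∈ S → f i ≈ 0#) → ∑∈ S f ≈ 0#
  ∑∈-zero []      f≈0 = refl
  ∑∈-zero (i ∷ S) f≈0 = trans (+-cong (f≈0 i (here ≡.refl)) (∑∈-zero S (λ k k∈S → f≈0 k (there k∈S)))) (+-identityˡ 0#)

  ∑∈-mono : ∀ (S : List O) {f g} → (∀ i → i ∈ S → f i ≤ g i) → ∑∈ S f ≤ ∑∈ S g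
  ∑∈-mono []      f≤g = ≤-refl
  ∑∈-mono (i ∷ S) f≤g = +-mono-≤ (f≤g i (here ≡.refl)) (∑∈-mono S (λ k k∈S → f≤g k (there k∈S)))

  ∑∈-nonNegative : ∀ (S : List O) {f} → (∀ i → i ∈ S → 0# ≤ f i) → 0# ≤ ∑∈ S f
  ∑∈-nonNegative []      0≤f = ≤-refl
  ∑∈-nonNegative (i ∷ S) 0≤f = +-nonNegative (0≤f i (here ≡.refl)) (∑∈-nonNegative S (λ k k∈S → 0≤f k (there k∈S)))

  ∑∈-+ : ∀ (S : List O) f g → ∑∈ S (λ i → f i + g i) ≈ ∑∈ S f + ∑∈ S g
  ∑∈-+ []      f g = sym (+-identityˡ 0#)
  ∑∈-+ (i ∷ S) f g = trans (+-congˡ (∑∈-+ S f g))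
    (solve 4 (λ a b c d → a :+ b :+ (c :+ d) := a :+ c :+ (b :+ d)) (f i) (g i) (∑∈ S f) (∑∈ S g))

  ∑∈-*ˡ : ∀ (S : List O) x f → x * ∑∈ S f ≈ ∑∈ S (λ i → x * f i)
  ∑∈-*ˡ []      x f = zeroʳ x
  ∑∈-*ˡ (i ∷ S) x f = trans (distribˡ x (f i) (∑∈ S f)) (+-congˡ (∑∈-*ˡ S x f))

  ∑∈-++ : ∀ (S T : List O) f → ∑∈ (S ++ T) f ≈ ∑∈ S f + ∑∈ T f
  ∑∈-++ []      T f = sym (+-identityˡ _)
  ∑∈-++ (i ∷ S) T f = trans (+-congˡ (∑∈-++ S T f)) (sym (+-assoc _ _ _))

  ∑∈-↭ : ∀ {S T : List O} f → S ↭ T → ∑∈ S f ≈ ∑∈ T f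
  ∑∈-↭ f _↭_.refl         = refl
  ∑∈-↭ f (_↭_.prep x p)   = +-congˡ (∑∈-↭ f p)
  ∑∈-↭ f (_↭_.swap x y p) = trans (+-congˡ (+-congˡ (∑∈-↭ f p)))
    (solve 3 (λ a b c → a :+ (b :+ c) := b :+ (a :+ c)) (f x) (f y) _)
  ∑∈-↭ f (_↭_.trans p q)  = trans (∑∈-↭ f p) (∑∈-↭ f q)

  ∑∈-single : ∀ {S : List O} {i} f → Unique S → i ∈ S → (∀ k → k ≢ i → f k ≈ 0#) → ∑∈ S f ≈ f i
  ∑∈-single {S = i ∷ S} f (i∉S ∷ᵘ _) (here ≡.refl) f≈0 = trans
    (+-congˡ (∑∈-zero S (λ k k∈S → f≈0 k (λ k≡i → All.lookup i∉S k∈S (≡.sym k≡i))))) (+-identityʳ _)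
  ∑∈-single {S = k ∷ S} f (k∉S ∷ᵘ S!) (there i∈S) f≈0 = trans
    (+-cong (f≈0 k (All.lookup k∉S i∈S)) (∑∈-single f S! i∈S f≈0)) (+-identityˡ _)

  ∑∈-sum-comm : ∀ (S : List O) (f : O → Fin n → ℝ) → ∑∈ S (λ i → sum (f i)) ≈ sum (λ e → ∑∈ S (λ i → f i e))
  ∑∈-sum-comm {n = n} [] f = sym (sum-zero {n} λ _ → refl)
  ∑∈-sum-comm (i ∷ S) f = trans (+-congˡ (∑∈-sum-comm S f)) (sym (sum-+ (f i) (λ e → ∑∈ S (λ k → f k e))))

  -- Writing `f e` as a sum of indicators over `S` and exchanging the sums reduces this to single
  -- terms. It links the rules, which sum over feasible machines, with the costs, which sum over all
  -- machines.
  sum≈∑∈ : ∀ {S : List (Fin n)} (f : Fin n → ℝ) → Unique S → (∀ i → i ∉ S → f i ≈ 0#) → sum f ≈ ∑∈ S f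
  sum≈∑∈ {S = S} f S! f≈0 = begin-equality
    sum f                                                 ≈⟨ sum-cong term ⟩
    sum (λ e → ∑∈ S (λ i → when ⌊ i ≟ᶠ e ⌋ (f e)))        ≈⟨ ∑∈-sum-comm S (λ i e → when ⌊ i ≟ᶠ e ⌋ (f e)) ⟨
    ∑∈ S (λ i → sum (λ e → when ⌊ i ≟ᶠ e ⌋ (f e)))        ≈⟨ ∑∈-cong S (λ i _ → sum-δ i f) ⟩
    ∑∈ S f                                                ∎
    where
    term : ∀ e → f e ≈ ∑∈ S (λ i → when ⌊ i ≟ᶠ e ⌋ (f e))
    term e with any? (e ≟ᶠ_) S
    ... | yes e∈S = sym (trans
      (∑∈-single (λ i → when ⌊ i ≟ᶠ e ⌋ (f e)) S! e∈S (λ i i≢e → reflexive (when-false (i ≟ᶠ e) i≢e)))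
      (reflexive (when-true (e ≟ᶠ e) ≡.refl)))
    ... | no e∉S = trans (f≈0 e e∉S) (sym (∑∈-zero S (λ i i∈S →
      reflexive (when-false (i ≟ᶠ e) (λ { ≡.refl → e∉S i∈S })))))

  term≤∑∈ : ∀ (S : List O) {f} → (∀ i → 0# ≤ f i) → ∀ {i} → i ∈ S → f i ≤ ∑∈ S f
  term≤∑∈ (_ ∷ S) 0≤f (here ≡.refl) = x≤x+y (∑∈-nonNegative S (λ k _ → 0≤f k))
  term≤∑∈ (k ∷ S) 0≤f (there i∈S)   = ≤-trans (term≤∑∈ S 0≤f i∈S) (x≤y+x (0≤f k))

  two-terms≤∑∈ : ∀ (S : List O) {f} → (∀ i → 0# ≤ f i) → ∀ {i k} → i ≢ k → i ∈ S → k ∈ S → f i + f k ≤ ∑∈ S f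
  two-terms≤∑∈ (_ ∷ S) 0≤f i≢k (here ≡.refl) (here ≡.refl) = contradiction ≡.refl i≢k
  two-terms≤∑∈ (_ ∷ S) 0≤f i≢k (here ≡.refl) (there k∈S)   = +-mono-≤ ≤-refl (term≤∑∈ S 0≤f k∈S)
  two-terms≤∑∈ (_ ∷ S) 0≤f i≢k (there i∈S)   (here ≡.refl) =
    ≤-cong (+-comm _ _) refl (+-mono-≤ ≤-refl (term≤∑∈ S 0≤f i∈S))
  two-terms≤∑∈ (l ∷ S) 0≤f i≢k (there i∈S)   (there k∈S)   =
    ≤-trans (two-terms≤∑∈ S 0≤f i≢k i∈S k∈S) (x≤y+x (0≤f l))

  -- `loadUpTo` is by definition such a partial sum of contributions, so facts about `prefix` apply
  -- to loads without conversion.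
  prefix : (Fin n → ℝ) → ℕ → ℝ
  prefix a t = sum λ k → when (toℕ k <ᵇ t) (a k)

  prefix-zero : ∀ (a : Fin n → ℝ) → prefix a 0 ≈ 0#
  prefix-zero {n} a = sum-zero {n} (λ _ → refl)

  prefix-suc : ∀ (a : Fin n → ℝ) j → prefix a (suc (toℕ j)) ≈ prefix a (toℕ j) + a j
  prefix-suc {suc n} a fzero    = trans (+-congˡ (sum-zero {n} (λ _ → refl)))
    (trans (solve 1 (λ x → x :+ :0 := :0 :+ :0 :+ x) (a fzero)) (+-congʳ (+-congˡ (sym (sum-zero {n} (λ _ → refl))))))
  prefix-suc {suc n} a (fsuc j) = trans (+-congˡ (prefix-suc (λ k → a (fsuc k)) j)) (sym (+-assoc _ _ _))

  prefix-all : ∀ (a : Fin n → ℝ) → prefix a n ≈ sum a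
  prefix-all {zero}  a = refl
  prefix-all {suc n} a = +-congˡ (prefix-all (λ k → a (fsuc k)))

  prefix≤prefix-all : ∀ {a : Fin n → ℝ} t → (∀ k → 0# ≤ a k) → prefix a t ≤ prefix a n
  prefix≤prefix-all {n} {a} t 0≤a = ≤-cong refl (sym (prefix-all a)) (sum-mono (λ k → when≤ (toℕ k <ᵇ t) (0≤a k)))
    where
    when≤ : ∀ b {x} → 0# ≤ x → when b x ≤ x
    when≤ true  0≤x = ≤-refl
    when≤ false 0≤x = 0≤x

  ⟨⟩-cong : ∀ {a b c d : Fin m → ℝ} → (∀ e → a e ≈ c e) → (∀ e → b e ≈ d e) → ⟨ a , b ⟩ ≈ ⟨ c , d ⟩
  ⟨⟩-cong a≈c b≈d = sum-cong (λ e → *-cong (a≈c e) (b≈d e))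

  ⟨⟩-comm : ∀ (a b : Fin m → ℝ) → ⟨ a , b ⟩ ≈ ⟨ b , a ⟩
  ⟨⟩-comm a b = sum-cong (λ e → *-comm (a e) (b e))

  ⟨⟩-+ʳ : ∀ (a b c : Fin m → ℝ) → ⟨ a , (λ e → b e + c e) ⟩ ≈ ⟨ a , b ⟩ + ⟨ a , c ⟩
  ⟨⟩-+ʳ a b c = trans (sum-cong (λ e → distribˡ (a e) (b e) (c e))) (sum-+ (λ e → a e * b e) (λ e → a e * c e))

  ⟨⟩-*ʳ : ∀ x (a b : Fin m → ℝ) → ⟨ a , (λ e → x * b e) ⟩ ≈ x * ⟨ a , b ⟩
  ⟨⟩-*ʳ x a b = trans (sum-cong (λ e → solve 3 (λ a x b → a :* (x :* b) := x :* (a :* b)) (a e) x (b e)))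
    (sym (sum-*ˡ x (λ e → a e * b e)))

  ⟨⟩-** : ∀ x y (a b : Fin m → ℝ) → ⟨ (λ e → x * a e) , (λ e → y * b e) ⟩ ≈ x * y * ⟨ a , b ⟩
  ⟨⟩-** x y a b = trans (sum-cong (λ e → solve 4 (λ x a y b → x :* a :* (y :* b) := x :* y :* (a :* b)) x (a e) y (b e)))
    (sym (sum-*ˡ (x * y) (λ e → a e * b e)))

  ⟨⟩-sumʳ : ∀ (a : Fin m → ℝ) (b : Fin n → Fin m → ℝ) → ⟨ a , (λ e → sum (λ k → b k e)) ⟩ ≈ sum (λ k → ⟨ a , b k ⟩)
  ⟨⟩-sumʳ a b = trans (sum-cong (λ e → sum-*ˡ (a e) (λ k → b k e))) (∑-comm (λ e k → a e * b k e))

  ‖‖²-+ : ∀ (a b : Fin m → ℝ) → ‖ (λ e → a e + b e) ‖² ≈ ‖ a ‖² + fromℕ 2 * ⟨ a , b ⟩ + ‖ b ‖²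
  ‖‖²-+ a b = begin-equality
    ‖ (λ e → a e + b e) ‖²
      ≈⟨ sum-cong (λ e → solve 2 (λ a b → (a :+ b) :* (a :+ b) := a :* a :+ ♯ 2 :* (a :* b) :+ b :* b) (a e) (b e)) ⟩
    sum (λ e → a e * a e + fromℕ 2 * (a e * b e) + b e * b e)
      ≈⟨ sum-+ (λ e → a e * a e + fromℕ 2 * (a e * b e)) _ ⟩
    sum (λ e → a e * a e + fromℕ 2 * (a e * b e)) + ‖ b ‖²
      ≈⟨ +-congʳ (sum-+ (λ e → a e * a e) _) ⟩
    ‖ a ‖² + sum (λ e → fromℕ 2 * (a e * b e)) + ‖ b ‖²
      ≈⟨ +-congʳ (+-congˡ (sum-*ˡ (fromℕ 2) (λ e → a e * b e))) ⟨
    ‖ a ‖² + fromℕ 2 * ⟨ a , b ⟩ + ‖ b ‖² ∎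

  ‖‖²-nonNegative : ∀ (a : Fin m → ℝ) → 0# ≤ ‖ a ‖²
  ‖‖²-nonNegative a = sum-nonNegative (λ e → x²≥0 (a e))

  -- Half of the square of `a - b` is nonnegative; `b` is scaled by minus one so that the rules for
  -- sums and multiples apply.
  young : ∀ (a b : Fin m → ℝ) → ⟨ a , b ⟩ - ½ * ‖ b ‖² ≤ ½ * ‖ a ‖²
  young a b = ≤-by (*-nonNegative (recip≥0 1) (‖‖²-nonNegative (λ e → a e + - 1# * b e))) (begin-equality
    ½ * ‖ a ‖² - (⟨ a , b ⟩ - ½ * ‖ b ‖²)
      ≈⟨ solve 3 (λ p q r → :½ :* p :- (q :- :½ :* r) := :½ :* (p :+ ♯ 2 :* (:- :1 :* q) :+ :- :1 :* :- :1 :* r)) ‖ a ‖² ⟨ a , b ⟩ ‖ b ‖² ⟩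
    ½ * (‖ a ‖² + fromℕ 2 * (- 1# * ⟨ a , b ⟩) + - 1# * - 1# * ‖ b ‖²)
      ≈⟨ *-congˡ (+-cong (+-congˡ (*-congˡ (⟨⟩-*ʳ (- 1#) a b))) (⟨⟩-** (- 1#) (- 1#) b b)) ⟨
    ½ * (‖ a ‖² + fromℕ 2 * ⟨ a , (λ e → - 1# * b e) ⟩ + ‖ (λ e → - 1# * b e) ‖²)
      ≈⟨ *-congˡ (‖‖²-+ a (λ e → - 1# * b e)) ⟨
    ½ * ‖ (λ e → a e + - 1# * b e) ‖² ∎)

  -- Peel off one job at a time; the off-diagonal constraints bound the cross terms.
  dual-bound : ∀ {n} (y : Fin n → ℝ) (ν : Fin m → ℝ) (a v : Fin n → Fin m → ℝ) →
    (∀ j → y j ≤ ‖ a j ‖² - ½ * ‖ v j ‖² + ⟨ ν , v j ⟩) →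
    (∀ j k → j ≢ k → ⟨ v j , v k ⟩ ≤ fromℕ 2 * ⟨ a j , a k ⟩) →
    sum y ≤ ‖ (λ e → sum (λ j → a j e)) ‖² + (⟨ ν , (λ e → sum (λ j → v j e)) ⟩ - ½ * ‖ (λ e → sum (λ j → v j e)) ‖²)
  dual-bound {m} {n = zero} y ν a v y≤ v≤ = ≤-reflexive (sym (begin-equality
    ‖ 𝟎 ‖² + (⟨ ν , 𝟎 ⟩ - ½ * ‖ 𝟎 ‖²)
      ≈⟨ +-cong (sum-zero {m} (λ _ → zeroˡ 0#)) (+-cong (sum-zero (λ e → zeroʳ (ν e))) (-‿cong (*-congˡ (sum-zero {m} (λ _ → zeroˡ 0#))))) ⟩
    0# + (0# - ½ * 0#)
      ≈⟨ solve 0 (:0 :+ (:0 :- :½ :* :0) := :0) ⟩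
    0# ∎))
    where
    𝟎 : Fin m → ℝ
    𝟎 _ = 0#
  dual-bound {n = suc n} y ν a v y≤ v≤ = begin
    y fzero + sum (λ j → y (fsuc j))
      ≤⟨ +-mono-≤ (y≤ fzero) (dual-bound (λ j → y (fsuc j)) ν (λ j → a (fsuc j)) (λ j → v (fsuc j))
           (λ j → y≤ (fsuc j)) (λ j k j≢k → v≤ (fsuc j) (fsuc k) (λ j≡k → j≢k (suc-injective j≡k)))) ⟩
    (‖ a₀ ‖² - ½ * ‖ v₀ ‖² + ⟨ ν , v₀ ⟩) + (‖ A ‖² + (⟨ ν , V ⟩ - ½ * ‖ V ‖²))
      ≤⟨ ≤-by (x≤y⇒0≤y-x v₀V≤)
           (solve 8 (λ a² v² νv A² νV V² vV aA →
              (a² :+ ♯ 2 :* aA :+ A²) :+ ((νv :+ νV) :- :½ :* (v² :+ ♯ 2 :* vV :+ V²))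
                :- ((a² :- :½ :* v² :+ νv) :+ (A² :+ (νV :- :½ :* V²))) := ♯ 2 :* aA :- vV)
            ‖ a₀ ‖² ‖ v₀ ‖² ⟨ ν , v₀ ⟩ ‖ A ‖² ⟨ ν , V ⟩ ‖ V ‖² ⟨ v₀ , V ⟩ ⟨ a₀ , A ⟩) ⟩
    (‖ a₀ ‖² + fromℕ 2 * ⟨ a₀ , A ⟩ + ‖ A ‖²) + ((⟨ ν , v₀ ⟩ + ⟨ ν , V ⟩) - ½ * (‖ v₀ ‖² + fromℕ 2 * ⟨ v₀ , V ⟩ + ‖ V ‖²))
      ≈⟨ +-cong (‖‖²-+ a₀ A) (+-cong (⟨⟩-+ʳ ν v₀ V) (-‿cong (*-congˡ (‖‖²-+ v₀ V)))) ⟨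
    ‖ (λ e → a₀ e + A e) ‖² + (⟨ ν , (λ e → v₀ e + V e) ⟩ - ½ * ‖ (λ e → v₀ e + V e) ‖²) ∎
    where
    a₀ = a fzero
    v₀ = v fzero
    A = λ e → sum (λ j → a (fsuc j) e)
    V = λ e → sum (λ j → v (fsuc j) e)

    v₀V≤ : ⟨ v₀ , V ⟩ ≤ fromℕ 2 * ⟨ a₀ , A ⟩
    v₀V≤ = begin
      ⟨ v₀ , V ⟩                                      ≈⟨ ⟨⟩-sumʳ v₀ (λ j → v (fsuc j)) ⟩
      sum (λ j → ⟨ v₀ , v (fsuc j) ⟩)                 ≤⟨ sum-mono (λ j → v≤ fzero (fsuc j) λ ()) ⟩
      sum (λ j → fromℕ 2 * ⟨ a₀ , a (fsuc j) ⟩)       ≈⟨ sum-*ˡ (fromℕ 2) (λ j → ⟨ a₀ , a (fsuc j) ⟩) ⟨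
      fromℕ 2 * sum (λ j → ⟨ a₀ , a (fsuc j) ⟩)       ≈⟨ *-congˡ (⟨⟩-sumʳ a₀ (λ j → a (fsuc j))) ⟨
      fromℕ 2 * ⟨ a₀ , A ⟩                            ∎

-- Weak duality and fitted dual solutions

module DualFittingFramework (R : CompleteOrderedField) where
  open Sums R public
  open LB using (Model; standard; hypergraph; Job; module Job; Instance; Assignment; FractionalChoice; module FractionalChoice
                ; IntegralChoice; IsIntegral; loadUpTo; load; CostFunction; cost; DualSolution; DualFeasible; objective
                ; WeakDuality; Algorithm; run; AlgorithmClass; Fractional; Deterministic; Rule; Follows; Competitive
                ; DualFitting; AnalyzedByDualFitting; OptimalRatio; greedy; balance; fracBalance; expectedCost) public
  open Job public

  private
    variable
      m : ℕ

  on : (M : Model) → Model.Option M m → (Fin m → ℝ) → Fin m → ℝ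
  on M i w e = when (Model.uses M i e) (w e)

  -- In terms of the restriction on M i w of the weights to the machines used
  -- by i, both models look alike.
  record Lawful (M : Model) : Set where
    open Model M
    field
      _≟ᵒ_      : DecidableEquality (Option m)
      diagonal≈ : ∀ (w : Fin m → ℝ) i → diagonal w i ≈ ‖ on M i w ‖²
      cross≈    : ∀ (w w′ : Fin m → ℝ) i i′ → cross w w′ i i′ ≈ fromℕ 2 * ⟨ on M i w , on M i′ w′ ⟩
      share≈    : ∀ {S : List (Option m)} {x i} → Unique S → i ∈ S → x i ≈ 1# → (∀ k → k ≢ i → x k ≈ 0#) →
                  ∀ e → share S x e ≈ when (uses i e) 1#

  standard-lawful : Lawful standard
  standard-lawful = record
    { _≟ᵒ_      = _≟ᶠ_
    ; diagonal≈ = λ w i → sym (trans (sum-δ-* i w (on standard i w)) (*-congˡ (reflexive (when-true (i ≟ᶠ i) ≡.refl))))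
    ; cross≈    = cross≈
    ; share≈    = λ {m} {S} {x} {i} → share≈ x i
    }
    where
    cross≈ : ∀ (w w′ : Fin m → ℝ) i i′ →
      when ⌊ i ≟ᶠ i′ ⌋ (fromℕ 2 * (w i * w′ i′)) ≈ fromℕ 2 * ⟨ on standard i w , on standard i′ w′ ⟩
    cross≈ w w′ i i′ = sym (trans (*-congˡ (trans (⟨⟩-comm (on standard i w) (on standard i′ w′)) (sum-δ-* i′ w′ (on standard i w)))) (by-cases (i ≟ᶠ i′)))
      where
      by-cases : (d : Dec (i ≡ i′)) → fromℕ 2 * (w′ i′ * when ⌊ d ⌋ (w i′)) ≈ when ⌊ d ⌋ (fromℕ 2 * (w i * w′ i′))
      by-cases (yes ≡.refl) = *-congˡ (*-comm _ _)
      by-cases (no _)       = trans (*-congˡ (zeroʳ _)) (zeroʳ _)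

    share≈ : ∀ {S : List (Fin m)} x i → Unique S → i ∈ S → x i ≈ 1# → (∀ k → k ≢ i → x k ≈ 0#) →
             ∀ e → x e ≈ when ⌊ i ≟ᶠ e ⌋ 1#
    share≈ x i _ _ xi≈1 x≈0 e with i ≟ᶠ e
    ... | yes ≡.refl = xi≈1
    ... | no i≢e     = x≈0 e (λ e≡i → i≢e (≡.sym e≡i))

  hypergraph-lawful : Lawful hypergraph
  hypergraph-lawful = record
    { _≟ᵒ_      = ≡-dec _≟ᵇ_
    ; diagonal≈ = λ w i → sum-cong (λ e → when-² ⌊ e ∈? i ⌋ (w e))
    ; cross≈    = λ w w′ i i′ → *-congˡ (sum-cong (λ e → when-∩ i i′ e (w e) (w′ e)))
    ; share≈    = λ {m} {S} {x} {i} S! i∈S xi≈1 x≈0 e → trans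
        (∑∈-single (λ k → when ⌊ e ∈? k ⌋ (x k)) S! i∈S (λ k k≢i → trans (when-cong ⌊ e ∈? k ⌋ (x≈0 k k≢i)) (when-0 ⌊ e ∈? k ⌋)))
        (when-cong ⌊ e ∈? i ⌋ xi≈1)
    }
    where
    when-0 : ∀ b → when b 0# ≈ 0#
    when-0 true  = refl
    when-0 false = refl

    when-² : ∀ b x → when b (x ²) ≈ when b x ²
    when-² true  x = refl
    when-² false x = sym (zeroˡ 0#)

    when-∩ : ∀ (i i′ : Subset m) e x y → when ⌊ e ∈? (i ∩ i′) ⌋ (x * y) ≈ when ⌊ e ∈? i ⌋ x * when ⌊ e ∈? i′ ⌋ y
    when-∩ i i′ e x y with e ∈? i | e ∈? i′
    ... | yes e∈i | yes e∈i′ = reflexive (when-true (e ∈? (i ∩ i′)) (x∈p∩q⁺ (e∈i , e∈i′)))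
    ... | yes e∈i | no e∉i′  = trans (reflexive (when-false (e ∈? (i ∩ i′)) (λ e∈∩ → e∉i′ (proj₂ (x∈p∩q⁻ i i′ e∈∩))))) (sym (zeroʳ x))
    ... | no e∉i  | _        = trans (reflexive (when-false (e ∈? (i ∩ i′)) (λ e∈∩ → e∉i (proj₁ (x∈p∩q⁻ i i′ e∈∩))))) (sym (zeroˡ _))

  module _ {M : Model} (lawful : Lawful M) where
    open Model M
    open Lawful lawful

    module _ {J : Job M m} {x : Option m → ℝ} (choice : FractionalChoice M J x) where
      open FractionalChoice choice using (x≥0; infeasible)

      -- Entries are nonnegative and total one, so an entry equal to one leaves nothing for the
      -- rest.
      other-options : ∀ {i} → i ∈ feasible J → x i ≈ 1# → ∀ k → k ≢ i → x k ≈ 0#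
      other-options {i} i∈S xi≈1 k k≢i with any? (k ≟ᵒ_) (feasible J)
      ... | no k∉S  = infeasible k k∉S
      ... | yes k∈S = antisym
        (≤-by (x≤y⇒0≤y-x (two-terms≤∑∈ (feasible J) x≥0 k≢i k∈S i∈S))
          (trans (solve 1 (λ a → :0 :- a := :1 :- (a :+ :1)) (x k)) (+-cong (sym (FractionalChoice.total choice)) (-‿cong (+-congˡ (sym xi≈1))))))
        (x≥0 k)

      share-of-option : ∀ {i} → i ∈ feasible J → x i ≈ 1# →
                        ∀ e → weight J e * share (feasible J) x e ≈ on M i (weight J) e
      share-of-option {i} i∈S xi≈1 e = trans (*-congˡ (share≈ (unique J) i∈S xi≈1 (other-options i∈S xi≈1) e))
        (trans (*-when (uses i e) 1#) (when-cong (uses i e) (*-identityʳ _)))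

    some-one : ∀ (S : List (Option m)) {x} → (∀ i → x i ≈ 0# ⊎ x i ≈ 1#) → ¬ (∑∈ S x ≈ 0#) →
               ∃[ i ] (i ∈ S × x i ≈ 1#)
    some-one []      0∨1 ∑≉0 = contradiction refl ∑≉0
    some-one (i ∷ S) 0∨1 ∑≉0 with 0∨1 i
    ... | inj₂ xi≈1 = i , here ≡.refl , xi≈1
    ... | inj₁ xi≈0 with some-one S 0∨1 (λ ∑≈0 → ∑≉0 (trans (+-cong xi≈0 ∑≈0) (+-identityˡ 0#)))
    ...   | k , k∈S , xk≈1 = k , there k∈S , xk≈1

    chosen-option : ∀ {J : Job M m} {x} → IntegralChoice M J x → ∃[ i ] (i ∈ feasible J × x i ≈ 1#)
    chosen-option {J = J} (choice , 0∨1) = some-one (feasible J) 0∨1 λ ∑≈0 →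
      1≉0 (trans (sym (FractionalChoice.total choice)) ∑≈0)

    -- The constraints added up are those of the pairs `(σ j , j)` selected by the integral
    -- assignment. With `V` the sum of the selected vectors, they bound the objective by the cost
    -- minus half of `‖ ν - V ‖²`; discarding that square is `young`.
    weakDuality : WeakDuality M
    weakDuality {m} I d x feas integral = begin
      sum y - ½ * ‖ ν ‖²
        ≤⟨ +-mono-≤ (dual-bound y ν a v′ y≤ v≤) ≤-refl ⟩
      ‖ A ‖² + (⟨ ν , V ⟩ - ½ * ‖ V ‖²) - ½ * ‖ ν ‖²
        ≤⟨ ≤-by (x≤y⇒0≤y-x (young ν V)) (solve 3 (λ a b c → a :- (a :+ b :- c) := c :- b) ‖ A ‖² (⟨ ν , V ⟩ - ½ * ‖ V ‖²) (½ * ‖ ν ‖²)) ⟩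
      ‖ A ‖²
        ≈⟨ ⟨⟩-cong A≈load A≈load ⟩
      cost M I x ∎
      where
      open DualSolution d
      open DualFeasible feas

      w : Fin (length I) → Fin m → ℝ
      w j = weight (lookup I j)

      σ : Fin (length I) → Option m
      σ j = proj₁ (chosen-option (integral j))

      σ∈ : ∀ j → σ j ∈ feasible (lookup I j)
      σ∈ j = proj₁ (proj₂ (chosen-option (integral j)))

      a v′ : Fin (length I) → Fin m → ℝ
      a j = on M (σ j) (w j)
      v′ j = v (σ j) j

      A V : Fin m → ℝ
      A e = sum (λ j → a j e)
      V e = sum (λ j → v′ j e)

      A≈load : ∀ e → A e ≈ load M I x e
      A≈load e = sym (trans (prefix-all (λ j → w j e * share (feasible (lookup I j)) (λ i → x i j) e))
        (sum-cong (λ j → share-of-option (proj₁ (integral j)) (σ∈ j) (proj₂ (proj₂ (chosen-option (integral j)))) e)))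

      y≤ : ∀ j → y j ≤ ‖ a j ‖² - ½ * ‖ v′ j ‖² + ⟨ ν , v′ j ⟩
      y≤ j = ≤-cong refl (+-congʳ (+-congʳ (diagonal≈ (w j) (σ j)))) (y-bound j (σ j) (σ∈ j))

      v≤ : ∀ j k → j ≢ k → ⟨ v′ j , v′ k ⟩ ≤ fromℕ 2 * ⟨ a j , a k ⟩
      v≤ j k j≢k = ≤-cong refl (cross≈ (w j) (w k) (σ j) (σ k))
        (v-bound j (σ j) k (σ k) (σ∈ j) (σ∈ k) (λ { (_ , j≡k) → j≢k j≡k }))

    competitive : ∀ {Class : AlgorithmClass M} {rule : Rule M} {costOf : CostFunction M} {c} → c ≰ 0# → DualFitting M Class rule costOf c →
      (A : Algorithm M) → Class A → Follows M rule A → Competitive M costOf A c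
    competitive {costOf = costOf} {c} c≰0 (fit , fits) A A∈Class follows I z integral = begin
      costOf I (run M A I)                  ≈⟨ *-identityˡ _ ⟨
      1# * costOf I (run M A I)             ≈⟨ *-congʳ (⁻¹-inverseʳ c (≰0⇒≉0 c≰0)) ⟨
      c * c ⁻¹ * costOf I (run M A I)       ≈⟨ *-assoc _ _ _ ⟩
      c * (c ⁻¹ * costOf I (run M A I))     ≤⟨ *-monoˡ-≤ (≰⇒≥ c≰0) (proj₂ (fits A A∈Class follows I)) ⟩
      c * objective M I (fit I (run M A I)) ≤⟨ *-monoˡ-≤ (≰⇒≥ c≰0) (weakDuality I _ z (proj₁ (fits A A∈Class follows I)) integral) ⟩
      c * cost M I z                        ∎

    -- All three fitted solutions have this form.
    proportional : ℝ → ℝ → (I : Instance M m) → Assignment M I → (Fin (length I) → ℝ) → DualSolution M I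
    proportional α β I x y = record
      { y = y
      ; ν = λ e → β * load M I x e
      ; v = λ i j e → α * on M i (weight (lookup I j)) e
      }

    on-nonNegative : ∀ (J : Job M m) i e → 0# ≤ on M i (weight J) e
    on-nonNegative J i e = when-nonNegative (uses i e) (weight≥0 J e)

    -- Nonnegative weights make every `⟨ a , b ⟩` nonnegative, so one condition on `α` settles all
    -- cross constraints, and only the bound on `y` is left to the individual algorithms.
    proportional-feasible : ∀ {α β} (I : Instance M m) (x : Assignment M I) {y} → α ² ≤ fromℕ 2 →
      (∀ j i → i ∈ feasible (lookup I j) → let a = on M i (weight (lookup I j)) in
        y j ≤ (1# - ½ * α ²) * ‖ a ‖² + β * α * ⟨ load M I x , a ⟩) →
      DualFeasible M I (proportional α β I x y)
    proportional-feasible {m} {α} {β} I x {y} α²≤2 y≤ = record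
      { y-bound = λ j i i∈S → let a = on M i (weight (lookup I j)) in begin
          y j                                                             ≤⟨ y≤ j i i∈S ⟩
          (1# - ½ * α ²) * ‖ a ‖² + β * α * ⟨ load M I x , a ⟩
            ≈⟨ solve 4 (λ α a² b l → (:1 :- :½ :* (α :* α)) :* a² :+ b :* α :* l := a² :- :½ :* (α :* α :* a²) :+ b :* α :* l) α ‖ a ‖² β ⟨ load M I x , a ⟩ ⟩
          ‖ a ‖² - ½ * (α * α * ‖ a ‖²) + β * α * ⟨ load M I x , a ⟩
            ≈⟨ +-cong (+-cong (diagonal≈ (weight (lookup I j)) i) (-‿cong (*-congˡ (⟨⟩-** α α a a)))) (⟨⟩-** β α (load M I x) a) ⟨
          diagonal (weight (lookup I j)) i - ½ * ‖ (λ e → α * a e) ‖² + ⟨ (λ e → β * load M I x e) , (λ e → α * a e) ⟩ ∎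
      ; v-bound = λ j i k i′ _ _ _ → let a = on M i (weight (lookup I j)) ; b = on M i′ (weight (lookup I k)) in begin
          ⟨ (λ e → α * a e) , (λ e → α * b e) ⟩    ≈⟨ ⟨⟩-** α α a b ⟩
          α * α * ⟨ a , b ⟩                        ≤⟨ *-monoʳ-≤ (sum-nonNegative (λ e → *-nonNegative (on-nonNegative (lookup I j) i e) (on-nonNegative (lookup I k) i′ e))) α²≤2 ⟩
          fromℕ 2 * ⟨ a , b ⟩                      ≈⟨ cross≈ (weight (lookup I j)) (weight (lookup I k)) i i′ ⟨
          cross (weight (lookup I j)) (weight (lookup I k)) i i′ ∎
      }

    proportional-objective : ∀ {α β} (I : Instance M m) (x : Assignment M I) {y} →
      objective M I (proportional α β I x y) ≈ sum y - ½ * (β ² * cost M I x)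
    proportional-objective {β = β} I x = +-congˡ (-‿cong (*-congˡ (⟨⟩-** β β (load M I x) (load M I x))))

    contribution : (I : Instance M m) → Assignment M I → Fin (length I) → Fin m → ℝ
    contribution I x j e = weight (lookup I j) e * share (feasible (lookup I j)) (λ i → x i j) e

    loadAfter : ∀ (I : Instance M m) x j e →
      loadUpTo M I x (suc (toℕ j)) e ≈ loadUpTo M I x (toℕ j) e + contribution I x j e
    loadAfter I x j e = prefix-suc (λ k → contribution I x k e) j

    costUpTo : (I : Instance M m) → Assignment M I → ℕ → ℝ
    costUpTo I x t = ‖ loadUpTo M I x t ‖²

    -- Charging to each job the growth of the cost at its arrival distributes the whole cost; all
    -- three choices of `y` build on these charges.
    cost-telescope : ∀ (I : Instance M m) x →
      sum {length I} (λ j → costUpTo I x (suc (toℕ j)) - costUpTo I x (toℕ j)) ≈ cost M I x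
    cost-telescope {m} I x = begin-equality
      sum {length I} (λ j → costUpTo I x (suc (toℕ j)) - costUpTo I x (toℕ j)) ≈⟨ telescope (length I) (costUpTo I x) ⟩
      cost M I x - costUpTo I x 0       ≈⟨ +-congˡ (-‿cong costUpTo-0) ⟩
      cost M I x - 0#                   ≈⟨ solve 1 (λ c → c :- :0 := c) (cost M I x) ⟩
      cost M I x                        ∎
      where
      costUpTo-0 : costUpTo I x 0 ≈ 0#
      costUpTo-0 = sum-zero {m} (λ e → trans (*-congʳ (prefix-zero (λ k → contribution I x k e))) (zeroˡ _))

-- Algorithms driven by loads, and the analysis of Greedy

module OnlineAlgorithms (R : CompleteOrderedField) where
  open DualFittingFramework R public

  private
    variable
      m : ℕ
      O : Set

  module _ (M : Model) where
    open Model M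

    -- All three algorithms know the past only through the current loads. An `Algorithm` receives
    -- the earlier jobs but not its own earlier decisions, so `loadBased` replays them by folding
    -- `step`.
    LoadBased : Set
    LoadBased = ∀ {m} → (Fin m → ℝ) → Job M m → Option m → ℝ

    module _ (choose : LoadBased) where
      step : (Fin m → ℝ) → Job M m → Fin m → ℝ
      step s J e = s e + weight J e * share (feasible J) (choose s J) e

      loadBased : Algorithm M
      loadBased past J = choose (foldl step (λ _ → 0#) past) J

      private
        -- The starting load varies because the induction absorbs the first job into it.
        loads : ∀ (s : Fin m → ℝ) (I : Instance M m) t e →
          foldl step s (take t I) e ≈ s e + prefix {length I} (λ k → weight (lookup I k) e *
            share (feasible (lookup I k)) (choose (foldl step s (take (toℕ k) I)) (lookup I k)) e) t
        loads s []      zero    e = sym (+-identityʳ _)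
        loads s []      (suc t) e = sym (+-identityʳ _)
        loads s (J ∷ I) zero    e = sym (trans (+-congˡ (sum-zero {suc (length I)} (λ _ → refl))) (+-identityʳ _))
        loads s (J ∷ I) (suc t) e = trans (loads (step s J) I t e) (+-assoc _ _ _)

      loadBased-state : ∀ (I : Instance M m) (j : Fin (length I)) e →
        foldl step (λ _ → 0#) (take (toℕ j) I) e ≈ loadUpTo M I (run M loadBased I) (toℕ j) e
      loadBased-state I j e = trans (loads (λ _ → 0#) I (toℕ j) e) (+-identityˡ _)

  minimum : ∀ (f : O → ℝ) (S : List O) → S ≢ [] → ∃[ i ] (i ∈ S × (∀ k → k ∈ S → f i ≤ f k))
  minimum f []          S≢[] = contradiction ≡.refl S≢[]
  minimum f (i ∷ [])    _ = i , here ≡.refl , λ { k (here ≡.refl) → ≤-refl }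
  minimum f (i ∷ l ∷ S) _ with minimum f (l ∷ S) (λ ())
  ... | k , k∈ , least with total (f i) (f k)
  ...   | inj₁ fi≤fk = i , here ≡.refl , λ { _ (here ≡.refl) → ≤-refl ; k′ (there k′∈) → ≤-trans fi≤fk (least k′ k′∈) }
  ...   | inj₂ fk≤fi = k , there k∈ , λ { _ (here ≡.refl) → fk≤fi ; k′ (there k′∈) → least k′ k′∈ }

  module _ {M : Model} (lawful : Lawful M) where
    open Model M
    open Lawful lawful

    indicator : Option m → Option m → ℝ
    indicator i k = when ⌊ i ≟ᵒ k ⌋ 1#

    indicator-integral : ∀ {J : Job M m} {i} → i ∈ feasible J → IntegralChoice M J (indicator i)
    indicator-integral {J = J} {i} i∈S = record
      { x≥0        = λ k → when-nonNegative ⌊ i ≟ᵒ k ⌋ 0≤1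
      ; x≤1        = λ k → ≤1 ⌊ i ≟ᵒ k ⌋
      ; total      = trans (∑∈-single (indicator i) (unique J) i∈S (λ k k≢i → reflexive (when-false (i ≟ᵒ k) (λ i≡k → k≢i (≡.sym i≡k)))))
                           (reflexive (when-true (i ≟ᵒ i) ≡.refl))
      ; infeasible = λ k k∉S → reflexive (when-false (i ≟ᵒ k) (λ { ≡.refl → k∉S i∈S }))
      } , λ k → 0∨1 ⌊ i ≟ᵒ k ⌋
      where
      ≤1 : ∀ b → when b 1# ≤ 1#
      ≤1 true  = ≤-refl
      ≤1 false = 0≤1

      0∨1 : ∀ b → when b 1# ≈ 0# ⊎ when b 1# ≈ 1#
      0∨1 true  = inj₂ refl
      0∨1 false = inj₁ refl

    increase : (Fin m → ℝ) → Job M m → Option m → ℝ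
    increase s J i = ‖ (λ e → s e + on M i (weight J) e) ‖² - ‖ s ‖²

    increase-cong : ∀ {s s′ : Fin m → ℝ} (J : Job M m) i → (∀ e → s e ≈ s′ e) → increase s J i ≈ increase s′ J i
    increase-cong J i s≈s′ = +-cong (⟨⟩-cong (λ e → +-congʳ (s≈s′ e)) (λ e → +-congʳ (s≈s′ e))) (-‿cong (⟨⟩-cong s≈s′ s≈s′))

    -- Greedy compares options at the current loads, but `ν` is made of the final ones. Loads only
    -- grow and weights are nonnegative, so the linear term may be enlarged from `s` to `t`.
    increase≤ : ∀ {s t : Fin m → ℝ} (J : Job M m) i → (∀ e → s e ≤ t e) →
      increase s J i ≤ ‖ on M i (weight J) ‖² + fromℕ 2 * ⟨ t , on M i (weight J) ⟩
    increase≤ {s = s} {t} J i s≤t = let a = on M i (weight J) in begin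
      increase s J i                                                 ≈⟨ +-congʳ (‖‖²-+ s a) ⟩
      ‖ s ‖² + fromℕ 2 * ⟨ s , a ⟩ + ‖ a ‖² - ‖ s ‖²                 ≈⟨ solve 3 (λ s² sa a² → s² :+ ♯ 2 :* sa :+ a² :- s² := a² :+ ♯ 2 :* sa) ‖ s ‖² ⟨ s , a ⟩ ‖ a ‖² ⟩
      ‖ a ‖² + fromℕ 2 * ⟨ s , a ⟩
        ≤⟨ +-mono-≤ ≤-refl (*-monoˡ-≤ (fromℕ≥0 2) (sum-mono (λ e → *-monoʳ-≤ (on-nonNegative lawful J i e) (s≤t e)))) ⟩
      ‖ a ‖² + fromℕ 2 * ⟨ t , a ⟩                                   ∎

    greedyOption : (Fin m → ℝ) → Job M m → Option m
    greedyOption s J = proj₁ (minimum (increase s J) (feasible J) (nonempty J))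

    greedyOption∈ : ∀ (s : Fin m → ℝ) J → greedyOption s J ∈ feasible J
    greedyOption∈ s J = proj₁ (proj₂ (minimum (increase s J) (feasible J) (nonempty J)))

    greedyAlgorithm : Algorithm M
    greedyAlgorithm = loadBased M (λ s J → indicator (greedyOption s J))

    greedyAlgorithm-follows : Follows M (greedy M) greedyAlgorithm
    greedyAlgorithm-follows I j =
      greedyOption state J , greedyOption∈ state J , reflexive (when-true (greedyOption state J ≟ᵒ greedyOption state J) ≡.refl) ,
      λ k k∈S → ≤-cong (increase-cong J (greedyOption state J) (state≈)) (increase-cong J k state≈)
        (proj₂ (proj₂ (minimum (increase state J) (feasible J) (nonempty J))) k k∈S)
      where
      J = lookup I j
      state = foldl (step M (λ s J → indicator (greedyOption s J))) (λ _ → 0#) (take (toℕ j) I)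
      state≈ : ∀ e → state e ≈ loadUpTo M I (run M greedyAlgorithm I) (toℕ j) e
      state≈ = loadBased-state M (λ s J → indicator (greedyOption s J)) I j

    loadUpTo≤load : ∀ (I : Instance M m) x → (∀ j e → 0# ≤ contribution lawful I x j e) →
      ∀ t e → loadUpTo M I x t e ≤ load M I x e
    loadUpTo≤load I x 0≤c t e = prefix≤prefix-all t (λ j → 0≤c j e)

    -- With κ = 1 - α²/2 and βα = 2κ, the bounds κ increase ≤ κ (‖a‖² + 2⟨L,a⟩)
    -- are the constraints on y; α² = √2 maximises the ratio κ - β²/2.
    module Greedy {r : ℝ} (0≤r : 0# ≤ r) (r²≈2 : r * r ≈ fromℕ 2) where
      r≤2 : r ≤ fromℕ 2
      r≤2 = ≤-by (*-nonNegative (recip≥0 3) (+-nonNegative (x²≥0 (r - fromℕ 2)) (fromℕ≥0 2)))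
        (≈-mod r²≈2 (solve 1 (λ r → ♯ 2 :- r := con (recip 3) :* ((r :- ♯ 2) :* (r :- ♯ 2) :+ ♯ 2) :+ (:- con (recip 3)) :* (r :* r :- ♯ 2)) r))

      fourthRoot = squareRoot r 0≤r

      α κ β : ℝ
      α = proj₁ fourthRoot
      κ = 1# - ½ * r
      -- Division-free form of `β = 2κ / α`: as `α` is a fourth root of 2, `2 / α` is the cube of
      -- `α`.
      β = κ * (α * (α * α))

      α²≈r : α * α ≈ r
      α²≈r = proj₂ (proj₂ fourthRoot)

      0≤κ : 0# ≤ κ
      0≤κ = ≤-by (*-nonNegative (recip≥0 1) (x≤y⇒0≤y-x r≤2)) (solve 1 (λ r → :1 :- :½ :* r :- :0 := :½ :* (♯ 2 :- r)) r)

      βα≈2κ : β * α ≈ fromℕ 2 * κ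
      βα≈2κ = begin-equality
        κ * (α * (α * α)) * α     ≈⟨ solve 2 (λ k a → k :* (a :* (a :* a)) :* a := a :* a :* (a :* a) :* k) κ α ⟩
        α * α * (α * α) * κ       ≈⟨ *-congʳ (trans (*-cong α²≈r α²≈r) r²≈2) ⟩
        fromℕ 2 * κ               ∎

      β²≈ : β ² ≈ fromℕ 2 * r * κ * κ
      β²≈ = begin-equality
        β * β                                     ≈⟨ solve 2 (λ k a → k :* (a :* (a :* a)) :* (k :* (a :* (a :* a))) := a :* a :* (a :* a) :* (a :* a) :* k :* k) κ α ⟩
        α * α * (α * α) * (α * α) * κ * κ         ≈⟨ *-congʳ (*-congʳ (*-cong (trans (*-cong α²≈r α²≈r) r²≈2) α²≈r)) ⟩
        fromℕ 2 * r * κ * κ                       ∎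

      c : ℝ
      c = fromℕ 3 + fromℕ 2 * r

      c⁻¹≈ : c ⁻¹ ≈ fromℕ 3 - fromℕ 2 * r
      c⁻¹≈ = ⁻¹-unique (≈-mod r²≈2 (solve 1 (λ r → (♯ 3 :+ ♯ 2 :* r) :* (♯ 3 :- ♯ 2 :* r) := :1 :+ (:- ♯ 4) :* (r :* r :- ♯ 2)) r))

      c≰0 : c ≰ 0#
      c≰0 c≤0 = fromℕ-suc≰0 2 (≤-trans (x≤x+y (*-nonNegative (fromℕ≥0 2) 0≤r)) c≤0)

      fit : ∀ {m} (I : Instance M m) → Assignment M I → DualSolution M I
      fit I x = proportional lawful α β I x (λ j → κ * (costUpTo lawful I x (suc (toℕ j)) - costUpTo lawful I x (toℕ j)))

      fit-feasible : ∀ {m} (I : Instance M m) x → (∀ j → FractionalChoice M (lookup I j) (λ i → x i j)) →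
        (∀ j → greedy M I x j) → DualFeasible M I (fit I x)
      fit-feasible {m} I x choice follows = proportional-feasible lawful I x (≤-cong (sym α²≈r) refl r≤2) y≤
        where
        σ : Fin (length I) → Option m
        σ j = proj₁ (follows j)

        contribution≈ : ∀ j e → contribution lawful I x j e ≈ on M (σ j) (weight (lookup I j)) e
        contribution≈ j = share-of-option lawful (choice j) (proj₁ (proj₂ (follows j))) (proj₁ (proj₂ (proj₂ (follows j))))

        before : ∀ j → Fin m → ℝ
        before j = loadUpTo M I x (toℕ j)

        cost-increase : ∀ j → costUpTo lawful I x (suc (toℕ j)) - costUpTo lawful I x (toℕ j) ≈ increase (before j) (lookup I j) (σ j)
        cost-increase j = +-congʳ (⟨⟩-cong after≈ after≈)
          where
          after≈ : ∀ e → loadUpTo M I x (suc (toℕ j)) e ≈ before j e + on M (σ j) (weight (lookup I j)) e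
          after≈ e = trans (loadAfter lawful I x j e) (+-congˡ (contribution≈ j e))

        y≤ : ∀ j i → i ∈ feasible (lookup I j) → let a = on M i (weight (lookup I j)) in
          κ * (costUpTo lawful I x (suc (toℕ j)) - costUpTo lawful I x (toℕ j))
            ≤ (1# - ½ * α ²) * ‖ a ‖² + β * α * ⟨ load M I x , a ⟩
        y≤ j i i∈S = let a = on M i (weight (lookup I j)) in begin
          κ * (costUpTo lawful I x (suc (toℕ j)) - costUpTo lawful I x (toℕ j))
            ≈⟨ *-congˡ (cost-increase j) ⟩
          κ * increase (before j) (lookup I j) (σ j)
            ≤⟨ *-monoˡ-≤ 0≤κ (proj₂ (proj₂ (proj₂ (follows j))) i i∈S) ⟩
          κ * increase (before j) (lookup I j) i
            ≤⟨ *-monoˡ-≤ 0≤κ (increase≤ (lookup I j) i (loadUpTo≤load I x (λ k e → ≤-cong refl (sym (contribution≈ k e)) (on-nonNegative lawful (lookup I k) (σ k) e)) (toℕ j))) ⟩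
          κ * (‖ a ‖² + fromℕ 2 * ⟨ load M I x , a ⟩)
            ≈⟨ solve 3 (λ k a² La → k :* (a² :+ ♯ 2 :* La) := k :* a² :+ ♯ 2 :* k :* La) κ ‖ a ‖² ⟨ load M I x , a ⟩ ⟩
          κ * ‖ a ‖² + fromℕ 2 * κ * ⟨ load M I x , a ⟩
            ≈⟨ +-cong (*-congʳ (+-congˡ (-‿cong (*-congˡ α²≈r)))) (*-congʳ βα≈2κ) ⟨
          (1# - ½ * α ²) * ‖ a ‖² + β * α * ⟨ load M I x , a ⟩ ∎

      fit-objective : ∀ {m} (I : Instance M m) x → c ⁻¹ * cost M I x ≈ objective M I (fit I x)
      fit-objective I x = begin-equality
        c ⁻¹ * C                                       ≈⟨ *-congʳ c⁻¹≈ ⟩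
        (fromℕ 3 - fromℕ 2 * r) * C
          -- The factor of `C` is `κ - β ² / 2 = κ - r * κ * κ`. Since `r * κ = r - 1` and
          -- `2 - r = 2κ`, it equals `2 * κ * κ = 3 - 2r`, the inverse of `c`.
          ≈⟨ ≈-mod r²≈2 (solve 2 (λ r C → let k = :1 :- :½ :* r in
               (♯ 3 :- ♯ 2 :* r) :* C := k :* C :- :½ :* (♯ 2 :* r :* k :* k :* C) :+ (:- ((:1 :- con (recip 3) :* r) :* C)) :* (r :* r :- ♯ 2)) r C) ⟩
        κ * C - ½ * (fromℕ 2 * r * κ * κ * C)          ≈⟨ +-cong (*-congˡ (cost-telescope lawful I x)) (-‿cong (*-congˡ (*-congʳ β²≈))) ⟨
        κ * sum {length I} Δ - ½ * (β ² * C)           ≈⟨ +-congʳ (sum-*ˡ κ Δ) ⟩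
        sum {length I} (λ j → κ * Δ j) - ½ * (β ² * C) ≈⟨ proportional-objective lawful {α = α} I x ⟨
        objective M I (fit I x)                        ∎
        where
        C = cost M I x
        Δ : Fin (length I) → ℝ
        Δ j = costUpTo lawful I x (suc (toℕ j)) - costUpTo lawful I x (toℕ j)

      dualFitting : DualFitting M (Deterministic M) (greedy M) (cost M) c
      dualFitting = fit , λ A deterministic follows I →
        fit-feasible I (run M A I) (λ j → proj₁ (deterministic (take (toℕ j) I) (lookup I j))) (follows I) ,
        ≤-reflexive (fit-objective I (run M A I))

      analysis : AnalyzedByDualFitting M (Deterministic M) (greedy M) (cost M) c
      analysis = (greedyAlgorithm , (λ past J → indicator-integral (greedyOption∈ _ J)) , greedyAlgorithm-follows) ,
        dualFitting , competitive lawful {rule = greedy M} {costOf = cost M} c≰0 dualFitting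

-- Existence of balanced assignments

module Equilibria (R : CompleteOrderedField) where
  open OnlineAlgorithms R public

  infixl 8 _⁺

  _⁺ : ℝ → ℝ
  x ⁺ with 0# ≤? x
  ... | yes _ = x
  ... | no  _ = 0#

  x⁺≥0 : ∀ x → 0# ≤ x ⁺
  x⁺≥0 x with 0# ≤? x
  ... | yes 0≤x = 0≤x
  ... | no  _   = ≤-refl

  x≤x⁺ : ∀ x → x ≤ x ⁺
  x≤x⁺ x with 0# ≤? x
  ... | yes _   = ≤-refl
  ... | no  0≰x = ≰⇒≥ 0≰x

  x⁺≈0∨x⁺≈x : ∀ x → x ⁺ ≈ 0# ⊎ x ⁺ ≈ x
  x⁺≈0∨x⁺≈x x with 0# ≤? x
  ... | yes _ = inj₂ refl
  ... | no  _ = inj₁ refl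

  x≤0⇒x⁺≈0 : ∀ {x} → x ≤ 0# → x ⁺ ≈ 0#
  x≤0⇒x⁺≈0 {x} x≤0 with x⁺≈0∨x⁺≈x x
  ... | inj₁ x⁺≈0 = x⁺≈0
  ... | inj₂ x⁺≈x = antisym (≤-cong (sym x⁺≈x) refl x≤0) (x⁺≥0 x)

  0≤x⇒x⁺≈x : ∀ {x} → 0# ≤ x → x ⁺ ≈ x
  0≤x⇒x⁺≈x {x} 0≤x with x⁺≈0∨x⁺≈x x
  ... | inj₁ x⁺≈0 = trans x⁺≈0 (antisym 0≤x (≤-cong refl x⁺≈0 (x≤x⁺ x)))
  ... | inj₂ x⁺≈x = x⁺≈x

  ⁺-nonexpansive : ∀ {x y} → x ≤ y → y ⁺ ≤ x ⁺ + (y - x)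
  ⁺-nonexpansive {x} {y} x≤y with x⁺≈0∨x⁺≈x y
  ... | inj₁ y⁺≈0 = ≤-cong (sym y⁺≈0) refl (+-nonNegative (x⁺≥0 x) (x≤y⇒0≤y-x x≤y))
  ... | inj₂ y⁺≈y = ≤-cong (trans (solve 2 (λ x y → x :+ (y :- x) := y) x y) (sym y⁺≈y)) refl (+-mono-≤ (x≤x⁺ x) ≤-refl)

  -- Machines with affine latencies `a e + b e * t` share a flow of one. An average latency that is
  -- at most every single one forces all machines in use to have the least latency: a Wardrop
  -- equilibrium on parallel links.
  record Equilibrium {m} (S : List (Fin m)) (a b : Fin m → ℝ) : Set where
    field
      flow             : Fin m → ℝ
      flow≥0           : ∀ i → 0# ≤ flow i
      flow-total       : ∑∈ S flow ≈ 1#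
      flow-outside     : ∀ i → i ∉ S → flow i ≈ 0#
      average≤latency  : ∀ i → i ∈ S → ∑∈ S (λ e → flow e * (a e + b e * flow e)) ≤ a i + b i * flow i

  private
    -- Raising the common latency level s, machine i absorbs a flow of
    -- ((s - a i) / b i)⁺; the level sought is the one absorbing 1 in total.
    module WaterFilling {m} (S : List (Fin m)) {i₀} (i₀∈S : i₀ ∈ S) (a b : Fin m → ℝ)
      (a≥0 : ∀ i → 0# ≤ a i) (b≰0 : ∀ i → i ∈ S → b i ≰ 0#) where

      absorbed : ℝ → Fin m → ℝ
      absorbed s i = ((s - a i) * b i ⁻¹) ⁺

      G : ℝ → ℝ
      G s = ∑∈ S (absorbed s)

      K : ℝ
      K = ∑∈ S (λ i → b i ⁻¹)

      b⁻¹≥0 : ∀ i → i ∈ S → 0# ≤ b i ⁻¹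
      b⁻¹≥0 i i∈S = ⁻¹-nonNegative (b≰0 i i∈S)

      bb⁻¹≈1 : ∀ i → i ∈ S → b i * b i ⁻¹ ≈ 1#
      bb⁻¹≈1 i i∈S = ⁻¹-inverseʳ (b i) (≰0⇒≉0 (b≰0 i i∈S))

      K≰0 : K ≰ 0#
      K≰0 K≤0 = ⁻¹-positive (b≰0 i₀ i₀∈S) (≤-trans (go S i₀∈S b⁻¹≥0) K≤0)
        where
        go : ∀ (S : List (Fin m)) → i₀ ∈ S → (∀ i → i ∈ S → 0# ≤ b i ⁻¹) → b i₀ ⁻¹ ≤ ∑∈ S (λ i → b i ⁻¹)
        go (_ ∷ S) (here ≡.refl) 0≤ = x≤x+y (∑∈-nonNegative S (λ i i∈S → 0≤ i (there i∈S)))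
        go (i ∷ S) (there i₀∈S)  0≤ = ≤-trans (go S i₀∈S (λ k k∈S → 0≤ k (there k∈S))) (x≤y+x (0≤ i (here ≡.refl)))

      KK⁻¹≈1 : K * K ⁻¹ ≈ 1#
      KK⁻¹≈1 = ⁻¹-inverseʳ K (≰0⇒≉0 K≰0)

      -- This takes the place of continuity. If `G level` differed from one by `η`, the level could
      -- be moved by `η * K ⁻¹` without `G` crossing one, against the choice of `level` as a
      -- supremum; `G≤1` and `1≤G` both argue this way.
      G-lipschitz : ∀ {s t} → s ≤ t → G t ≤ G s + (t - s) * K
      G-lipschitz {s} {t} s≤t = begin
        G t                                                    ≤⟨ ∑∈-mono S term ⟩
        ∑∈ S (λ i → absorbed s i + (t - s) * b i ⁻¹)           ≈⟨ ∑∈-+ S (absorbed s) (λ i → (t - s) * b i ⁻¹) ⟩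
        G s + ∑∈ S (λ i → (t - s) * b i ⁻¹)                    ≈⟨ +-congˡ (∑∈-*ˡ S (t - s) (λ i → b i ⁻¹)) ⟨
        G s + (t - s) * K                                      ∎
        where
        term : ∀ i → i ∈ S → absorbed t i ≤ absorbed s i + (t - s) * b i ⁻¹
        term i i∈S = ≤-cong refl (+-congˡ (solve 4 (λ s t a j → (t :- a) :* j :- (s :- a) :* j := (t :- s) :* j) s t (a i) (b i ⁻¹)))
          (⁺-nonexpansive (*-monoʳ-≤ (b⁻¹≥0 i i∈S) (+-monoˡ-≤ (- a i) s≤t)))

      latency≈ : ∀ s i → i ∈ S → a i + b i * ((s - a i) * b i ⁻¹) ≈ s
      latency≈ s i i∈S = ≈-mod (bb⁻¹≈1 i i∈S)
        (solve 4 (λ s a b j → a :+ b :* ((s :- a) :* j) := s :+ (s :- a) :* (b :* j :- :1)) s (a i) (b i) (b i ⁻¹))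

      P : ℝ → Set
      P s = G s ≤ 1#

      0∈P : P 0#
      0∈P = ≤-cong (sym (∑∈-zero S (λ i i∈S → x≤0⇒x⁺≈0
        (≤-cong refl (zeroˡ _) (*-monoʳ-≤ (b⁻¹≥0 i i∈S) (≤-by (a≥0 i) (solve 1 (λ a → :0 :- (:0 :- a) := a) (a i)))))))) refl 0≤1

      bounded : IsUpperBound P (a i₀ + b i₀)
      bounded s Gs≤1 = begin
        s                                            ≈⟨ latency≈ s i₀ i₀∈S ⟨
        a i₀ + b i₀ * ((s - a i₀) * b i₀ ⁻¹)         ≤⟨ +-mono-≤ ≤-refl (*-monoˡ-≤ (≰⇒≥ (b≰0 i₀ i₀∈S)) (≤-trans (≤-trans (x≤x⁺ _) (term≤∑∈ S (λ i → x⁺≥0 _) i₀∈S)) Gs≤1)) ⟩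
        a i₀ + b i₀ * 1#                             ≈⟨ +-congˡ (*-identityʳ (b i₀)) ⟩
        a i₀ + b i₀                                  ∎

      sup = supremum P (0# , 0∈P) (a i₀ + b i₀ , bounded)
      level = proj₁ sup

      G≤1 : G level ≤ 1#
      G≤1 = ≤-stable λ G≰1 →
        let
          η = G level - 1#
          upper : IsUpperBound P (level - η * K ⁻¹)
          upper s Gs≤1 = *-cancelʳ-≤ K≰0 (≤-by
            (+-nonNegative (x≤y⇒0≤y-x (G-lipschitz (proj₁ (proj₂ sup) s Gs≤1))) (x≤y⇒0≤y-x Gs≤1))
            (≈-mod (sym KK⁻¹≈1) (solve 6 (λ l s Gl Gs K j → (l :- (Gl :- :1) :* j) :* K :- s :* K
                := (Gs :+ (l :- s) :* K :- Gl) :+ (:1 :- Gs) :+ (Gl :- :1) :* (:1 :- K :* j)) level s (G level) (G s) K (K ⁻¹))))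
        in x-y≰x (*-positive (≰-shift G≰1) (⁻¹-positive K≰0)) (proj₂ (proj₂ sup) _ upper)

      1≤G : 1# ≤ G level
      1≤G = ≤-stable λ 1≰G →
        let
          η = 1# - G level
          0≤ηK⁻¹ = *-nonNegative (≰⇒≥ (≰-shift 1≰G)) (⁻¹-nonNegative K≰0)
          member : P (level + η * K ⁻¹)
          member = ≤-cong refl (≈-mod KK⁻¹≈1 (solve 4 (λ l Gl K j → Gl :+ (l :+ (:1 :- Gl) :* j :- l) :* K := :1 :+ (:1 :- Gl) :* (K :* j :- :1)) level (G level) K (K ⁻¹)))
            (G-lipschitz (x≤x+y 0≤ηK⁻¹))
        in x+y≰x (*-positive (≰-shift 1≰G) (⁻¹-positive K≰0)) (proj₁ (proj₂ sup) _ member)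

      -- A machine either absorbs nothing or has latency exactly `s`.
      total-latency : ∀ s i → i ∈ S → absorbed s i * (a i + b i * absorbed s i) ≈ s * absorbed s i
      total-latency s i i∈S with x⁺≈0∨x⁺≈x ((s - a i) * b i ⁻¹)
      ... | inj₁ x≈0 = trans (*-congʳ x≈0) (trans (zeroˡ _) (sym (trans (*-congˡ x≈0) (zeroʳ s))))
      ... | inj₂ x≈t = trans (*-comm _ _) (*-congʳ (trans (+-congˡ (*-congˡ x≈t)) (latency≈ s i i∈S)))

      level≤latency : ∀ s i → i ∈ S → s ≤ a i + b i * absorbed s i
      level≤latency s i i∈S = ≤-trans (≤-reflexive (sym (latency≈ s i i∈S)))
        (+-mono-≤ ≤-refl (*-monoˡ-≤ (≰⇒≥ (b≰0 i i∈S)) (x≤x⁺ _)))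

      module _ (s : ℝ) (G≈1 : G s ≈ 1#) where
        flow : Fin m → ℝ
        flow i = when ⌊ any? (i ≟ᶠ_) S ⌋ (absorbed s i)

        flow≈ : ∀ i → i ∈ S → flow i ≈ absorbed s i
        flow≈ i i∈S = reflexive (when-true (any? (i ≟ᶠ_) S) i∈S)

        equilibriumAt : Equilibrium S a b
        equilibriumAt = record
          { flow         = flow
          ; flow≥0       = λ i → when-nonNegative ⌊ any? (i ≟ᶠ_) S ⌋ (x⁺≥0 _)
          ; flow-total   = trans (∑∈-cong S flow≈) G≈1
          ; flow-outside = λ i i∉S → reflexive (when-false (any? (i ≟ᶠ_) S) i∉S)
          ; average≤latency = λ i i∈S → begin
              ∑∈ S (λ e → flow e * (a e + b e * flow e))
                ≈⟨ ∑∈-cong S (λ e e∈S → *-cong (flow≈ e e∈S) (+-congˡ (*-congˡ (flow≈ e e∈S)))) ⟩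
              ∑∈ S (λ e → absorbed s e * (a e + b e * absorbed s e))
                ≈⟨ ∑∈-cong S (total-latency s) ⟩
              ∑∈ S (λ e → s * absorbed s e)       ≈⟨ ∑∈-*ˡ S s (absorbed s) ⟨
              s * G s                             ≈⟨ trans (*-congˡ G≈1) (*-identityʳ s) ⟩
              s                                   ≤⟨ level≤latency s i i∈S ⟩
              a i + b i * absorbed s i            ≈⟨ +-congˡ (*-congˡ (flow≈ i i∈S)) ⟨
              a i + b i * flow i                      ∎
          }

      equilibrium : Equilibrium S a b
      equilibrium = equilibriumAt level (antisym G≤1 1≤G)

  -- A machine of constant latency 0 takes the whole flow.
  abstract
    equilibrium : ∀ {m} (S : List (Fin m)) → S ≢ [] → Unique S → (a b : Fin m → ℝ) →
      (∀ i → 0# ≤ a i) → (∀ i → 0# ≤ b i) → (∀ i → b i ≈ 0# → a i ≈ 0#) → Equilibrium S a b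
    equilibrium     []           S≢[] _  a b a≥0 b≥0 b≈0⇒a≈0 = contradiction ≡.refl S≢[]
    equilibrium {m} S@(i₀ ∷ _)   _    S! a b a≥0 b≥0 b≈0⇒a≈0 with any? (λ i → b i ≤? 0#) S
    ... | no ¬any = WaterFilling.equilibrium S (here ≡.refl) a b a≥0 (λ i i∈S bi≤0 → ¬any (lose i∈S bi≤0))
    ... | yes any with find any
    ...   | i , i∈S , bi≤0 = record
      { flow         = x
      ; flow≥0       = λ k → when-nonNegative ⌊ i ≟ᶠ k ⌋ 0≤1
      ; flow-total   = trans (∑∈-single x S! i∈S x≈0) x≈1
      ; flow-outside = λ k k∉S → reflexive (when-false (i ≟ᶠ k) (λ { ≡.refl → k∉S i∈S }))
      ; average≤latency = λ k k∈S → begin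
          ∑∈ S (λ e → x e * (a e + b e * x e))    ≈⟨ ∑∈-single (λ e → x e * (a e + b e * x e)) S! i∈S (λ e e≢i → trans (*-congʳ (x≈0 e e≢i)) (zeroˡ _)) ⟩
          x i * (a i + b i * x i)                 ≈⟨ *-congˡ (trans (+-cong (b≈0⇒a≈0 i bi≈0) (trans (*-congʳ bi≈0) (zeroˡ _))) (+-identityˡ 0#)) ⟩
          x i * 0#                                ≈⟨ zeroʳ (x i) ⟩
          0#                                      ≤⟨ +-nonNegative (a≥0 k) (*-nonNegative (b≥0 k) (when-nonNegative ⌊ i ≟ᶠ k ⌋ 0≤1)) ⟩
          a k + b k * x k                         ∎
      }
      where
      bi≈0 : b i ≈ 0#
      bi≈0 = antisym bi≤0 (b≥0 i)

      x : Fin m → ℝ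
      x k = when ⌊ i ≟ᶠ k ⌋ 1#

      x≈0 : ∀ k → k ≢ i → x k ≈ 0#
      x≈0 k k≢i = reflexive (when-false (i ≟ᶠ k) (λ i≡k → k≢i (≡.sym i≡k)))

      x≈1 : x i ≈ 1#
      x≈1 = reflexive (when-true (i ≟ᶠ i) ≡.refl)

-- Fractional assignments and the balancing algorithm

module FractionalAlgorithms (R : CompleteOrderedField) where
  open Equilibria R public

  private
    variable
      m n : ℕ

  module FractionalAssignment (I : Instance standard m) (x : Assignment standard I)
    (choice : ∀ j → FractionalChoice standard (lookup I j) (λ i → x i j)) where

    w : Fin (length I) → Fin m → ℝ
    w j = weight (lookup I j)

    before : Fin (length I) → Fin m → ℝ
    before j = loadUpTo standard I x (toℕ j)

    w≥0 : ∀ j e → 0# ≤ w j e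
    w≥0 j = weight≥0 (lookup I j)

    x≥0 : ∀ j e → 0# ≤ x e j
    x≥0 j = FractionalChoice.x≥0 (choice j)

    contribution≥0 : ∀ j e → 0# ≤ contribution standard-lawful I x j e
    contribution≥0 j e = *-nonNegative (w≥0 j e) (x≥0 j e)

    before≥0 : ∀ j e → 0# ≤ before j e
    before≥0 j e = sum-nonNegative (λ k → when-nonNegative (toℕ k <ᵇ toℕ j) (contribution≥0 k e))

    afterwards≤load : ∀ j e → before j e + w j e * x e j ≤ load standard I x e
    afterwards≤load j e = ≤-trans (≤-reflexive (sym (loadAfter standard-lawful I x j e)))
      (loadUpTo≤load standard-lawful I x contribution≥0 (suc (toℕ j)) e)

    sum-feasible : ∀ j (f : Fin m → ℝ) → sum (λ e → x e j * f e) ≈ ∑∈ (feasible (lookup I j)) (λ e → x e j * f e)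
    sum-feasible j f = sum≈∑∈ _ (unique (lookup I j))
      (λ e e∉S → trans (*-congʳ (FractionalChoice.infeasible (choice j) e e∉S)) (zeroˡ (f e)))

    row-total : ∀ j → sum (λ e → x e j) ≈ 1#
    row-total j = trans (sum≈∑∈ _ (unique (lookup I j)) (FractionalChoice.infeasible (choice j))) (FractionalChoice.total (choice j))

    costIncrease : Fin (length I) → ℝ
    costIncrease j = costUpTo standard-lawful I x (suc (toℕ j)) - costUpTo standard-lawful I x (toℕ j)

    -- From `(ℓ + w x)² - ℓ² = x w (2ℓ + x w)`: the average latency in the rule of FracBalance is
    -- exactly the growth of the cost, which explains its `f`.
    costIncrease≈ : ∀ j → costIncrease j ≈ sum (λ e → x e j * (w j e * (fromℕ 2 * before j e + x e j * w j e)))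
    costIncrease≈ j = begin-equality
      costIncrease j
        ≈⟨ +-congʳ (⟨⟩-cong (loadAfter standard-lawful I x j) (loadAfter standard-lawful I x j)) ⟩
      ‖ (λ e → before j e + w j e * x e j) ‖² - ‖ before j ‖²
        ≈⟨ sum-- (λ e → (before j e + w j e * x e j) ²) (λ e → before j e ²) ⟨
      sum (λ e → (before j e + w j e * x e j) ² - before j e ²)
        ≈⟨ sum-cong (λ e → solve 3 (λ l w x → (l :+ w :* x) :* (l :+ w :* x) :- l :* l := x :* (w :* (♯ 2 :* l :+ x :* w))) (before j e) (w j e) (x e j)) ⟩
      sum (λ e → x e j * (w j e * (fromℕ 2 * before j e + x e j * w j e))) ∎

    ‖on‖²≈ : ∀ j i → ‖ on standard i (w j) ‖² ≈ w j i ²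
    ‖on‖²≈ j i = sym (Lawful.diagonal≈ standard-lawful (w j) i)

    ⟨load,on⟩≈ : ∀ j i → ⟨ load standard I x , on standard i (w j) ⟩ ≈ w j i * load standard I x i
    ⟨load,on⟩≈ j i = trans (⟨⟩-comm (load standard I x) (on standard i (w j))) (sum-δ-* i (w j) (load standard I x))

  -- fracBalance and balance both equalise latencies of the form
  -- f(t) = p w² + q w ℓ + g w² t.
  module Balancing {p q g : ℝ} (0≤p : 0# ≤ p) (0≤q : 0# ≤ q) (g≰0 : g ≰ 0#) where

    latency : ℝ → ℝ → ℝ → ℝ
    latency ℓ w t = p * w ² + q * w * ℓ + g * w ² * t

    module _ (s : Fin m → ℝ) (J : Job standard m) where
      private
        w = weight J

        w²≥0 : ∀ e → 0# ≤ w e ²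
        w²≥0 e = x²≥0 (w e)

        constant≈0 : ∀ e → g * w e ² ≈ 0# → p * w e ² + q * w e * s e ⁺ ≈ 0#
        constant≈0 e gw²≈0 = trans (+-cong (trans (*-congˡ (trans (*-congʳ w≈0) (zeroˡ _))) (zeroʳ p))
                                           (trans (*-congʳ (trans (*-congˡ w≈0) (zeroʳ q))) (zeroˡ _))) (+-identityˡ 0#)
          where
          w≈0 : w e ≈ 0#
          w≈0 = x²≈0⇒x≈0 (*-cancelʳ (≰0⇒≉0 g≰0) (trans (*-comm _ _) (trans gw²≈0 (sym (zeroˡ g)))))

      abstract
        -- `choose` has to be defined for arbitrary `s`, while `equilibrium` asks for nonnegative
        -- latencies, hence the positive part. It changes nothing at the loads that actually occur,
        -- see `state⁺≈`.
        jobEquilibrium : Equilibrium (feasible J) (λ e → p * w e ² + q * w e * s e ⁺) (λ e → g * w e ²)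
        jobEquilibrium = equilibrium (feasible J) (nonempty J) (unique J) _ _
          (λ e → +-nonNegative (*-nonNegative 0≤p (w²≥0 e)) (*-nonNegative (*-nonNegative 0≤q (weight≥0 J e)) (x⁺≥0 (s e))))
          (λ e → *-nonNegative (≰⇒≥ g≰0) (w²≥0 e))
          constant≈0

    choose : LoadBased standard
    choose s J = Equilibrium.flow (jobEquilibrium s J)

    algorithm : Algorithm standard
    algorithm = loadBased standard choose

    algorithm-fractional : Fractional standard algorithm
    algorithm-fractional {m} past J = record
      { x≥0        = flow≥0
      ; x≤1        = ≤1
      ; total      = flow-total
      ; infeasible = flow-outside
      }
      where
      open Equilibrium (jobEquilibrium (foldl (step standard choose) (λ _ → 0#) past) J)

      ≤1 : ∀ i → flow i ≤ 1#
      ≤1 i = [ (λ i∈S → ≤-cong refl flow-total (term≤∑∈ (feasible J) flow≥0 i∈S))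
             , (λ i∉S → ≤-cong (sym (flow-outside i i∉S)) refl 0≤1)
             ]′ (toSum (any? (i ≟ᶠ_) (feasible J)))

    algorithm-balanced : ∀ (I : Instance standard m) j i → i ∈ feasible (lookup I j) →
      let x = run standard algorithm I
          f = λ e → latency (loadUpTo standard I x (toℕ j) e) (weight (lookup I j) e) (x e j)
      in ∑∈ (feasible (lookup I j)) (λ e → x e j * f e) ≤ f i
    algorithm-balanced {m} I j i i∈S = ≤-cong
      (∑∈-cong (feasible (lookup I j)) (λ e _ → *-congˡ (latency≈ e))) (latency≈ i)
      (Equilibrium.average≤latency (jobEquilibrium state (lookup I j)) i i∈S)
      where
      open FractionalAssignment I (run standard algorithm I) (λ j → algorithm-fractional (take (toℕ j) I) (lookup I j))
      state : Fin m → ℝ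
      state = foldl (step standard choose) (λ _ → 0#) (take (toℕ j) I)

      state⁺≈ : ∀ e → state e ⁺ ≈ before j e
      state⁺≈ e = trans (0≤x⇒x⁺≈x (≤-cong refl (sym state≈) (before≥0 j e))) state≈
        where
        state≈ = loadBased-state standard choose I j e

      latency≈ : ∀ e → p * w j e ² + q * w j e * state e ⁺ + g * w j e ² * run standard algorithm I e j
                       ≈ latency (before j e) (w j e) (run standard algorithm I e j)
      latency≈ e = +-congʳ (+-congˡ (*-congˡ (state⁺≈ e)))


-- The analysis of FracBalance

module FracBalanceAnalysis (R : CompleteOrderedField) where
  open FractionalAlgorithms R public

  private
    variable
      m : ℕ

  module FracBalance {r : ℝ} (0≤r : 0# ≤ r) (r²≈2 : r * r ≈ fromℕ 2) where
    open Balancing {0#} {fromℕ 2} {1#} ≤-refl (fromℕ≥0 2) 1≰0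

    algorithm-follows : Follows standard fracBalance algorithm
    algorithm-follows I j i i∈S = ≤-cong
      (∑∈-cong (feasible (lookup I j)) (λ e _ → *-congˡ (rearrange _ _ _))) (rearrange _ _ _)
      (algorithm-balanced I j i i∈S)
      where
      rearrange : ∀ ℓ w t → latency ℓ w t ≈ w * (fromℕ 2 * ℓ + t * w)
      rearrange = solve 3 (λ l w t → :0 :* (w :* w) :+ ♯ 2 :* w :* l :+ :1 :* (w :* w) :* t := w :* (♯ 2 :* l :+ t :* w))

    -- `α = r` is the largest value allowed and removes the term `‖ a ‖²`. If `y` is `t` times the
    -- growth of the cost, the bound asks for `β * α = 2t`, and the objective is `t - t²` times the
    -- cost, with maximum `1/4` at `t = 1/2`.
    fit : ∀ {m} (I : Instance standard m) → Assignment standard I → DualSolution standard I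
    fit I x = proportional standard-lawful r (½ * r) I x
      (λ j → ½ * (costUpTo standard-lawful I x (suc (toℕ j)) - costUpTo standard-lawful I x (toℕ j)))

    module _ (I : Instance standard m) (x : Assignment standard I)
      (choice : ∀ j → FractionalChoice standard (lookup I j) (λ i → x i j)) where
      open FractionalAssignment I x choice

      fit-feasible : (∀ j → fracBalance I x j) → DualFeasible standard I (fit I x)
      fit-feasible follows = proportional-feasible standard-lawful I x (≤-reflexive r²≈2) y≤
        where
        L = load standard I x

        y≤ : ∀ j i → i ∈ feasible (lookup I j) → let a = on standard i (w j) in
          ½ * costIncrease j ≤ (1# - ½ * r ²) * ‖ a ‖² + ½ * r * r * ⟨ L , a ⟩
        y≤ j i i∈S = begin
          ½ * costIncrease j
            ≈⟨ *-congˡ (trans (costIncrease≈ j) (sum-feasible j _)) ⟩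
          ½ * ∑∈ (feasible (lookup I j)) (λ e → x e j * (w j e * (fromℕ 2 * before j e + x e j * w j e)))
            ≤⟨ *-monoˡ-≤ (recip≥0 1) (follows j i i∈S) ⟩
          ½ * (w j i * (fromℕ 2 * before j i + x i j * w j i))
            ≤⟨ ≤-by (*-nonNegative (recip≥0 1) (*-nonNegative (*-nonNegative (w≥0 j i) (w≥0 j i)) (x≥0 j i)))
                 (solve 3 (λ w l x → w :* (l :+ w :* x) :- :½ :* (w :* (♯ 2 :* l :+ x :* w)) := :½ :* (w :* w :* x)) (w j i) (before j i) (x i j)) ⟩
          w j i * (before j i + w j i * x i j)
            ≤⟨ *-monoˡ-≤ (w≥0 j i) (afterwards≤load j i) ⟩
          w j i * L i
            ≈⟨ ≈-mod (sym r²≈2) (solve 3 (λ w² wL r → wL := (:1 :- :½ :* (r :* r)) :* w² :+ :½ :* r :* r :* wL :+ :½ :* (wL :- w²) :* (♯ 2 :- r :* r)) (w j i ²) (w j i * L i) r) ⟩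
          (1# - ½ * r ²) * w j i ² + ½ * r * r * (w j i * L i)
            ≈⟨ +-cong (*-congˡ (‖on‖²≈ j i)) (*-congˡ (⟨load,on⟩≈ j i)) ⟨
          (1# - ½ * r ²) * ‖ on standard i (w j) ‖² + ½ * r * r * ⟨ L , on standard i (w j) ⟩ ∎

      fit-objective : fromℕ 4 ⁻¹ * cost standard I x ≈ objective standard I (fit I x)
      fit-objective = begin-equality
        fromℕ 4 ⁻¹ * C
          ≈⟨ ≈-mod r²≈2 (solve 2 (λ r C → con (recip 3) :* C := :½ :* C :- :½ :* (:½ :* r :* (:½ :* r) :* C) :+ (con (recip 7) :* C) :* (r :* r :- ♯ 2)) r C) ⟩
        ½ * C - ½ * ((½ * r) ² * C)                              ≈⟨ +-congʳ (*-congˡ (cost-telescope standard-lawful I x)) ⟨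
        ½ * sum costIncrease - ½ * ((½ * r) ² * C)               ≈⟨ +-congʳ (sum-*ˡ ½ costIncrease) ⟩
        sum (λ j → ½ * costIncrease j) - ½ * ((½ * r) ² * C)     ≈⟨ proportional-objective standard-lawful {α = r} I x ⟨
        objective standard I (fit I x)                           ∎
        where
        C = cost standard I x

    dualFitting : DualFitting standard (Fractional standard) fracBalance (cost standard) (fromℕ 4)
    dualFitting = fit , λ A fractional follows I →
      let choice = λ j → fractional (take (toℕ j) I) (lookup I j) in
      fit-feasible I (run standard A I) choice (follows I) , ≤-reflexive (fit-objective I (run standard A I) choice)

    analysis : AnalyzedByDualFitting standard (Fractional standard) fracBalance (cost standard) (fromℕ 4)
    analysis = (algorithm , algorithm-fractional , algorithm-follows) , dualFitting ,
      competitive standard-lawful {rule = fracBalance} {costOf = cost standard} (fromℕ-suc≰0 3) dualFitting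


-- First and second moments of random loads

module Expectations (R : CompleteOrderedField) where
  open Sums R public
  open LB using (expectation)

  private
    variable
      m n : ℕ

  Stochastic : (Fin n → Fin m → ℝ) → Set
  Stochastic p = ∀ j → sum (p j) ≈ 1#

  expectation-cong : ∀ n {p : Fin n → Fin m → ℝ} {g h} → (∀ σ → g σ ≈ h σ) → expectation n p g ≈ expectation n p h
  expectation-cong zero    g≈h = g≈h Vector.[]
  expectation-cong (suc n) g≈h = sum-cong (λ i → *-congˡ (expectation-cong n (λ σ → g≈h (i Vector.∷ σ))))

  expectation-+ : ∀ n (p : Fin n → Fin m → ℝ) g h →
    expectation n p (λ σ → g σ + h σ) ≈ expectation n p g + expectation n p h
  expectation-+ zero    p g h = refl
  expectation-+ (suc n) p g h = trans
    (sum-cong (λ i → trans (*-congˡ (expectation-+ n _ _ _)) (distribˡ (p fzero i) _ _))) (sum-+ (λ i → p fzero i * expectation n (λ j → p (fsuc j)) (λ σ → g (i Vector.∷ σ))) _)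

  expectation-const : ∀ n {p : Fin n → Fin m → ℝ} → Stochastic p → ∀ c → expectation n p (λ _ → c) ≈ c
  expectation-const zero        rows c = refl
  expectation-const {m} (suc n) {p} rows c = begin-equality
    sum (λ i → p fzero i * expectation n (λ j → p (fsuc j)) (λ _ → c)) ≈⟨ sum-cong {m} (λ i → trans (*-congˡ (expectation-const n {λ j → p (fsuc j)} (λ j → rows (fsuc j)) c)) (*-comm _ c)) ⟩
    sum (λ i → c * p fzero i)                                          ≈⟨ sum-*ˡ c (p fzero) ⟨
    c * sum (p fzero)                                                  ≈⟨ trans (*-congˡ (rows fzero)) (*-identityʳ c) ⟩
    c                                                                  ∎

  expectation-* : ∀ n (p : Fin n → Fin m → ℝ) c g → expectation n p (λ σ → c * g σ) ≈ c * expectation n p g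
  expectation-* zero    p c g = refl
  expectation-* (suc n) p c g = trans
    (sum-cong (λ i → trans (*-congˡ (expectation-* n _ c _)) (solve 3 (λ p c e → p :* (c :* e) := c :* (p :* e)) (p fzero i) c _)))
    (sym (sum-*ˡ c (λ i → p fzero i * expectation n (λ j → p (fsuc j)) (λ σ → g (i Vector.∷ σ)))))

  expectation-sum : ∀ {k} n {p : Fin n → Fin m → ℝ} → Stochastic p → (g : Fin k → (Fin n → Fin m) → ℝ) →
    expectation n p (λ σ → sum (λ e → g e σ)) ≈ sum (λ e → expectation n p (g e))
  expectation-sum {k = zero}  n     rows g = expectation-const n rows 0#
  expectation-sum {k = suc k} n {p} rows g = trans (expectation-+ n p (g fzero) _)
    (+-congˡ (expectation-sum n rows (λ e → g (fsuc e))))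

  -- Conditioned on the machine of the first job, both moments of the load of `e` are affine in the
  -- indicator that this machine is `e`; averaging replaces the indicator by its probability.
  first-choice : ∀ {p : Fin (suc n) → Fin m → ℝ} → Stochastic p → ∀ e c d →
    sum (λ i → p fzero i * (when ⌊ i ≟ᶠ e ⌋ 1# * c + d)) ≈ p fzero e * c + d
  first-choice {p = p} rows e c d = begin-equality
    sum (λ i → p₀ i * (δ i * c + d))                        ≈⟨ sum-cong (λ i → solve 4 (λ p δ c d → p :* (δ :* c :+ d) := c :* (p :* δ) :+ d :* p) (p₀ i) (δ i) c d) ⟩
    sum (λ i → c * (p₀ i * δ i) + d * p₀ i)                 ≈⟨ sum-+ (λ i → c * (p₀ i * δ i)) (λ i → d * p₀ i) ⟩
    sum (λ i → c * (p₀ i * δ i)) + sum (λ i → d * p₀ i)     ≈⟨ +-cong (sum-*ˡ c (λ i → p₀ i * δ i)) (sum-*ˡ d p₀) ⟨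
    c * sum (λ i → p₀ i * δ i) + d * sum p₀                 ≈⟨ +-cong (*-congˡ (sum-1δ p₀ e)) (*-congˡ (rows fzero)) ⟩
    c * p₀ e + d * 1#                                       ≈⟨ +-cong (*-comm c (p₀ e)) (*-identityʳ d) ⟩
    p₀ e * c + d                                            ∎
    where
    p₀ = p fzero
    δ : Fin _ → ℝ
    δ i = when ⌊ i ≟ᶠ e ⌋ 1#

  -- The load of e if job k has weight b k on e and goes to machine σ k.
  loadOn : Fin m → (Fin n → ℝ) → (Fin n → Fin m) → ℝ
  loadOn e b σ = sum (λ k → b k * when ⌊ σ k ≟ᶠ e ⌋ 1#)

  expectedLoad : ∀ n {p : Fin n → Fin m → ℝ} → Stochastic p → ∀ e b →
    expectation n p (loadOn e b) ≈ sum (λ k → b k * p k e)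
  expectedLoad zero        rows e b = refl
  expectedLoad (suc n) {p} rows e b = begin-equality
    sum (λ i → p fzero i * expectation n p′ (λ σ → b fzero * δ i + loadOn e b′ σ))
      ≈⟨ sum-cong (λ i → *-congˡ (trans (expectation-+ n p′ (λ _ → b fzero * δ i) (loadOn e b′))
           (+-cong (trans (expectation-const n rows′ _) (*-comm _ _)) (expectedLoad n rows′ e b′)))) ⟩
    sum (λ i → p fzero i * (δ i * b fzero + sum (λ k → b′ k * p′ k e)))
      ≈⟨ first-choice rows e (b fzero) (sum (λ k → b′ k * p′ k e)) ⟩
    p fzero e * b fzero + sum (λ k → b′ k * p′ k e)
      ≈⟨ +-congʳ (*-comm _ _) ⟩
    b fzero * p fzero e + sum (λ k → b′ k * p′ k e) ∎
    where
    δ : Fin _ → ℝ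
    δ i = when ⌊ i ≟ᶠ e ⌋ 1#
    b′ = λ k → b (fsuc k)
    p′ = λ k → p (fsuc k)
    rows′ = λ k → rows (fsuc k)

  -- Variances of independent jobs add up, and putting `b k` on `e` with probability `p k e` has
  -- variance `p k e * b k ²` minus the square of the mean.
  expectedSquare : ∀ n {p : Fin n → Fin m → ℝ} → Stochastic p → ∀ e b →
    expectation n p (λ σ → loadOn e b σ ²) ≈
    sum (λ k → b k * p k e) ² + sum (λ k → p k e * b k ² - (b k * p k e) ²)
  expectedSquare zero        rows e b = solve 0 (:0 :* :0 := :0 :* :0 :+ :0)
  expectedSquare (suc n) {p} rows e b = begin-equality
    sum (λ i → p fzero i * expectation n p′ (λ σ → (b₀ * δ i + loadOn e b′ σ) ²))
      ≈⟨ sum-cong (λ i → *-congˡ (conditional i)) ⟩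
    sum (λ i → p fzero i * (δ i * (b₀ ² + fromℕ 2 * b₀ * μ) + (μ ² + V)))
      ≈⟨ first-choice rows e (b₀ ² + fromℕ 2 * b₀ * μ) (μ ² + V) ⟩
    p fzero e * (b₀ ² + fromℕ 2 * b₀ * μ) + (μ ² + V)
      ≈⟨ solve 4 (λ p b u V → p :* (b :* b :+ ♯ 2 :* b :* u) :+ (u :* u :+ V)
           := (b :* p :+ u) :* (b :* p :+ u) :+ ((p :* (b :* b) :- b :* p :* (b :* p)) :+ V)) (p fzero e) b₀ μ V ⟩
    (b₀ * p fzero e + μ) ² + ((p fzero e * b₀ ² - (b₀ * p fzero e) ²) + V) ∎
    where
    δ : Fin _ → ℝ
    δ i = when ⌊ i ≟ᶠ e ⌋ 1#
    b₀ = b fzero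
    b′ = λ k → b (fsuc k)
    p′ = λ k → p (fsuc k)
    rows′ = λ k → rows (fsuc k)
    μ = sum (λ k → b′ k * p′ k e)
    V = sum (λ k → p′ k e * b′ k ² - (b′ k * p′ k e) ²)

    δ²≈δ : ∀ b → when b 1# * when b 1# ≈ when b 1#
    δ²≈δ true  = *-identityˡ 1#
    δ²≈δ false = zeroˡ 0#

    conditional : ∀ i → expectation n p′ (λ σ → (b₀ * δ i + loadOn e b′ σ) ²) ≈ δ i * (b₀ ² + fromℕ 2 * b₀ * μ) + (μ ² + V)
    conditional i = begin-equality
      expectation n p′ (λ σ → (b₀ * δ i + loadOn e b′ σ) ²)
        ≈⟨ expectation-cong n (λ σ → ≈-mod (δ²≈δ ⌊ i ≟ᶠ e ⌋) (solve 3 (λ b δ l →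
             (b :* δ :+ l) :* (b :* δ :+ l) := δ :* (b :* b) :+ (δ :* (♯ 2 :* b) :* l :+ l :* l) :+ b :* b :* (δ :* δ :- δ)) b₀ (δ i) (loadOn e b′ σ))) ⟩
      expectation n p′ (λ σ → δ i * b₀ ² + (δ i * (fromℕ 2 * b₀) * loadOn e b′ σ + loadOn e b′ σ ²))
        ≈⟨ expectation-+ n p′ (λ _ → δ i * b₀ ²) _ ⟩
      expectation n p′ (λ _ → δ i * b₀ ²) + expectation n p′ (λ σ → δ i * (fromℕ 2 * b₀) * loadOn e b′ σ + loadOn e b′ σ ²)
        ≈⟨ +-cong (expectation-const n rows′ _) (trans (expectation-+ n p′ (λ σ → δ i * (fromℕ 2 * b₀) * loadOn e b′ σ) _)
             (+-cong (trans (expectation-* n p′ (δ i * (fromℕ 2 * b₀)) (loadOn e b′)) (*-congˡ (expectedLoad n rows′ e b′))) (expectedSquare n rows′ e b′))) ⟩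
      δ i * b₀ ² + (δ i * (fromℕ 2 * b₀) * μ + (μ ² + V))
        ≈⟨ solve 4 (λ δ b u v → δ :* (b :* b) :+ (δ :* (♯ 2 :* b) :* u :+ v) := δ :* (b :* b :+ ♯ 2 :* b :* u) :+ v) (δ i) b₀ μ (μ ² + V) ⟩
      δ i * (b₀ ² + fromℕ 2 * b₀ * μ) + (μ ² + V) ∎

-- The analysis of Balance

module BalanceAnalysis (R : CompleteOrderedField) where
  open FractionalAlgorithms R public
  open Expectations R using (Stochastic; expectation-cong; expectation-sum; loadOn; expectedLoad; expectedSquare)
  open LB using (expectation; 𝔼)

  private
    variable
      m : ℕ

  module RandomAssignment (I : Instance standard m) (x : Assignment standard I)
    (choice : ∀ j → FractionalChoice standard (lookup I j) (λ i → x i j)) where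
    open FractionalAssignment I x choice public

    n : ℕ
    n = length I

    p : Fin n → Fin m → ℝ
    p j i = x i j

    outcome : (Fin n → Fin m) → Assignment standard I
    outcome σ i j = when ⌊ σ j ≟ᶠ i ⌋ 1#

    -- By linearity of expectation the rule of Balance involves only the loads of the fractional
    -- `x`, so the same water-filling serves both algorithms.
    𝔼-loadUpTo : ∀ t e → 𝔼 I x (λ X → loadUpTo standard I X t e) ≈ loadUpTo standard I x t e
    𝔼-loadUpTo t e = begin-equality
      expectation n p (λ σ → loadUpTo standard I (outcome σ) t e)
        ≈⟨ expectation-cong n {p} (λ σ → sum-cong (λ k → sym (when-* (toℕ k <ᵇ t) (w k e)))) ⟩
      expectation n p (loadOn e (λ k → when (toℕ k <ᵇ t) (w k e)))
        ≈⟨ expectedLoad n {p} row-total e (λ k → when (toℕ k <ᵇ t) (w k e)) ⟩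
      sum (λ k → when (toℕ k <ᵇ t) (w k e) * x e k)
        ≈⟨ sum-cong (λ k → when-* (toℕ k <ᵇ t) (w k e)) ⟩
      loadUpTo standard I x t e ∎

    variance : Fin m → Fin n → ℝ
    variance e k = x e k * w k e ² - (w k e * x e k) ²

    expectedCost≈ : expectedCost I x ≈ cost standard I x + sum (λ e → sum (variance e))
    expectedCost≈ = begin-equality
      expectation n p (λ σ → sum (λ e → load standard I (outcome σ) e ²))
        ≈⟨ expectation-sum n {p} row-total (λ e σ → load standard I (outcome σ) e ²) ⟩
      sum (λ e → expectation n p (λ σ → load standard I (outcome σ) e ²))
        ≈⟨ sum-cong (λ e → trans
             (expectation-cong n {p} (λ σ → *-cong (all-loads (outcome σ) e) (all-loads (outcome σ) e)))
             (trans (expectedSquare n {p} row-total e (λ k → w k e)) (+-congʳ (sym (*-cong (all-loads x e) (all-loads x e)))))) ⟩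
      sum (λ e → load standard I x e ² + sum (variance e))
        ≈⟨ sum-+ (λ e → load standard I x e ²) (λ e → sum (variance e)) ⟩
      cost standard I x + sum (λ e → sum (variance e)) ∎
      where
      all-loads : ∀ X e → load standard I X e ≈ sum (λ k → w k e * X e k)
      all-loads X e = prefix-all (λ k → w k e * X e k)

  open Balancing {1#} {fromℕ 4} {fromℕ 4} 0≤1 (fromℕ≥0 4) (fromℕ-suc≰0 3)

  latency≈ : ∀ ℓ w t → latency ℓ w t ≈ w ² + fromℕ 4 * w * (ℓ + t * w)
  latency≈ = solve 3 (λ l w t → :1 :* (w :* w) :+ ♯ 4 :* w :* l :+ ♯ 4 :* (w :* w) :* t := w :* w :+ ♯ 4 :* w :* (l :+ t :* w))

  balanced-latency : ∀ (I : Instance standard m) x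
    (choice : ∀ j → FractionalChoice standard (lookup I j) (λ i → x i j)) j i →
    weight (lookup I j) i ² + fromℕ 4 * weight (lookup I j) i * (𝔼 I x (λ X → loadUpTo standard I X (toℕ j) i) + x i j * weight (lookup I j) i)
      ≈ latency (loadUpTo standard I x (toℕ j) i) (weight (lookup I j) i) (x i j)
  balanced-latency I x choice j i = trans (+-congˡ (*-congˡ (+-congʳ (𝔼-loadUpTo (toℕ j) i)))) (sym (latency≈ _ _ _))
    where open RandomAssignment I x choice

  algorithm-follows : Follows standard balance algorithm
  algorithm-follows I j i i∈S = ≤-cong
    (∑∈-cong (feasible (lookup I j)) (λ e _ → *-congˡ (sym (balanced-latency I _ choice j e)))) (sym (balanced-latency I _ choice j i))
    (algorithm-balanced I j i i∈S)
    where
    choice = λ k → algorithm-fractional (take (toℕ k) I) (lookup I k)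

  private
    8/5≥0 : 0# ≤ fromℕ 8 * fromℕ 5 ⁻¹
    8/5≥0 = *-nonNegative (fromℕ≥0 8) (recip≥0 4)

  -- Each `y j` is a fifth of the average latency, hence at most `(w ² + 4 w L) / 5`. Matching this
  -- with the dual bound term by term gives `1 - α ² / 2 = 1/5` and `β α = 4/5`, that is,
  -- `α ² = 8/5` and `β = α / 2`.
  α : ℝ
  α = proj₁ (squareRoot _ 8/5≥0)

  α²≈8/5 : α * α ≈ fromℕ 8 * fromℕ 5 ⁻¹
  α²≈8/5 = proj₂ (proj₂ (squareRoot _ 8/5≥0))

  α²≤2 : α ² ≤ fromℕ 2
  α²≤2 = ≤-by (*-nonNegative (fromℕ≥0 2) (recip≥0 4))
    (≈-mod (sym α²≈8/5) (solve 1 (λ a → ♯ 2 :- a :* a := ♯ 2 :* con (recip 4) :+ :1 :* (♯ 8 :* con (recip 4) :- a :* a)) α))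

  totalLatency : (I : Instance standard m) (x : Assignment standard I) → Fin (length I) → ℝ
  totalLatency I x j = sum λ e → x e j * latency (loadUpTo standard I x (toℕ j) e) (weight (lookup I j) e) (x e j)

  fit : ∀ {m} (I : Instance standard m) → Assignment standard I → DualSolution standard I
  fit I x = proportional standard-lawful α (½ * α) I x (λ j → fromℕ 5 ⁻¹ * totalLatency I x j)

  module _ (I : Instance standard m) (x : Assignment standard I)
    (choice : ∀ j → FractionalChoice standard (lookup I j) (λ i → x i j)) where
    open RandomAssignment I x choice

    fit-feasible : (∀ j → balance I x j) → DualFeasible standard I (fit I x)
    fit-feasible follows = proportional-feasible standard-lawful I x α²≤2 y≤
      where
      L = load standard I x

      y≤ : ∀ j i → i ∈ feasible (lookup I j) → let a = on standard i (w j) in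
        fromℕ 5 ⁻¹ * totalLatency I x j ≤ (1# - ½ * α ²) * ‖ a ‖² + ½ * α * α * ⟨ L , a ⟩
      y≤ j i i∈S = begin
        fromℕ 5 ⁻¹ * totalLatency I x j
          ≈⟨ *-congˡ (sum-feasible j _) ⟩
        fromℕ 5 ⁻¹ * ∑∈ (feasible (lookup I j)) (λ e → x e j * latency (before j e) (w j e) (x e j))
          ≤⟨ *-monoˡ-≤ (recip≥0 4) (≤-cong (∑∈-cong (feasible (lookup I j)) (λ e _ → *-congˡ (balanced-latency I x choice j e)))
               (balanced-latency I x choice j i) (follows j i i∈S)) ⟩
        fromℕ 5 ⁻¹ * latency (before j i) (w j i) (x i j)
          ≈⟨ solve 3 (λ l w t → con (recip 4) :* (:1 :* (w :* w) :+ ♯ 4 :* w :* l :+ ♯ 4 :* (w :* w) :* t)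
               := con (recip 4) :* (w :* w) :+ ♯ 4 :* con (recip 4) :* w :* (l :+ w :* t)) (before j i) (w j i) (x i j) ⟩
        fromℕ 5 ⁻¹ * w j i ² + fromℕ 4 * fromℕ 5 ⁻¹ * w j i * (before j i + w j i * x i j)
          ≤⟨ +-mono-≤ ≤-refl (*-monoˡ-≤ (*-nonNegative (*-nonNegative (fromℕ≥0 4) (recip≥0 4)) (w≥0 j i)) (afterwards≤load j i)) ⟩
        fromℕ 5 ⁻¹ * w j i ² + fromℕ 4 * fromℕ 5 ⁻¹ * w j i * L i
          ≈⟨ ≈-mod (sym α²≈8/5) (solve 4 (λ w² w L a → con (recip 4) :* w² :+ ♯ 4 :* con (recip 4) :* w :* L
               := (:1 :- :½ :* (a :* a)) :* w² :+ :½ :* a :* a :* (w :* L) :+ :½ :* (w :* L :- w²) :* (♯ 8 :* con (recip 4) :- a :* a)) (w j i ²) (w j i) (L i) α) ⟩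
        (1# - ½ * α ²) * w j i ² + ½ * α * α * (w j i * L i)
          ≈⟨ +-cong (*-congˡ (‖on‖²≈ j i)) (*-congˡ (⟨load,on⟩≈ j i)) ⟨
        (1# - ½ * α ²) * ‖ on standard i (w j) ‖² + ½ * α * α * ⟨ L , on standard i (w j) ⟩ ∎

    -- What the average latency contains beyond twice the growth of the fractional cost. It covers
    -- the variance, by which the expected cost exceeds the cost of `x`, with `3 (w x)²` to spare in
    -- each term.
    excess : Fin n → Fin m → ℝ
    excess j e = x e j * w j e ² + fromℕ 2 * (w j e * x e j) ²

    totalLatency≈ : ∀ j → totalLatency I x j ≈ fromℕ 2 * costIncrease j + sum (excess j)
    totalLatency≈ j = begin-equality
      totalLatency I x j
        ≈⟨ sum-cong (λ e → solve 3 (λ l w x → x :* (:1 :* (w :* w) :+ ♯ 4 :* w :* l :+ ♯ 4 :* (w :* w) :* x)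
             := ♯ 2 :* (x :* (w :* (♯ 2 :* l :+ x :* w))) :+ (x :* (w :* w) :+ ♯ 2 :* (w :* x :* (w :* x)))) (before j e) (w j e) (x e j)) ⟩
      sum (λ e → fromℕ 2 * increment e + excess j e)
        ≈⟨ sum-+ (λ e → fromℕ 2 * increment e) (excess j) ⟩
      sum (λ e → fromℕ 2 * increment e) + sum (excess j)
        ≈⟨ +-congʳ (trans (*-congˡ (costIncrease≈ j)) (sum-*ˡ (fromℕ 2) increment)) ⟨
      fromℕ 2 * costIncrease j + sum (excess j) ∎
      where
      increment : Fin m → ℝ
      increment e = x e j * (w j e * (fromℕ 2 * before j e + x e j * w j e))

    variance≤excess : sum (λ e → sum (variance e)) ≤ sum (λ j → sum (excess j))
    variance≤excess = begin
      sum (λ e → sum (variance e))           ≈⟨ ∑-comm variance ⟩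
      sum (λ j → sum (λ e → variance e j))
        ≤⟨ sum-mono (λ j → sum-mono (λ e → ≤-by (*-nonNegative (fromℕ≥0 3) (x²≥0 (w j e * x e j)))
             (solve 2 (λ a b → a :+ ♯ 2 :* b :- (a :- b) := ♯ 3 :* b) (x e j * w j e ²) ((w j e * x e j) ²)))) ⟩
      sum (λ j → sum (excess j))             ∎

    fit-objective : fromℕ 5 ⁻¹ * expectedCost I x ≤ objective standard I (fit I x)
    fit-objective = begin
      fromℕ 5 ⁻¹ * expectedCost I x
        ≈⟨ *-congˡ expectedCost≈ ⟩
      fromℕ 5 ⁻¹ * (C + sum (λ e → sum (variance e)))
        ≤⟨ *-monoˡ-≤ (recip≥0 4) (+-mono-≤ ≤-refl variance≤excess) ⟩
      fromℕ 5 ⁻¹ * (C + sum (λ j → sum (excess j)))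
        -- Of the `2/5` in front of `C`, the norm of `ν` uses up `β ² / 2 = 1/5`.
        ≈⟨ ≈-mod α²≈8/5 (solve 3 (λ C E a → con (recip 4) :* (C :+ E) := con (recip 4) :* (♯ 2 :* C :+ E) :- :½ :* (:½ :* a :* (:½ :* a) :* C)
             :+ con (recip 7) :* C :* (a :* a :- ♯ 8 :* con (recip 4))) C (sum (λ j → sum (excess j))) α) ⟩
      fromℕ 5 ⁻¹ * (fromℕ 2 * C + sum (λ j → sum (excess j))) - ½ * ((½ * α) ² * C)
        ≈⟨ +-congʳ (*-congˡ sum-totalLatency) ⟨
      fromℕ 5 ⁻¹ * sum (totalLatency I x) - ½ * ((½ * α) ² * C)
        ≈⟨ +-congʳ (sum-*ˡ (fromℕ 5 ⁻¹) (totalLatency I x)) ⟩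
      sum (λ j → fromℕ 5 ⁻¹ * totalLatency I x j) - ½ * ((½ * α) ² * C)
        ≈⟨ proportional-objective standard-lawful {α = α} I x ⟨
      objective standard I (fit I x) ∎
      where
      C = cost standard I x

      sum-totalLatency : sum (totalLatency I x) ≈ fromℕ 2 * C + sum (λ j → sum (excess j))
      sum-totalLatency = trans (sum-cong totalLatency≈) (trans (sum-+ (λ j → fromℕ 2 * costIncrease j) (λ j → sum (excess j)))
        (+-congʳ (trans (sym (sum-*ˡ (fromℕ 2) costIncrease)) (*-congˡ (cost-telescope standard-lawful I x)))))

  dualFitting : DualFitting standard (Fractional standard) balance expectedCost (fromℕ 5)
  dualFitting = fit , λ A fractional follows I →
    let choice = λ j → fractional (take (toℕ j) I) (lookup I j) in
    fit-feasible I (run standard A I) choice (follows I) , fit-objective I (run standard A I) choice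

  analysis : AnalyzedByDualFitting standard (Fractional standard) balance expectedCost (fromℕ 5)
  analysis = (algorithm , algorithm-fractional , algorithm-follows) , dualFitting ,
    competitive standard-lawful {rule = balance} {costOf = expectedCost} (fromℕ-suc≰0 4) dualFitting

-- Adaptive instances and their offline solutions

module Adversary (R : CompleteOrderedField) where
  open OnlineAlgorithms R public

  private
    variable
      m : ℕ

  Jobs : ℕ → Set
  Jobs m = List (Job standard m)

  uniformJob : (S : List (Fin m)) → Unique S → S ≢ [] → ∀ {ω} → 0# ≤ ω → Job standard m
  uniformJob S S! S≢[] {ω} 0≤ω = record
    { feasible = S; unique = S!; nonempty = S≢[]; weight = λ _ → ω; weight≥0 = λ _ → 0≤ω }

  -- Jobs confined to `S` put no load outside `S`, online or offline, so games on disjoint sets of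
  -- machines do not interact.
  Confined : List (Fin m) → Jobs m → Set
  Confined S = All (λ J → ∀ {i} → i ∈ feasible J → i ∈ S)

  confined-mono : ∀ {S T} {Js : Jobs m} → (∀ {i} → i ∈ S → i ∈ T) → Confined S Js → Confined T Js
  confined-mono S⊆T All.[]         = All.[]
  confined-mono S⊆T (J⊆S ∷ᵃ ⊆S) = (λ i∈J → S⊆T (J⊆S i∈J)) ∷ᵃ confined-mono S⊆T ⊆S

  -- Stored along the list, offline solutions are built together with the jobs and concatenated by
  -- `++⁺`; they become an `Assignment` only when costs are compared.
  Offline : Jobs m → Set
  Offline = All (λ J → ∃[ i ] i ∈ feasible J)

  offlineLoad : ∀ {Js : Jobs m} → Offline Js → Fin m → ℝ
  offlineLoad All.[]                      e = 0#
  offlineLoad {Js = J ∷ _} ((i , _) ∷ᵃ zs) e = when ⌊ i ≟ᶠ e ⌋ (weight J e) + offlineLoad zs e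

  offlineLoad-++ : ∀ {Js Ks : Jobs m} (ys : Offline Js) (zs : Offline Ks) e →
    offlineLoad (++⁺ ys zs) e ≈ offlineLoad ys e + offlineLoad zs e
  offlineLoad-++ All.[]     zs e = sym (+-identityˡ _)
  offlineLoad-++ (y ∷ᵃ ys) zs e = trans (+-congˡ (offlineLoad-++ ys zs e)) (sym (+-assoc _ _ _))

  offlineLoad-outside : ∀ {S} {Js : Jobs m} (zs : Offline Js) → Confined S Js → ∀ {e} → e ∉ S → offlineLoad zs e ≈ 0#
  offlineLoad-outside All.[]             All.[]      e∉S = refl
  offlineLoad-outside ((i , i∈) ∷ᵃ zs) (J⊆S ∷ᵃ ⊆S) {e} e∉S = trans
    (+-cong (reflexive (when-false (i ≟ᶠ e) (λ { ≡.refl → e∉S (J⊆S i∈) }))) (offlineLoad-outside zs ⊆S e∉S)) (+-identityˡ 0#)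

  offlineAssignment : ∀ {I : Instance standard m} → Offline I → Assignment standard I
  offlineAssignment ((i , _) ∷ᵃ zs) k fzero    = when ⌊ i ≟ᶠ k ⌋ 1#
  offlineAssignment (_ ∷ᵃ zs)       k (fsuc j) = offlineAssignment zs k j

  offlineAssignment-integral : ∀ {I : Instance standard m} (zs : Offline I) → IsIntegral standard I (offlineAssignment zs)
  offlineAssignment-integral ((i , i∈) ∷ᵃ zs) fzero    = indicator-integral standard-lawful i∈
  offlineAssignment-integral (_ ∷ᵃ zs)        (fsuc j) = offlineAssignment-integral zs j

  load-offline : ∀ {I : Instance standard m} (zs : Offline I) e → load standard I (offlineAssignment zs) e ≈ offlineLoad zs e
  load-offline {I = I} zs e = trans (prefix-all {length I} _) (go zs)
    where
    go : ∀ {Js : Jobs _} (zs : Offline Js) →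
      sum (λ k → weight (lookup Js k) e * offlineAssignment zs e k) ≈ offlineLoad zs e
    go All.[]           = refl
    go ((i , _) ∷ᵃ zs) = +-cong (trans (*-when ⌊ i ≟ᶠ e ⌋ 1#) (when-cong ⌊ i ≟ᶠ e ⌋ (*-identityʳ _))) (go zs)

  module _ (A : Algorithm standard) where
    -- the load due to the jobs Js when they arrive after past
    onlineLoad : Jobs m → Jobs m → Fin m → ℝ
    onlineLoad past []       e = 0#
    onlineLoad past (J ∷ Js) e = weight J e * A past J e + onlineLoad (past ++ J ∷ []) Js e

    onlineLoad-++ : ∀ (past Js Ks : Jobs m) e →
      onlineLoad past (Js ++ Ks) e ≈ onlineLoad past Js e + onlineLoad (past ++ Js) Ks e
    onlineLoad-++ past [] Ks e = trans (reflexive (≡.cong (λ p → onlineLoad p Ks e) (≡.sym (++-identityʳ past)))) (sym (+-identityˡ _))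
    onlineLoad-++ past (J ∷ Js) Ks e = trans (+-congˡ (trans (onlineLoad-++ (past ++ J ∷ []) Js Ks e)
      (+-congˡ (reflexive (≡.cong (λ p → onlineLoad p Ks e) (++-assoc past (J ∷ []) Js)))))) (sym (+-assoc _ _ _))

    load-run : ∀ (I : Instance standard m) e → load standard I (run standard A I) e ≈ onlineLoad [] I e
    load-run I e = trans (prefix-all {length I} _) (go [] I)
      where
      go : ∀ past Js → sum {length Js} (λ k → weight (lookup Js k) e * A (past ++ take (toℕ k) Js) (lookup Js k) e) ≈ onlineLoad past Js e
      go past []       = refl
      go past (J ∷ Js) = +-cong (*-congˡ (reflexive (≡.cong (λ p → A p J e) (++-identityʳ past))))
        (trans (sum-cong {length Js} (λ k → *-congˡ (reflexive (≡.cong (λ p → A p (lookup Js k) e) (≡.sym (++-assoc past (J ∷ []) (take (toℕ k) Js)))))))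
               (go (past ++ J ∷ []) Js))

    onlineLoad-outside : Fractional standard A → ∀ {S} (past Js : Jobs m) → Confined S Js → ∀ {e} → e ∉ S → onlineLoad past Js e ≈ 0#
    onlineLoad-outside fractional past []       All.[]       e∉S = refl
    onlineLoad-outside fractional past (J ∷ Js) (J⊆S ∷ᵃ ⊆S) e∉S = trans
      (+-cong (trans (*-congˡ (FractionalChoice.infeasible (fractional past J) _ (λ e∈J → e∉S (J⊆S e∈J)))) (zeroʳ _))
              (onlineLoad-outside fractional (past ++ J ∷ []) Js ⊆S e∉S)) (+-identityˡ 0#)

    onlineCost≤ : ∀ {c} → Competitive standard (cost standard) A c → ∀ (I : Instance standard m) (zs : Offline I) →
      sum (λ e → onlineLoad [] I e ²) ≤ c * sum (λ e → offlineLoad zs e ²)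
    onlineCost≤ {c = c} comp I zs = ≤-cong
      (⟨⟩-cong (load-run I) (load-run I)) (*-congˡ (⟨⟩-cong (load-offline zs) (load-offline zs)))
      (comp I (offlineAssignment zs) (offlineAssignment-integral zs))

  extract : ∀ {i} {S : List (Fin m)} → Unique S → i ∈ S → ∃[ S′ ] (S ↭ i ∷ S′ × Unique S′ × i ∉ S′)
  extract {i = i} S! i∈S with ∈-∃++ i∈S
  ... | ys , zs , ≡.refl with Unique-resp-↭ (≡.setoid _) (↭⇒↭ₛ (shift i ys zs)) S!
  ...   | i∉ ∷ᵘ S′! = ys ++ zs , shift i ys zs , S′! , λ i∈S′ → All.lookup i∉ i∈S′ ≡.refl

  unique-++⁻ : ∀ (S : List (Fin m)) {T} → Unique (S ++ T) → Unique S × Unique T × (∀ {e} → e ∈ S → e ∉ T)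
  unique-++⁻ []      T! = []ᵘ , T! , λ ()
  unique-++⁻ (i ∷ S) (i∉ ∷ᵘ ST!) with unique-++⁻ S ST!
  ... | S! , T! , S#T = ++⁻ˡ S i∉ ∷ᵘ S! , T! , λ
    { (here ≡.refl) e∈T → All.lookup (++⁻ʳ S i∉) e∈T ≡.refl ; (there e∈S) e∈T → S#T e∈S e∈T }

  sum-allFin : ∀ (f : Fin m → ℝ) → sum f ≈ ∑∈ (allFin m) f
  sum-allFin {m} f = sum≈∑∈ f (allFin⁺ m) (λ i i∉ → contradiction (∈-allFin i) i∉)

  -- If `c` exceeded `c′`, then `f` would be bounded by `B * (c - c′) ⁻¹`. An error that does not
  -- grow with `n` is thus harmless.
  ratio-bound : ∀ {c c′} {B} (f : ℕ → ℝ) → (∀ B → ¬ (∀ n → f n ≤ B)) → (∀ n → c * f n ≤ c′ * f n + B) → c ≤ c′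
  ratio-bound {c} {c′} {B} f f-unbounded bound = ≤-stable λ c≰c′ → f-unbounded (B * (c - c′) ⁻¹) λ n →
    *-cancelʳ-≤ (≰-shift c≰c′) (≤-by (x≤y⇒0≤y-x (bound n))
      (≈-mod (⁻¹-inverseʳ (c - c′) (≰0⇒≉0 (≰-shift c≰c′)))
        (solve 5 (λ B c d f i → B :* i :* (c :- d) :- f :* (c :- d) := d :* f :+ B :- c :* f :+ B :* ((c :- d) :* i :- :1)) B c c′ (f n) ((c - c′) ⁻¹))))

-- The lower bound for fractional algorithms

module FractionalLowerBound (R : CompleteOrderedField) where
  open Adversary R public

  private
    variable
      m : ℕ

  -- u d = (2d choose d) / 4ᵈ is of order 1/√d and satisfies
  -- u 0 + ⋯ + u (d - 1) = 2 d (u d), so that Hardy's inequality with the sharp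
  -- constant 4 is nearly tight for it.
  u : ℕ → ℝ
  u zero    = 1#
  u (suc d) = u d - u d * (½ * fromℕ (suc d) ⁻¹)

  δ : ℕ → ℝ
  δ d = u d * (½ * fromℕ (suc d) ⁻¹)

  -- The discrete counterpart of the equation `u′ = - u / (2d)` satisfied by `1 / √d`; it makes the
  -- induction for `online≥` close.
  2dδ≈u : ∀ d → fromℕ 2 * (fromℕ (suc d) * δ d) ≈ u d
  2dδ≈u d = ≈-mod (⁻¹-inverse-suc d) (solve 3 (λ u D i → ♯ 2 :* (D :* (u :* (:½ :* i))) := u :+ u :* (D :* i :- :1)) (u d) (fromℕ (suc d)) (fromℕ (suc d) ⁻¹))

  recip≤1 : ∀ d → fromℕ (suc d) ⁻¹ ≤ 1#
  recip≤1 d = *-cancelʳ-≤ (fromℕ-suc≰0 d) (≤-cong (sym (trans (*-comm _ _) (⁻¹-inverse-suc d))) (sym (*-identityˡ _)) (x≤x+y (fromℕ≥0 d)))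

  u≥0 : ∀ d → 0# ≤ u d
  u≥0 zero    = 0≤1
  u≥0 (suc d) = ≤-cong refl (solve 2 (λ u i → :½ :* u :* (:1 :+ (:1 :- i)) := u :- u :* (:½ :* i)) (u d) (fromℕ (suc d) ⁻¹))
    (*-nonNegative (*-nonNegative (recip≥0 1) (u≥0 d)) (+-nonNegative 0≤1 (x≤y⇒0≤y-x (recip≤1 d))))

  δ≥0 : ∀ d → 0# ≤ δ d
  δ≥0 d = *-nonNegative (u≥0 d) (*-nonNegative (recip≥0 1) (recip≥0 d))

  u-antitone : ∀ d → u (suc d) ≤ u d
  u-antitone d = ≤-by (δ≥0 d) (solve 2 (λ u δ → u :- (u :- δ) := δ) (u d) (δ d))

  -- The product `4 d (u d)²` equals 1 at `d = 1` and never decreases. So the offline cost, the sum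
  -- of all `(u d)²`, diverges at least as fast as a quarter of the harmonic series.
  4du²≥1 : ∀ d → 1# ≤ fromℕ 4 * fromℕ (suc d) * u (suc d) ²
  4du²≥1 zero    = ≤-reflexive (solve 0 (:1 := ♯ 4 :* ♯ 1 :* ((:1 :- :1 :* (:½ :* con (recip 0))) :* (:1 :- :1 :* (:½ :* con (recip 0))))))
  4du²≥1 (suc d) = ≤-trans (4du²≥1 d) (≤-by
    (*-nonNegative (x²≥0 (u (suc d))) (recip≥0 (suc d)))
    (≈-mod (⁻¹-inverse-suc (suc d)) (solve 3 (λ u D i → ♯ 4 :* (:1 :+ D) :* ((u :- u :* (:½ :* i)) :* (u :- u :* (:½ :* i))) :- ♯ 4 :* D :* (u :* u)
      := u :* u :* i :+ u :* u :* (i :- ♯ 4) :* ((:1 :+ D) :* i :- :1)) (u (suc d)) (fromℕ (suc d)) (fromℕ (suc (suc d)) ⁻¹))))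

  -- the offline cost of the game on d machines
  H : ℕ → ℝ
  H zero    = 0#
  H (suc d) = u (suc d) ² + H d

  H-gain : ∀ k n → H n + fromℕ k * u (k ℕ.+ n) ² ≤ H (k ℕ.+ n)
  H-gain zero    n = ≤-reflexive (trans (+-congˡ (zeroˡ _)) (+-identityʳ (H n)))
  H-gain (suc k) n = begin
    H n + (1# + fromℕ k) * v ²            ≈⟨ solve 3 (λ h k v → h :+ (:1 :+ k) :* v := v :+ (h :+ k :* v)) (H n) (fromℕ k) (v ²) ⟩
    v ² + (H n + fromℕ k * v ²)           ≤⟨ +-mono-≤ ≤-refl (+-mono-≤ ≤-refl (*-monoˡ-≤ (fromℕ≥0 k) v²≤)) ⟩
    v ² + (H n + fromℕ k * u (k ℕ.+ n) ²) ≤⟨ +-mono-≤ ≤-refl (H-gain k n) ⟩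
    v ² + H (k ℕ.+ n)                     ∎
    where
    v = u (suc (k ℕ.+ n))
    v²≤ : v ² ≤ u (k ℕ.+ n) ²
    v²≤ = ≤-trans (*-monoˡ-≤ (u≥0 (suc (k ℕ.+ n))) (u-antitone (k ℕ.+ n))) (*-monoʳ-≤ (u≥0 (k ℕ.+ n)) (u-antitone (k ℕ.+ n)))

  -- Blocks as for the harmonic series: the `n + 1` terms after index `n` up to `2n + 1` are each at
  -- least the last one, hence at least `1 / (4 (2n + 1))`, and the block adds at least `1/8`.
  H-unbounded : ∀ B → ¬ (∀ n → H n ≤ B)
  H-unbounded = unbounded H (λ n → suc n ℕ.+ n) (⁻¹-positive (fromℕ-suc≰0 7))
    λ n → ≤-trans (+-mono-≤ ≤-refl (eighth n)) (H-gain (suc n) n)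
    where
    eighth : ∀ n → fromℕ 8 ⁻¹ ≤ fromℕ (suc n) * u (suc n ℕ.+ n) ²
    eighth n = begin
      fromℕ 8 ⁻¹                                                       ≈⟨ *-identityʳ _ ⟨
      fromℕ 8 ⁻¹ * 1#                                                  ≤⟨ *-monoˡ-≤ (recip≥0 7) (4du²≥1 (n ℕ.+ n)) ⟩
      fromℕ 8 ⁻¹ * (fromℕ 4 * fromℕ (suc (n ℕ.+ n)) * v)               ≈⟨ *-congˡ (*-congʳ (*-congˡ (+-congˡ (fromℕ-+ n n)))) ⟩
      fromℕ 8 ⁻¹ * (fromℕ 4 * (1# + (fromℕ n + fromℕ n)) * v)
        ≤⟨ ≤-by (*-nonNegative (recip≥0 1) (x²≥0 (u (suc n ℕ.+ n)))) (solve 2 (λ n v →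
             (:1 :+ n) :* v :- con (recip 7) :* (♯ 4 :* (:1 :+ (n :+ n)) :* v) := :½ :* v) (fromℕ n) v) ⟩
      fromℕ (suc n) * v                                                ∎
      where
      v = u (suc n ℕ.+ n) ²

  length*minimum≤ : ∀ {O : Set} (S : List O) (f : O → ℝ) {x} → (∀ i → i ∈ S → x ≤ f i) → fromℕ (length S) * x ≤ ∑∈ S f
  length*minimum≤ []      f {x} x≤f = ≤-reflexive (zeroˡ x)
  length*minimum≤ (i ∷ S) f {x} x≤f = ≤-cong (sym (trans (distribʳ x 1# _) (+-congʳ (*-identityˡ x)))) refl
    (+-mono-≤ (x≤f i (here ≡.refl)) (length*minimum≤ S f (λ k k∈S → x≤f k (there k∈S))))

  module _ (A : Algorithm standard) (fractional : Fractional standard A) where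

    -- The machines of `S` already carry the loads `ℓ` when `jobs` arrive. The bound involves only
    -- the total of `ℓ`, so it does not matter how the algorithm spreads a job, and being affine in
    -- it, it survives the dropping of a machine.
    record Game (d : ℕ) (past : Jobs m) (ℓ : Fin m → ℝ) (S : List (Fin m)) : Set where
      field
        jobs     : Jobs m
        offline  : Offline jobs
        confined : Confined S jobs
        online≥  : fromℕ 8 * u d * ∑∈ S ℓ + (fromℕ 4 * u d ² + fromℕ 4 * H d - fromℕ 4)
                     ≤ ∑∈ S (λ e → (ℓ e + onlineLoad A past jobs e) ²)
        offline≈ : ∑∈ S (λ e → offlineLoad offline e ²) ≈ H d

    -- A job on all alive machines; the least loaded one receives it offline and
    -- is dropped.  Squares are bounded below by l² ≥ 2λl - λ² with λ = 2 u d.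
    play : ∀ d (past : Jobs m) ℓ (S : List (Fin m)) → Unique S → length S ≡ d → Game d past ℓ S
    play zero past ℓ [] S! _ = record
      { jobs     = []
      ; offline  = All.[]
      ; confined = All.[]
      -- As `u 0` is 1, the constant `- 4` of the invariant makes the empty game break even.
      ; online≥  = ≤-reflexive (solve 0 (♯ 8 :* :1 :* :0 :+ (♯ 4 :* (:1 :* :1) :+ ♯ 4 :* :0 :- ♯ 4) := :0))
      ; offline≈ = refl
      }
    play {m} (suc d) past ℓ S@(i₀ ∷ T) S! |S|≡1+d = record
      { jobs     = J ∷ jobs
      ; offline  = (i , i∈S) ∷ᵃ offline
      ; confined = id ∷ᵃ confined-mono S′⊆S confined
      ; online≥  = online≥′
      ; offline≈ = offline≈′
      }
      where
      J : Job standard m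
      J = uniformJob S S! (λ ()) (u≥0 (suc d))

      x : Fin m → ℝ
      x = A past J

      ℓ′ : Fin m → ℝ
      ℓ′ e = ℓ e + u (suc d) * x e

      least = minimum ℓ′ S (λ ())
      i = proj₁ least
      i∈S = proj₁ (proj₂ least)
      least≤ = proj₂ (proj₂ least)

      rest = extract S! i∈S
      S′ = proj₁ rest
      S↭ : S ↭ i ∷ S′
      S↭ = proj₁ (proj₂ rest)
      i∉S′ = proj₂ (proj₂ (proj₂ rest))

      length-S′ : length S′ ≡ d
      length-S′ = ℕₚ.suc-injective (≡.trans (≡.sym (↭-length S↭)) |S|≡1+d)

      S′⊆S : ∀ {k} → k ∈ S′ → k ∈ S
      S′⊆S k∈S′ = ∈-resp-↭ (↭-sym S↭) (there k∈S′)

      remaining : Game d (past ++ J ∷ []) ℓ′ S′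
      remaining = play d (past ++ J ∷ []) ℓ′ S′ (proj₁ (proj₂ (proj₂ rest))) length-S′

      open Game remaining

      onl : Fin m → ℝ
      onl = onlineLoad A (past ++ J ∷ []) jobs

      total≈ : ∑∈ S ℓ′ ≈ ∑∈ S ℓ + u (suc d)
      total≈ = trans (∑∈-+ S ℓ (λ e → u (suc d) * x e)) (+-congˡ (trans (sym (∑∈-*ˡ S (u (suc d)) x))
        (trans (*-congˡ (FractionalChoice.total (fractional past J))) (*-identityʳ _))))

      online≥′ : fromℕ 8 * u (suc d) * ∑∈ S ℓ + (fromℕ 4 * u (suc d) ² + fromℕ 4 * (u (suc d) ² + H d) - fromℕ 4)
                   ≤ ∑∈ S (λ e → (ℓ e + (u (suc d) * x e + onl e)) ²)
      online≥′ = begin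
        fromℕ 8 * v * ∑∈ S ℓ + (fromℕ 4 * v ² + fromℕ 4 * (v ² + H d) - fromℕ 4)
          -- Write `u` for `u d`, `δ` for `δ d` and `l` for the load of `i`. Trading `8 u l` for
          -- `l²` loses at most `4 u l + 4 u²`. Since `l` is at most the average load and
          -- `u = 2 (d + 1) δ`, the part `4 u l` is at most `8 δ` times the total load: the slope
          -- falls from `8 u d` to `8 u (suc d)`. The invariant's `4 u²` pays for the rest.
          ≤⟨ ≤-by (+-nonNegative (*-nonNegative (*-nonNegative (fromℕ≥0 8) (δ≥0 d)) (x≤y⇒0≤y-x (≤-cong (*-congʳ (reflexive (≡.cong fromℕ |S|≡1+d))) total≈ (length*minimum≤ S ℓ′ least≤))))
                                 (x²≥0 (ℓ′ i - fromℕ 2 * u d)))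
               (≈-mod (2dδ≈u d) (solve 6 (λ u δ D T H l → let v = u :- δ in
                  l :* l :+ (♯ 8 :* u :* (T :+ v :- l) :+ (♯ 4 :* (u :* u) :+ ♯ 4 :* H :- ♯ 4)) :- (♯ 8 :* v :* T :+ (♯ 4 :* (v :* v) :+ ♯ 4 :* (v :* v :+ H) :- ♯ 4))
                    := ♯ 8 :* δ :* (T :+ v :- D :* l) :+ (l :- ♯ 2 :* u) :* (l :- ♯ 2 :* u) :+ ♯ 4 :* l :* (♯ 2 :* (D :* δ) :- u))
                  (u d) (δ d) (fromℕ (suc d)) (∑∈ S ℓ) (H d) (ℓ′ i))) ⟩
        ℓ′ i ² + (fromℕ 8 * u d * (∑∈ S ℓ + v - ℓ′ i) + (fromℕ 4 * u d ² + fromℕ 4 * H d - fromℕ 4))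
          ≈⟨ +-congˡ (+-congʳ (*-congˡ ∑S′)) ⟩
        ℓ′ i ² + (fromℕ 8 * u d * ∑∈ S′ ℓ′ + (fromℕ 4 * u d ² + fromℕ 4 * H d - fromℕ 4))
          ≤⟨ +-mono-≤ ≤-refl online≥ ⟩
        ℓ′ i ² + ∑∈ S′ (λ e → (ℓ′ e + onl e) ²)
          ≈⟨ +-congʳ (*-cong dropped dropped) ⟨
        (ℓ′ i + onl i) ² + ∑∈ S′ (λ e → (ℓ′ e + onl e) ²)
          ≈⟨ ∑∈-↭ (λ e → (ℓ′ e + onl e) ²) S↭ ⟨
        ∑∈ S (λ e → (ℓ′ e + onl e) ²)
          ≈⟨ ∑∈-cong S (λ e _ → *-cong (+-assoc _ _ _) (+-assoc _ _ _)) ⟩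
        ∑∈ S (λ e → (ℓ e + (u (suc d) * x e + onl e)) ²) ∎
        where
        v = u (suc d)

        dropped : ℓ′ i + onl i ≈ ℓ′ i
        dropped = trans (+-congˡ (onlineLoad-outside A fractional (past ++ J ∷ []) jobs confined i∉S′)) (+-identityʳ _)

        ∑S′ : ∑∈ S ℓ + v - ℓ′ i ≈ ∑∈ S′ ℓ′
        ∑S′ = trans (+-congʳ (trans (sym total≈) (∑∈-↭ ℓ′ S↭))) (solve 2 (λ l s → l :+ s :- l := s) (ℓ′ i) (∑∈ S′ ℓ′))

      offline≈′ : ∑∈ S (λ e → (when ⌊ i ≟ᶠ e ⌋ (u (suc d)) + offlineLoad offline e) ²) ≈ u (suc d) ² + H d
      offline≈′ = begin-equality
        ∑∈ S off²
          ≈⟨ ∑∈-↭ off² S↭ ⟩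
        off² i + ∑∈ S′ off²
          ≈⟨ +-cong (*-cong at-i at-i) (∑∈-cong S′ (λ e e∈S′ → *-cong (elsewhere e e∈S′) (elsewhere e e∈S′))) ⟩
        u (suc d) ² + ∑∈ S′ (λ e → offlineLoad offline e ²)
          ≈⟨ +-congˡ offline≈ ⟩
        u (suc d) ² + H d ∎
        where
        off² : Fin m → ℝ
        off² e = (when ⌊ i ≟ᶠ e ⌋ (u (suc d)) + offlineLoad offline e) ²

        at-i : when ⌊ i ≟ᶠ i ⌋ (u (suc d)) + offlineLoad offline i ≈ u (suc d)
        at-i = trans (+-cong (reflexive (when-true (i ≟ᶠ i) ≡.refl)) (offlineLoad-outside offline confined i∉S′)) (+-identityʳ _)

        elsewhere : ∀ e → e ∈ S′ → when ⌊ i ≟ᶠ e ⌋ (u (suc d)) + offlineLoad offline e ≈ offlineLoad offline e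
        elsewhere e e∈S′ = trans (+-congʳ (reflexive (when-false (i ≟ᶠ e) (λ { ≡.refl → i∉S′ e∈S′ })))) (+-identityˡ _)

    4H≤ : ∀ {c} → Competitive standard (cost standard) A c → ∀ n → fromℕ 4 * H n ≤ c * H n + fromℕ 4
    4H≤ {c} comp n = begin
      fromℕ 4 * H n
        ≤⟨ ≤-by (*-nonNegative (fromℕ≥0 4) (x²≥0 (u n)))
             (solve 2 (λ u H → ♯ 8 :* u :* :0 :+ (♯ 4 :* (u :* u) :+ ♯ 4 :* H :- ♯ 4) :+ ♯ 4 :- ♯ 4 :* H := ♯ 4 :* (u :* u)) (u n) (H n)) ⟩
      fromℕ 8 * u n * 0# + (fromℕ 4 * u n ² + fromℕ 4 * H n - fromℕ 4) + fromℕ 4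
        ≈⟨ +-congʳ (+-congʳ (*-congˡ (∑∈-zero S (λ _ _ → refl)))) ⟨
      fromℕ 8 * u n * ∑∈ S (λ _ → 0#) + (fromℕ 4 * u n ² + fromℕ 4 * H n - fromℕ 4) + fromℕ 4
        ≤⟨ +-mono-≤ online≥ ≤-refl ⟩
      ∑∈ S (λ e → (0# + onlineLoad A [] jobs e) ²) + fromℕ 4
        ≈⟨ +-congʳ (trans (∑∈-cong S (λ e _ → *-cong (+-identityˡ _) (+-identityˡ _))) (sym (sum-allFin (λ e → onlineLoad A [] jobs e ²)))) ⟩
      sum (λ e → onlineLoad A [] jobs e ²) + fromℕ 4
        ≤⟨ +-mono-≤ (onlineCost≤ A comp jobs offline) ≤-refl ⟩
      c * sum (λ e → offlineLoad offline e ²) + fromℕ 4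
        ≈⟨ +-congʳ (*-congˡ (trans (sum-allFin (λ e → offlineLoad offline e ²)) offline≈)) ⟩
      c * H n + fromℕ 4 ∎
      where
      S = allFin n

      open Game (play n [] (λ _ → 0#) S (allFin⁺ n) (length-tabulate {n = n} id))

  fractional-optimal : OptimalRatio standard (Fractional standard) (fromℕ 4)
  fractional-optimal A fractional c comp = ratio-bound H H-unbounded (4H≤ A fractional comp)

-- The lower bound for deterministic algorithms

module DeterministicLowerBound (R : CompleteOrderedField) where
  open Adversary R public

  private
    variable
      m : ℕ

  -- Two machines of equal load meet in a job of weight ω k.  The machine chosen
  -- by the algorithm goes on to meet the next one, while offline the job is put
  -- on the other machine.
  module Knockout {r : ℝ} (0≤r : 0# ≤ r) (r²≈2 : r * r ≈ fromℕ 2) where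

    ω : ℕ → ℝ
    ω zero    = 1#
    ω (suc k) = r * ω k

    ω≥0 : ∀ k → 0# ≤ ω k
    ω≥0 zero    = 0≤1
    ω≥0 (suc k) = *-nonNegative 0≤r (ω≥0 k)

    -- the load ω 0 + ⋯ + ω (k - 1) of the winner of k meetings
    W : ℕ → ℝ
    W k = (r + 1#) * (ω k - 1#)

    -- `r + 1` is the inverse of `r - 1`, so `W` is the closed form of a geometric sum.
    W-suc : ∀ k → W k + ω k ≈ W (suc k)
    W-suc k = ≈-mod (sym r²≈2) (solve 2 (λ r w → (r :+ :1) :* (w :- :1) :+ w := (r :+ :1) :* (r :* w :- :1) :+ w :* (♯ 2 :- r :* r)) r (ω k))

    -- the online and offline costs of the machines knocked out
    on² off² : ℕ → ℝ
    on² zero     = 0#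
    on² (suc k)  = W k ² + (on² k + on² k)
    off² zero    = 0#
    off² (suc k) = ω k ² + (off² k + off² k)

    -- The square of `r + 1`, which is the limit of `W k / ω k`: a machine knocked out by a job of
    -- weight `ω k` has load `W k` online and `ω k` offline.
    c : ℝ
    c = fromℕ 3 + fromℕ 2 * r

    power : ℕ → ℝ
    power zero    = 1#
    power (suc k) = fromℕ 2 * power k

    power≰0 : ∀ k → power k ≰ 0#
    power≰0 zero    = 1≰0
    power≰0 (suc k) = *-positive (fromℕ-suc≰0 1) (power≰0 k)

    ω²≈power : ∀ k → ω k ² ≈ power k
    ω²≈power zero    = *-identityˡ 1#
    ω²≈power (suc k) = begin-equality
      r * ω k * (r * ω k)   ≈⟨ solve 2 (λ r w → r :* w :* (r :* w) := r :* r :* (w :* w)) r (ω k) ⟩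
      r * r * ω k ²         ≈⟨ *-cong r²≈2 (ω²≈power k) ⟩
      fromℕ 2 * power k     ∎

    -- Compared with the round before, a round has half the meetings and twice the squared weight,
    -- so all rounds cost the offline solution the same. Growth like `k * power k` makes errors of
    -- order `power k` harmless.
    2off²≈ : ∀ k → fromℕ 2 * off² k ≈ fromℕ k * power k
    2off²≈ zero    = solve 0 (♯ 2 :* :0 := :0 :* :1)
    2off²≈ (suc k) = begin-equality
      fromℕ 2 * (ω k ² + (off² k + off² k))              ≈⟨ solve 2 (λ w o → ♯ 2 :* (w :+ (o :+ o)) := ♯ 2 :* (w :+ ♯ 2 :* o)) (ω k ²) (off² k) ⟩
      fromℕ 2 * (ω k ² + fromℕ 2 * off² k)               ≈⟨ *-congˡ (+-cong (ω²≈power k) (2off²≈ k)) ⟩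
      fromℕ 2 * (power k + fromℕ k * power k)            ≈⟨ solve 2 (λ k p → ♯ 2 :* (p :+ k :* p) := (:1 :+ k) :* (♯ 2 :* p)) (fromℕ k) (power k) ⟩
      fromℕ (suc k) * power (suc k)                      ∎

    c≥0 : 0# ≤ c
    c≥0 = +-nonNegative (fromℕ≥0 3) (*-nonNegative (fromℕ≥0 2) 0≤r)

    -- c ω² - W² ≤ 2 c ω, and the errors 2 c (ω k) add up to this slack.
    slack : ℕ → ℝ
    slack k = c * (fromℕ 2 + r) * (power k - ω k)

    c*off²≤ : ∀ k → c * off² k ≤ on² k + slack k
    c*off²≤ zero    = ≤-reflexive (solve 1 (λ r → let c = ♯ 3 :+ ♯ 2 :* r in c :* :0 := :0 :+ c :* (♯ 2 :+ r) :* (:1 :- :1)) r)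
    c*off²≤ (suc k) = ≤-by (+-nonNegative (+-nonNegative (x≤y⇒0≤y-x (c*off²≤ k)) (x≤y⇒0≤y-x (c*off²≤ k))) c≥0)
      (≈-mod r²≈2 (solve 5 (λ r w p n o → let c = ♯ 3 :+ ♯ 2 :* r in
        ((r :+ :1) :* (w :- :1) :* ((r :+ :1) :* (w :- :1)) :+ (n :+ n) :+ c :* (♯ 2 :+ r) :* (♯ 2 :* p :- r :* w)) :- c :* (w :* w :+ (o :+ o))
          := (n :+ c :* (♯ 2 :+ r) :* (p :- w) :- c :* o) :+ (n :+ c :* (♯ 2 :+ r) :* (p :- w) :- c :* o) :+ c
             :+ ((w :- :1) :* (w :- :1) :- c :* w) :* (r :* r :- ♯ 2)) r (ω k) (power k) (on² k) (off² k)))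

    module _ (A : Algorithm standard) (deterministic : Deterministic standard A) where

      fractional : Fractional standard A
      fractional past J = proj₁ (deterministic past J)

      -- The values are exact whatever the algorithm does: its decisions only determine which
      -- machine plays which role. The winner is kept apart because it alone meets further jobs.
      record Tournament (k : ℕ) (past : Jobs m) (S : List (Fin m)) : Set where
        field
          winner         : Fin m
          losers         : List (Fin m)
          S↭             : S ↭ winner ∷ losers
          jobs           : Jobs m
          offline        : Offline jobs
          confined       : Confined S jobs
          winner-online  : onlineLoad A past jobs winner ≈ W k
          losers-online  : ∑∈ losers (λ e → onlineLoad A past jobs e ²) ≈ on² k
          winner-offline : offlineLoad offline winner ≈ 0#
          losers-offline : ∑∈ losers (λ e → offlineLoad offline e ²) ≈ off² k

        winner∈ : winner ∈ S
        winner∈ = ∈-resp-↭ (↭-sym S↭) (here ≡.refl)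

        losers⊆ : ∀ {e} → e ∈ losers → e ∈ S
        losers⊆ e∈ = ∈-resp-↭ (↭-sym S↭) (there e∈)

      module Join {k} {past : Jobs m} {S T : List (Fin m)} (ST! : Unique (S ++ T)) (left : Tournament k past S)
        (right : Tournament k (past ++ Tournament.jobs left) T) where
        module L = Tournament left
        module R = Tournament right

        S#T : ∀ {e} → e ∈ S → e ∉ T
        S#T = proj₂ (proj₂ (unique-++⁻ S ST!))

        rest : List (Fin m)
        rest = L.losers ++ R.losers

        ST↭ : S ++ T ↭ L.winner ∷ R.winner ∷ rest
        ST↭ = ↭-trans (↭-++⁺ L.S↭ R.S↭) (↭-prep L.winner (shift R.winner L.losers R.losers))

        onlineˡ onlineʳ offlineˡ offlineʳ : Fin m → ℝ
        onlineˡ  = onlineLoad A past L.jobs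
        onlineʳ  = onlineLoad A (past ++ L.jobs) R.jobs
        offlineˡ = offlineLoad L.offline
        offlineʳ = offlineLoad R.offline

        -- `S` and `T` are disjoint, so on either side only one of the two loads survives. Arbitrary
        -- `f` and `g` let this serve online and offline loads alike.
        module Sides (f g : Fin m → ℝ) (f≈0 : ∀ {e} → e ∉ S → f e ≈ 0#) (g≈0 : ∀ {e} → e ∉ T → g e ≈ 0#) where
          on-left : ∀ {e} → e ∈ S → f e + g e ≈ f e
          on-left e∈S = trans (+-congˡ (g≈0 (S#T e∈S))) (+-identityʳ _)

          on-right : ∀ {e} → e ∈ T → f e + g e ≈ g e
          on-right e∈T = trans (+-congʳ (f≈0 (λ e∈S → S#T e∈S e∈T))) (+-identityˡ _)

          ∑-rest : ∑∈ rest (λ e → (f e + g e) ²) ≈ ∑∈ L.losers (λ e → f e ²) + ∑∈ R.losers (λ e → g e ²)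
          ∑-rest = trans (∑∈-++ L.losers R.losers (λ e → (f e + g e) ²)) (+-cong
            (∑∈-cong L.losers (λ e e∈ → *-cong (on-left (L.losers⊆ e∈)) (on-left (L.losers⊆ e∈))))
            (∑∈-cong R.losers (λ e e∈ → *-cong (on-right (R.losers⊆ e∈)) (on-right (R.losers⊆ e∈)))))

        module Online = Sides onlineˡ onlineʳ (onlineLoad-outside A fractional past L.jobs L.confined)
                                              (onlineLoad-outside A fractional (past ++ L.jobs) R.jobs R.confined)
        module Off = Sides offlineˡ offlineʳ (offlineLoad-outside L.offline L.confined) (offlineLoad-outside R.offline R.confined)

        winners-differ : L.winner ≢ R.winner
        winners-differ l≡r = S#T L.winner∈ (≡.subst (_∈ T) (≡.sym l≡r) R.winner∈)

        final : Job standard m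
        final = uniformJob (L.winner ∷ R.winner ∷ []) ((winners-differ ∷ᵃ All.[]) ∷ᵘ (All.[] ∷ᵘ []ᵘ)) (λ ()) (ω≥0 k)

        x : Fin m → ℝ
        x = A ((past ++ L.jobs) ++ R.jobs) final

        jobs : Jobs m
        jobs = L.jobs ++ (R.jobs ++ final ∷ [])

        confined : Confined (S ++ T) jobs
        confined = ++⁺ (confined-mono ∈-++⁺ˡ L.confined) (++⁺ (confined-mono (∈-++⁺ʳ S) R.confined)
          ((λ { (here ≡.refl) → ∈-++⁺ˡ L.winner∈ ; (there (here ≡.refl)) → ∈-++⁺ʳ S R.winner∈ }) ∷ᵃ All.[]))

        online≈ : ∀ e → onlineLoad A past jobs e ≈ (onlineˡ e + onlineʳ e) + ω k * x e
        online≈ e = begin-equality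
          onlineLoad A past jobs e                   ≈⟨ onlineLoad-++ A past L.jobs (R.jobs ++ final ∷ []) e ⟩
          onlineˡ e + onlineLoad A (past ++ L.jobs) (R.jobs ++ final ∷ []) e
                                                     ≈⟨ +-congˡ (onlineLoad-++ A (past ++ L.jobs) R.jobs (final ∷ []) e) ⟩
          onlineˡ e + (onlineʳ e + (ω k * x e + 0#)) ≈⟨ solve 3 (λ a b c → a :+ (b :+ (c :+ :0)) := a :+ b :+ c) (onlineˡ e) (onlineʳ e) (ω k * x e) ⟩
          (onlineˡ e + onlineʳ e) + ω k * x e        ∎

        -- What the two winners have in common before they meet; it lets a single `finish` cover
        -- both possible decisions.
        record Finalist (e : Fin m) : Set where
          field
            plays        : e ∈ feasible final
            online-load  : onlineˡ e + onlineʳ e ≈ W k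
            offline-load : offlineˡ e + offlineʳ e ≈ 0#

        finalistˡ : Finalist L.winner
        finalistˡ = record
          { plays        = here ≡.refl
          ; online-load  = trans (Online.on-left L.winner∈) L.winner-online
          ; offline-load = trans (Off.on-left L.winner∈) L.winner-offline
          }

        finalistʳ : Finalist R.winner
        finalistʳ = record
          { plays        = there (here ≡.refl)
          ; online-load  = trans (Online.on-right R.winner∈) R.winner-online
          ; offline-load = trans (Off.on-right R.winner∈) R.winner-offline
          }

        finish : ∀ {i l} → S ++ T ↭ i ∷ l ∷ rest → Finalist i → Finalist l → x i ≈ 1# → Tournament (suc k) past (S ++ T)
        finish {i} {l} ST↭il i-plays l-plays xi≈1 = record
          { winner         = i
          ; losers         = l ∷ rest
          ; S↭             = ST↭il
          ; jobs           = jobs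
          ; offline        = offline
          ; confined       = confined
          ; winner-online  = trans (online≈ i) (trans (+-cong Fᵢ.online-load (trans (*-congˡ xi≈1) (*-identityʳ _))) (W-suc k))
          ; losers-online  = +-cong (*-cong online-l online-l)
              (trans (∑∈-cong rest (λ e e∈ → *-cong (online-rest e e∈) (online-rest e e∈))) (trans Online.∑-rest (+-cong L.losers-online R.losers-online)))
          ; winner-offline = trans (offline≈ i) (trans (+-cong Fᵢ.offline-load (reflexive (when-false (l ≟ᶠ i) (λ l≡i → i≢ (here ≡.refl) (≡.sym l≡i))))) (+-identityˡ 0#))
          ; losers-offline = +-cong (*-cong offline-l offline-l)
              (trans (∑∈-cong rest (λ e e∈ → *-cong (offline-rest e e∈) (offline-rest e e∈))) (trans Off.∑-rest (+-cong L.losers-offline R.losers-offline)))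
          }
          where
          module Fᵢ = Finalist i-plays
          module Fₗ = Finalist l-plays

          il! : Unique (i ∷ l ∷ rest)
          il! = Unique-resp-↭ (≡.setoid _) (↭⇒↭ₛ ST↭il) ST!

          i≢ : ∀ {e} → e ∈ l ∷ rest → i ≢ e
          i≢ = All.lookup (AllPairs.head il!)

          l≢ : ∀ {e} → e ∈ rest → l ≢ e
          l≢ = All.lookup (AllPairs.head (AllPairs.tail il!))

          unchosen : ∀ {e} → e ∈ l ∷ rest → onlineLoad A past jobs e ≈ onlineˡ e + onlineʳ e
          unchosen {e} e∈ = trans (online≈ e) (trans (+-congˡ (trans (*-congˡ
            (other-options standard-lawful (fractional ((past ++ L.jobs) ++ R.jobs) final) Fᵢ.plays xi≈1 e (λ e≡i → i≢ e∈ (≡.sym e≡i)))) (zeroʳ _))) (+-identityʳ _))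

          online-l : onlineLoad A past jobs l ≈ W k
          online-l = trans (unchosen (here ≡.refl)) Fₗ.online-load

          online-rest : ∀ e → e ∈ rest → onlineLoad A past jobs e ≈ onlineˡ e + onlineʳ e
          online-rest e e∈ = unchosen (there e∈)

          offline : Offline jobs
          offline = ++⁺ L.offline (++⁺ R.offline ((l , Fₗ.plays) ∷ᵃ All.[]))

          offline≈ : ∀ e → offlineLoad offline e ≈ (offlineˡ e + offlineʳ e) + when ⌊ l ≟ᶠ e ⌋ (ω k)
          offline≈ e = trans (offlineLoad-++ L.offline _ e) (trans (+-congˡ (offlineLoad-++ R.offline ((l , Fₗ.plays) ∷ᵃ All.[]) e))
            (solve 3 (λ a b c → a :+ (b :+ (c :+ :0)) := a :+ b :+ c) (offlineˡ e) (offlineʳ e) (when ⌊ l ≟ᶠ e ⌋ (ω k))))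

          offline-l : offlineLoad offline l ≈ ω k
          offline-l = trans (offline≈ l) (trans (+-cong Fₗ.offline-load (reflexive (when-true (l ≟ᶠ l) ≡.refl))) (+-identityˡ _))

          offline-rest : ∀ e → e ∈ rest → offlineLoad offline e ≈ offlineˡ e + offlineʳ e
          offline-rest e e∈ = trans (offline≈ e) (trans (+-congˡ (reflexive (when-false (l ≟ᶠ e) (l≢ e∈)))) (+-identityʳ _))

        joined : Tournament (suc k) past (S ++ T)
        joined with chosen-option standard-lawful (deterministic ((past ++ L.jobs) ++ R.jobs) final)
        ... | _ , here ≡.refl         , xi≈1 = finish ST↭ finalistˡ finalistʳ xi≈1
        ... | _ , there (here ≡.refl) , xi≈1 = finish (↭-trans ST↭ (↭-swap L.winner R.winner ↭-refl)) finalistʳ finalistˡ xi≈1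

      size : ℕ → ℕ
      size zero    = 1
      size (suc k) = size k ℕ.+ size k

      play : ∀ k (past : Jobs m) S → Unique S → length S ≡ size k → Tournament k past S
      play zero past (i ∷ []) S! _ = record
        { winner         = i
        ; losers         = []
        ; S↭             = ↭-refl
        ; jobs           = []
        ; offline        = All.[]
        ; confined       = All.[]
        ; winner-online  = solve 1 (λ r → :0 := (r :+ :1) :* (:1 :- :1)) r
        ; losers-online  = refl
        ; winner-offline = refl
        ; losers-offline = refl
        }
      play (suc k) past S S! |S|≡ = ≡.subst (Tournament (suc k) past) split
        -- The second half is played after the first, so its history, left to inference, includes
        -- the jobs of the first.
        (Join.joined S₁S₂! (play k past S₁ (proj₁ S₁S₂-unique) |S₁|≡) (play k _ S₂ (proj₁ (proj₂ S₁S₂-unique)) |S₂|≡))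
        where
        S₁ = take (size k) S
        S₂ = drop (size k) S

        split : S₁ ++ S₂ ≡ S
        split = take++drop≡id (size k) S

        S₁S₂! : Unique (S₁ ++ S₂)
        S₁S₂! = ≡.subst Unique (≡.sym split) S!

        S₁S₂-unique = unique-++⁻ S₁ S₁S₂!

        |S₁|≡ : length S₁ ≡ size k
        |S₁|≡ = ≡.trans (length-take (size k) S) (≡.trans (≡.cong (size k ℕ.⊓_) |S|≡) (ℕₚ.m≤n⇒m⊓n≡m (ℕₚ.m≤m+n (size k) (size k))))

        |S₂|≡ : length S₂ ≡ size k
        |S₂|≡ = ≡.trans (length-drop (size k) S) (≡.trans (≡.cong (ℕ._∸ size k) |S|≡) (ℕₚ.m+n∸m≡n (size k) (size k)))

      on²≤ : ∀ {c′} → Competitive standard (cost standard) A c′ → ∀ k → on² k ≤ c′ * off² k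
      on²≤ {c′} comp k = begin
        on² k
          ≈⟨ losers-online ⟨
        ∑∈ losers (λ e → onlineLoad A [] jobs e ²)
          -- The winner's online load can be given away: its square is of order `power k`, the total
          -- cost of order `k * power k`.
          ≤⟨ x≤y+x (x²≥0 _) ⟩
        ∑∈ (winner ∷ losers) (λ e → onlineLoad A [] jobs e ²)
          ≈⟨ trans (sum-allFin (λ e → onlineLoad A [] jobs e ²)) (∑∈-↭ _ S↭) ⟨
        sum (λ e → onlineLoad A [] jobs e ²)
          ≤⟨ onlineCost≤ A comp jobs offline ⟩
        c′ * sum (λ e → offlineLoad offline e ²)
          ≈⟨ *-congˡ (trans (sum-allFin (λ e → offlineLoad offline e ²)) (∑∈-↭ _ S↭)) ⟩
        c′ * (offlineLoad offline winner ² + ∑∈ losers (λ e → offlineLoad offline e ²))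
          ≈⟨ *-congˡ (trans (+-cong (trans (*-congʳ winner-offline) (zeroˡ _)) losers-offline) (+-identityˡ _)) ⟩
        c′ * off² k ∎
        where
        open Tournament (play k [] (allFin (size k)) (allFin⁺ (size k)) (length-tabulate {n = size k} id))

    deterministic-optimal : OptimalRatio standard (Deterministic standard) c
    -- After division by `power k` the comparison of costs is linear in `k`, and the slack is
    -- bounded by a constant.
    deterministic-optimal A deterministic c′ comp = ratio-bound fromℕ archimedean λ k → *-cancelʳ-≤ (power≰0 k) (begin
      c * fromℕ k * power k
        ≈⟨ trans (*-assoc _ _ _) (trans (*-congˡ (sym (2off²≈ k))) (solve 2 (λ c o → c :* (♯ 2 :* o) := ♯ 2 :* (c :* o)) c (off² k))) ⟩
      fromℕ 2 * (c * off² k)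
        ≤⟨ *-monoˡ-≤ (fromℕ≥0 2) (≤-trans (c*off²≤ k) (+-mono-≤ (on²≤ A deterministic comp k) (slack≤ k))) ⟩
      fromℕ 2 * (c′ * off² k + c * (fromℕ 2 + r) * power k)
        ≈⟨ solve 4 (λ d o s p → ♯ 2 :* (d :* o :+ s :* p) := d :* (♯ 2 :* o) :+ ♯ 2 :* s :* p) c′ (off² k) (c * (fromℕ 2 + r)) (power k) ⟩
      c′ * (fromℕ 2 * off² k) + fromℕ 2 * (c * (fromℕ 2 + r)) * power k
        ≈⟨ trans (+-congʳ (trans (*-congˡ (2off²≈ k)) (sym (*-assoc _ _ _)))) (sym (distribʳ (power k) _ _)) ⟩
      (c′ * fromℕ k + fromℕ 2 * (c * (fromℕ 2 + r))) * power k ∎)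
      where
      slack≤ : ∀ k → slack k ≤ c * (fromℕ 2 + r) * power k
      slack≤ k = *-monoˡ-≤ (*-nonNegative c≥0 (+-nonNegative (fromℕ≥0 2) 0≤r))
        (≤-by (ω≥0 k) (solve 2 (λ p w → p :- (p :- w) := w) (power k) (ω k)))

theorem1p2 : (R : CompleteOrderedField) →
  let open CompleteOrderedField R
      open LoadBalancing R
  in
  WeakDuality standard ×
  WeakDuality hypergraph ×
  (∃[ √2 ] (0# ≤ √2 × √2 * √2 ≈ fromℕ 2 ×
    (let c = fromℕ 3 + fromℕ 2 * √2 in
     AnalyzedByDualFitting standard (Deterministic standard) (greedy standard) (cost standard) c ×
     AnalyzedByDualFitting hypergraph (Deterministic hypergraph) (greedy hypergraph) (cost hypergraph) c ×
     OptimalRatio standard (Deterministic standard) c))) ×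
  AnalyzedByDualFitting standard (Fractional standard) balance expectedCost (fromℕ 5) ×
  AnalyzedByDualFitting standard (Fractional standard) fracBalance (cost standard) (fromℕ 4) ×
  OptimalRatio standard (Fractional standard) (fromℕ 4)
theorem1p2 R =
  weakDuality standard-lawful ,
  weakDuality hypergraph-lawful ,
  (√2 , 0≤√2 , √2²≈2 ,
    Greedy.analysis standard-lawful 0≤√2 √2²≈2 ,
    Greedy.analysis hypergraph-lawful 0≤√2 √2²≈2 ,
    DeterministicLowerBound.Knockout.deterministic-optimal R 0≤√2 √2²≈2) ,
  BalanceAnalysis.analysis R ,
  FracBalanceAnalysis.FracBalance.analysis R 0≤√2 √2²≈2 ,
  FractionalLowerBound.fractional-optimal R
  where
  open OnlineAlgorithms R

  root = squareRoot (fromℕ 2) (fromℕ≥0 2)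
  √2 = proj₁ root
  0≤√2 = proj₁ (proj₂ root)
  √2²≈2 = proj₂ (proj₂ root)
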